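{- Let $f:2^{\mathcal N}\to\mathbb R_{\ge 0}$ be a non-negative, not necessarily monotone, submodular function, let $c:\mathcal N\to(0,\infty)$ be a cost function, $B>0$ a budget with $c(u)\le B$ for all $u\in\mathcal N$, and let $\varepsilon\in(0,1)$. Let $\mathrm{OPT}=\max\{f(X): X\subseteq\mathcal N,\ c(X)\le B\}$. Then the algorithm $\mathsf{ParSKP}(\alpha,\varepsilon,B,f,c)$ (defined in the context), run with $\alpha=\tfrac14$, returns a solution $S$ (a set with $c(S)\le B$) satisfying $$\mathbb E[f(S)]\ \ge\ \Big(\tfrac18-\varepsilon\Big)\,\mathrm{OPT}.$$
   Context: $\mathcal N$ is a finite ground set with $|\mathcal N|=n$. A function $f:2^{\mathcal N}\to\mathbb R$ is submodular if $f(X)+f(Y)\ge f(X\cup Y)+f(X\cap Y)$ for all $X,Y\subseteq\mathcal N$. Write $f(u\mid X)=f(X\cup\{u\})-f(X)$, $f(u)=f(\{u\})$, $c(X)=\sum_{u\in X}c(u)$. The feasible family is $\mathcal I=\{X\subseteq\mathcal N: c(X)\le B\}$ (knapsack constraint). **USM.** $\mathsf{USM}(X)$ is a (possibly randomized, using fresh independent randomness) algorithm that returns a subset of $X$ and is a $(1/2-\varepsilon)$-approximation for unconstrained submodular maximization, i.e. $\mathbb E[f(\mathsf{USM}(X))]\ge(\tfrac12-\varepsilon)\max_{Y\subseteq X}f(Y)$ (expectation over its internal randomness, if any). **GetSEQ$(A,L)$.** Start with the empty sequence $V$. While $L\ne\emptyset$: draw a uniformly random permutation $v_1,\dots,v_{|L|}$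 of $L$; let $s=\max\{i: A\cup V\cup\{v_1,\dots,v_i\}\in\mathcal I\}$; append $v_1,\dots,v_s$ to $V$; replace $L$ by $\{u\in L\setminus V: A\cup V\cup\{u\}\in\mathcal I\}$. Return the ordered sequence $V$. **RandBatch$(\rho,I,M,p,\varepsilon,f,c)$**, for a threshold $\rho>0$, a set $I\subseteq\mathcal N$, a positive integer $M$, a probability $p$ and $\varepsilon\in(0,1)$. Set $A=U=\emptyset$, $count=0$, $L=\{u\in I: f(u\mid A)/c(u)\ge\rho,\ A\cup\{u\}\in\mathcal I\}$. While $L\neq\emptyset$ and $count<M$: (i) $(v_1,\dots,v_d)=\mathsf{GetSEQ}(A,L)$; (ii) for $0\le i\le d$ let $V_i=\{v_1,\dots,v_i\}$, $G_i=A\cup V_i$, $E_i^+=\{u\in L: f(u\mid G_i)/c(u)\ge\rho,\ G_i\cup\{u\}\in\mathcal I\}$, $E_i^-=\{u\in L: f(u\mid G_i)<0\}$, $D_i=\{v_j: 1\le j\le i,\ f(v_j\mid A\cup V_{j-1})<0\}$; (iii) let $t_1$ be the least $i\le d$ with $c(E_i^+)\le(1-\varepsilon)c(L)$, let $t_2$ be the least $i\le d$ with $\varepsilon\sum_{u\in E_i^+}f(u\mid G_i)\le\sum_{u\in E_i^- }|f(u\mid G_i)|+\sum_{v_j\in D_i}|f(v_j\mid A\cup V_{j-1})|$, let $t^*=\min\{t_1,t_2\}$, and set $U\leftarrow U\cup V_{t^*}$; (iv) with probability $p$ (independently) do: $A\leftarrow A\cup V_{t^*}$ and, if $t_2<t_1$,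 $count\leftarrow count+1$; (v) $L\leftarrow\{u\in L\setminus U: f(u\mid A)/c(u)\ge\rho,\ A\cup\{u\}\in\mathcal I\}$. Return $(A,U,L)$. **Probe$(\rho,\mathcal N_1,\mathcal N_2,\varepsilon,B,f,c)$.** Set $T=\emptyset$, $M=\lceil\varepsilon^{ -2}\rceil$, $p=1$. Let $(A_1,U_1,L_1)=\mathsf{RandBatch}(\rho,\mathcal N_1,M,p,\varepsilon,f,c)$ and $(A_2,U_2,L_2)=\mathsf{RandBatch}(\rho,\mathcal N_1\setminus A_1,M,p,\varepsilon,f,c)$. For $i=1,2$: let $e_i$ maximize $f(A_i\cup\{u\})$ over $u\in\mathcal N_1$ with $c(A_i\cup\{u\})\le B$ (if such $u$ exists), and replace $T$ by a set of largest $f$-value among $T,A_i,A_i\cup\{e_i\}$. If $c(\mathcal N_2\cup A_1)\le B$: let $A_3=\mathsf{USM}(\mathcal N_2\cup A_1)$ and replace $T$ by the better (in $f$-value) of $T,A_3$. Return $T$. **ParSKP$(\alpha,\varepsilon,B,f,c)$**, $\alpha\in(0,1)$. Let $\mathcal N_1=\{u\in\mathcal N: c(u)>\varepsilon B/n\}$, $\mathcal N_2=\mathcal N\setminus\mathcal N_1$, $u^*\in\arg\max_{u\in\mathcal N}f(u)$. Let $S$ be the better (in $f$-value) of $\mathsf{USM}(\mathcal N_2)$ and $\{u^*\}$. Let $\rho_{\min}=\alpha f(u^*)/B$, $\rho_{\max}=n^2\alpha f(u^*)/(\varepsilon B)$, $Z=\{(1-\varepsilon)^{ -z}: z\in\mathbb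 Z,\ (1-\varepsilon)^{ -z}\in[\rho_{\min},\rho_{\max}]\}$. For every $\rho\in Z$ run $\mathsf{Probe}(\rho,\mathcal N_1,\mathcal N_2,\varepsilon,B,f,c)$ independently $\lceil\log_{1-\varepsilon}\varepsilon\rceil$ times (all in parallel). Return the set of largest $f$-value among $S$ and all sets returned by the runs of $\mathsf{Probe}$. -}

module Defs where

open import Algebra.Bundles using (CommutativeRing; Semiring)
import Algebra.Definitions.RawSemiring as RawSemiringDefs
import Algebra.Properties.Ring as RingProperties
import Algebra.Properties.CommutativeSemigroup as CommutativeSemigroupProperties
open import Data.Bool.Base using (Bool; true; false; if_then_else_)
open import Data.Fin.Base using (Fin; toℕ)
open import Data.Fin.Subset
  using (Subset; _⊆_; _∪_; _∩_; _─_; ∁; ⁅_⁆; ⋃; ⊥; ∣_∣)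
open import Data.Fin.Subset.Properties using (_∈?_; nonempty?)
open import Data.Integer.Base as ℤ using (ℤ; +_; -[1+_])
open import Data.List.Base as List
  using (List; []; _∷_; _++_; map; concatMap; filter; length; take; lookup;
         allFin; upTo; replicate)
open import Data.List.Membership.Propositional using () renaming (_∈_ to _∈ˡ_)
open import Data.List.Membership.Propositional.Properties
  using (∈-filter⁺; ∈-++⁺ˡ; ∈-++⁺ʳ; ∈-map⁺; ∈-upTo⁺)
open import Data.List.Relation.Unary.All as All using (All)
open import Data.List.Relation.Unary.Any using (here; there)
import Data.List.Extrema as Extrema
open import Data.Nat.Base as ℕ using (ℕ; zero; suc; z≤n; s≤s)
import Data.Nat.Properties as ℕₚ
open import Data.Product.Base using (_×_; _,_; ∃; proj₁; proj₂)
import Data.Sum.Base as Sum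
open import Data.Vec.Base using (tabulate)
open import Function.Base using (_∘_)
open import Level using (Level; _⊔_) renaming (suc to lsuc)
open import Relation.Binary.Core using (Rel)
open import Relation.Binary.Bundles using (DecTotalOrder)
open import Relation.Binary.Structures using (IsDecTotalOrder)
import Relation.Binary.Reasoning.PartialOrder as PartialOrderReasoning
import Relation.Binary.Construct.NonStrictToStrict as NonStrictToStrict
open import Relation.Binary.Definitions using () renaming (Decidable to Decidable₂)
open import Relation.Binary.PropositionalEquality as ≡ using (_≡_)
open import Relation.Nullary using (¬_; yes; no; does; contradiction)
open import Relation.Nullary.Decidable using (_×-dec_)
open import Relation.Unary using (Pred; Decidable)

-- The standard library has no real numbers.  Everything below is stated over an
-- arbitrary Archimedean ordered field with decidable order: classically these are
-- exactly the subfields of ℝ, and ℝ itself is one of them.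
record ArchimedeanField a ℓ₁ ℓ₂ : Set (lsuc (a ⊔ ℓ₁ ⊔ ℓ₂)) where
  field
    commutativeRing : CommutativeRing a ℓ₁
  open CommutativeRing commutativeRing public
  open RawSemiringDefs (Semiring.rawSemiring semiring) public
    using (_^_; sum) renaming (_×_ to _·_)

  fromℕ : ℕ → Carrier
  fromℕ k = k · 1#

  infix 4 _≤_
  infix 8 _⁻¹
  field
    _≤_             : Rel Carrier ℓ₂
    isDecTotalOrder : IsDecTotalOrder _≈_ _≤_
    0≉1             : ¬ (0# ≈ 1#)
    +-monoʳ-≤       : ∀ z {x y} → x ≤ y → z + x ≤ z + y
    *-nonNegative   : ∀ {x y} → 0# ≤ x → 0# ≤ y → 0# ≤ x * y
    -- Total, with an unspecified value at 0#.
    _⁻¹             : Carrier → Carrier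
    *-inverseʳ      : ∀ {x} → ¬ (x ≈ 0#) → x * x ⁻¹ ≈ 1#
    archimedean     : ∀ x → ∃ λ k → x ≤ fromℕ k

  decTotalOrder : DecTotalOrder a ℓ₁ ℓ₂
  decTotalOrder = record { isDecTotalOrder = isDecTotalOrder }

  open DecTotalOrder decTotalOrder public
    using (_≟_; _≤?_; totalOrder)
    renaming (total to ≤-total; refl to ≤-refl; trans to ≤-trans;
              reflexive to ≤-reflexive; antisym to ≤-antisym)
  open NonStrictToStrict _≈_ _≤_ public using (_<_)

  infix 4 _<?_
  _<?_ : Decidable₂ _<_
  _<?_ = NonStrictToStrict.<-decidable _≈_ _≤_ _≟_ _≤?_

  infixl 7 _/_
  _/_ : Carrier → Carrier → Carrier
  x / y = x * y ⁻¹

  abs : Carrier → Carrier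
  abs x = if does (0# ≤? x) then x else - x

  infixr 8 _^ℤ_
  _^ℤ_ : Carrier → ℤ → Carrier
  x ^ℤ (+ k)    = x ^ k
  x ^ℤ -[1+ k ] = (x ⁻¹) ^ suc k

-- The least (greatest) i ≤ m satisfying P, or m (respectively 0) if there is none.
least greatest : ∀ {p} {P : Pred ℕ p} → Decidable P → ℕ → ℕ
least    P? zero    = zero
least    P? (suc m) = if does (P? zero) then zero else suc (least (P? ∘ suc) m)
greatest P? zero    = zero
greatest P? (suc m) = if does (P? (suc m)) then suc m else greatest P? m

least-satisfies : ∀ {p} {P : Pred ℕ p} (P? : Decidable P) {m} → P m → P (least P? m)
least-satisfies P? {zero}  Pm = Pm
least-satisfies P? {suc m} Pm with P? zero
... | yes P0 = P0
... | no  _  = least-satisfies (P? ∘ suc) Pm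

least-minimal : ∀ {p} {P : Pred ℕ p} (P? : Decidable P) m {k} → P k → least P? m ℕ.≤ k
least-minimal P? zero    Pk = z≤n
least-minimal P? (suc m) {k} Pk with P? zero
least-minimal P? (suc m) {k}     Pk | yes _  = z≤n
least-minimal P? (suc m) {zero}  Pk | no ¬P0 = contradiction Pk ¬P0
least-minimal P? (suc m) {suc k} Pk | no ¬P0 = s≤s (least-minimal (P? ∘ suc) m Pk)

⟪_⟫ : ∀ {n p} {P : Pred (Fin n) p} → Decidable P → Subset n
⟪ P? ⟫ = tabulate (does ∘ P?)

elements : ∀ {n} → Subset n → List (Fin n)
elements X = filter (_∈? X) (allFin _)

fromList : ∀ {n} → List (Fin n) → Subset n
fromList = ⋃ ∘ map ⁅_⁆

insertions : ∀ {a} {A : Set a} → A → List A → List (List A)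
insertions x []       = (x ∷ []) ∷ []
insertions x (y ∷ ys) = (x ∷ y ∷ ys) ∷ map (y ∷_) (insertions x ys)

-- All length xs ! orderings of xs.
permutations : ∀ {a} {A : Set a} → List A → List (List A)
permutations []       = [] ∷ []
permutations (x ∷ xs) = concatMap (insertions x) (permutations xs)

module OrderedFieldProperties {a ℓ₁ ℓ₂} (𝔽 : ArchimedeanField a ℓ₁ ℓ₂) where
  open ArchimedeanField 𝔽
  open RingProperties ring using (-‿distribʳ-*; -‿distribˡ-*; -‿involutive)
  open CommutativeSemigroupProperties *-commutativeSemigroup using (x∙yz≈y∙xz)
  open PartialOrderReasoning (DecTotalOrder.poset decTotalOrder)

  *-monoˡ-≤ : ∀ {z x y} → 0# ≤ z → x ≤ y → z * x ≤ z * y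
  *-monoˡ-≤ {z} {x} {y} 0≤z x≤y = begin
    z * x                      ≈⟨ +-identityʳ _ ⟨
    z * x + 0#                 ≤⟨ +-monoʳ-≤ _ (*-nonNegative 0≤z 0≤y-x) ⟩
    z * x + z * (- x + y)      ≈⟨ distribˡ _ _ _ ⟨
    z * (x + (- x + y))        ≈⟨ *-congˡ (+-assoc _ _ _) ⟨
    z * ((x + - x) + y)        ≈⟨ *-congˡ (+-congʳ (-‿inverseʳ x)) ⟩
    z * (0# + y)               ≈⟨ *-congˡ (+-identityˡ y) ⟩
    z * y                      ∎
    where
    0≤y-x : 0# ≤ - x + y
    0≤y-x = begin
      0#      ≈⟨ -‿inverseˡ x ⟨
      - x + x ≤⟨ +-monoʳ-≤ _ x≤y ⟩
      - x + y ∎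

  *-monoʳ-≤ : ∀ {z x y} → 0# ≤ z → x ≤ y → x * z ≤ y * z
  *-monoʳ-≤ {z} {x} {y} 0≤z x≤y = begin
    x * z ≈⟨ *-comm x z ⟩
    z * x ≤⟨ *-monoˡ-≤ 0≤z x≤y ⟩
    z * y ≈⟨ *-comm z y ⟩
    y * z ∎

  x≤y+x : ∀ {x y} → 0# ≤ y → x ≤ y + x
  x≤y+x {x} {y} 0≤y = begin
    x      ≈⟨ +-identityʳ x ⟨
    x + 0# ≤⟨ +-monoʳ-≤ x 0≤y ⟩
    x + y  ≈⟨ +-comm x y ⟩
    y + x  ∎

  +-nonNegative : ∀ {x y} → 0# ≤ x → 0# ≤ y → 0# ≤ x + y
  +-nonNegative 0≤x 0≤y = ≤-trans 0≤y (x≤y+x 0≤x)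

  0≤1 : 0# ≤ 1#
  0≤1 with ≤-total 0# 1#
  ... | Sum.inj₁ 0≤1 = 0≤1
  ... | Sum.inj₂ 1≤0 = begin
    0#            ≤⟨ *-nonNegative 0≤-1 0≤-1 ⟩
    - 1# * - 1#   ≈⟨ -‿distribˡ-* 1# (- 1#) ⟨
    - (1# * - 1#) ≈⟨ -‿cong (*-identityˡ _) ⟩
    - - 1#        ≈⟨ -‿involutive 1# ⟩
    1#            ∎
    where
    0≤-1 : 0# ≤ - 1#
    0≤-1 = begin
      0#         ≈⟨ -‿inverseˡ 1# ⟨
      - 1# + 1#  ≤⟨ +-monoʳ-≤ _ 1≤0 ⟩
      - 1# + 0#  ≈⟨ +-identityʳ _ ⟩
      - 1#       ∎

  1≰0 : ¬ (1# ≤ 0#)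
  1≰0 1≤0 = 0≉1 (≤-antisym 0≤1 1≤0)

  <⇒≉ : ∀ {x} → 0# < x → ¬ (x ≈ 0#)
  <⇒≉ (_ , 0≉x) x≈0 = 0≉x (sym x≈0)

  ⁻¹-nonNegative : ∀ {x} → 0# < x → 0# ≤ x ⁻¹
  ⁻¹-nonNegative {x} 0<x@(0≤x , _) with ≤-total 0# (x ⁻¹)
  ... | Sum.inj₁ 0≤x⁻¹ = 0≤x⁻¹
  ... | Sum.inj₂ x⁻¹≤0 = contradiction 1≤0 1≰0
    where
    1≤0 : 1# ≤ 0#
    1≤0 = begin
      1#       ≈⟨ *-inverseʳ (<⇒≉ 0<x) ⟨
      x * x ⁻¹ ≤⟨ *-monoˡ-≤ 0≤x x⁻¹≤0 ⟩
      x * 0#   ≈⟨ zeroʳ x ⟩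
      0#       ∎

  *-positive : ∀ {x y} → 0# < x → 0# < y → 0# < x * y
  *-positive {x} {y} 0<x@(0≤x , _) 0<y@(0≤y , 0≉y) =
    *-nonNegative 0≤x 0≤y , λ 0≈xy → 0≉y (begin-equality
      0#             ≈⟨ zeroʳ _ ⟨
      x ⁻¹ * 0#      ≈⟨ *-congˡ 0≈xy ⟩
      x ⁻¹ * (x * y) ≈⟨ *-assoc _ _ _ ⟨
      x ⁻¹ * x * y   ≈⟨ *-congʳ (trans (*-comm _ _) (*-inverseʳ (<⇒≉ 0<x))) ⟩
      1# * y         ≈⟨ *-identityˡ y ⟩
      y              ∎)

  *≤⇒≤/ : ∀ {x y z} → 0# < z → x * z ≤ y → x ≤ y / z
  *≤⇒≤/ {x} {y} {z} 0<z xz≤y = begin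
    x              ≈⟨ *-identityʳ x ⟨
    x * 1#         ≈⟨ *-congˡ (*-inverseʳ (<⇒≉ 0<z)) ⟨
    x * (z * z ⁻¹) ≈⟨ *-assoc _ _ _ ⟨
    x * z * z ⁻¹   ≤⟨ *-monoʳ-≤ (⁻¹-nonNegative 0<z) xz≤y ⟩
    y / z          ∎

  ^-nonNegative : ∀ {x} → 0# ≤ x → ∀ k → 0# ≤ x ^ k
  ^-nonNegative 0≤x zero    = 0≤1
  ^-nonNegative 0≤x (suc k) = *-nonNegative 0≤x (^-nonNegative 0≤x k)

  fromℕ-nonNegative : ∀ k → 0# ≤ fromℕ k
  fromℕ-nonNegative zero    = ≤-refl
  fromℕ-nonNegative (suc k) = +-nonNegative 0≤1 (fromℕ-nonNegative k)

  fromℕ-mono-≤ : ∀ {j k} → j ℕ.≤ k → fromℕ j ≤ fromℕ k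
  fromℕ-mono-≤ {k = k} z≤n = fromℕ-nonNegative k
  fromℕ-mono-≤ (s≤s j≤k)   = +-monoʳ-≤ 1# (fromℕ-mono-≤ j≤k)

  fromℕ-cancel-≤ : ∀ {j k} → fromℕ j ≤ fromℕ k → j ℕ.≤ k
  fromℕ-cancel-≤ {j} {k} fj≤fk with j ℕₚ.≤? k
  ... | yes j≤k = j≤k
  ... | no  j≰k = contradiction 1≤0 1≰0
    where
    1≤0 : 1# ≤ 0#
    1≤0 = begin
      1#                            ≈⟨ +-identityʳ 1# ⟨
      1# + 0#                       ≈⟨ +-congˡ (-‿inverseʳ _) ⟨
      1# + (fromℕ k + - fromℕ k)    ≈⟨ +-assoc _ _ _ ⟨
      fromℕ (suc k) + - fromℕ k     ≈⟨ +-comm _ _ ⟩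
      - fromℕ k + fromℕ (suc k)     ≤⟨ +-monoʳ-≤ _ (fromℕ-mono-≤ (ℕₚ.≰⇒> j≰k)) ⟩
      - fromℕ k + fromℕ j           ≤⟨ +-monoʳ-≤ _ fj≤fk ⟩
      - fromℕ k + fromℕ k           ≈⟨ -‿inverseˡ _ ⟩
      0#                            ∎

  ⁻¹^*^ : ∀ {x} → ¬ (x ≈ 0#) → ∀ k → (x ⁻¹) ^ k * x ^ k ≈ 1#
  ⁻¹^*^ x≉0 zero = *-identityˡ 1#
  ⁻¹^*^ {x} x≉0 (suc k) = begin-equality
    (x ⁻¹ * (x ⁻¹) ^ k) * (x * x ^ k) ≈⟨ *-assoc _ _ _ ⟩
    x ⁻¹ * ((x ⁻¹) ^ k * (x * x ^ k)) ≈⟨ *-congˡ (x∙yz≈y∙xz _ _ _) ⟩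
    x ⁻¹ * (x * ((x ⁻¹) ^ k * x ^ k)) ≈⟨ *-congˡ (*-congˡ (⁻¹^*^ x≉0 k)) ⟩
    x ⁻¹ * (x * 1#)                   ≈⟨ *-congˡ (*-identityʳ x) ⟩
    x ⁻¹ * x                          ≈⟨ *-comm _ _ ⟩
    x * x ⁻¹                          ≈⟨ *-inverseʳ x≉0 ⟩
    1#                                ∎

  module _ {ε} (0<ε : 0# < ε) (ε<1 : ε < 1#) where
    private
      q = 1# - ε
      0≤ε = proj₁ 0<ε

    q+ε≈1 : q + ε ≈ 1#
    q+ε≈1 = begin-equality
      (1# + - ε) + ε ≈⟨ +-assoc _ _ _ ⟩
      1# + (- ε + ε) ≈⟨ +-congˡ (-‿inverseˡ ε) ⟩
      1# + 0#        ≈⟨ +-identityʳ 1# ⟩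
      1#             ∎

    0<1-ε : 0# < q
    0<1-ε = 0≤q , λ 0≈q → proj₂ ε<1 (begin-equality
      ε      ≈⟨ +-identityˡ ε ⟨
      0# + ε ≈⟨ +-congʳ 0≈q ⟩
      q + ε  ≈⟨ q+ε≈1 ⟩
      1#     ∎)
      where
      0≤q : 0# ≤ q
      0≤q = begin
        0#        ≈⟨ -‿inverseˡ ε ⟨
        - ε + ε   ≤⟨ +-monoʳ-≤ _ (proj₁ ε<1) ⟩
        - ε + 1#  ≈⟨ +-comm _ _ ⟩
        q         ∎

    bernoulli-bound : ∀ k → q ^ k * (1# + fromℕ k * ε) ≤ 1#
    bernoulli-bound zero = begin
      1# * (1# + 0# * ε) ≈⟨ *-identityˡ _ ⟩
      1# + 0# * ε        ≈⟨ +-congˡ (zeroˡ ε) ⟩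
      1# + 0#            ≈⟨ +-identityʳ 1# ⟩
      1#                 ∎
    bernoulli-bound (suc k) = begin
      q * q ^ k * (1# + (1# + fromℕ k) * ε) ≈⟨ *-congʳ (*-comm _ _) ⟩
      q ^ k * q * (1# + (1# + fromℕ k) * ε) ≈⟨ *-assoc _ _ _ ⟩
      q ^ k * (q * (1# + (1# + fromℕ k) * ε))
        ≈⟨ *-congˡ (*-congˡ (+-congˡ (trans (distribʳ _ _ _) (+-congʳ (*-identityˡ ε))))) ⟩
      q ^ k * (q * (1# + (ε + s)))          ≤⟨ *-monoˡ-≤ (^-nonNegative (proj₁ 0<1-ε) k) step ⟩
      q ^ k * (1# + s)                      ≤⟨ bernoulli-bound k ⟩
      1#                                    ∎
      where
      s = fromℕ k * ε
      0≤s = *-nonNegative (fromℕ-nonNegative k) 0≤ε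
      step : q * (1# + (ε + s)) ≤ 1# + s
      step = begin
        q * (1# + (ε + s))                  ≤⟨ x≤y+x (*-nonNegative 0≤ε (+-nonNegative 0≤ε 0≤s)) ⟩
        ε * (ε + s) + q * (1# + (ε + s))    ≈⟨ +-congˡ (distribˡ _ _ _) ⟩
        ε * (ε + s) + (q * 1# + q * (ε + s)) ≈⟨ +-comm _ _ ⟩
        (q * 1# + q * (ε + s)) + ε * (ε + s) ≈⟨ +-assoc _ _ _ ⟩
        q * 1# + (q * (ε + s) + ε * (ε + s)) ≈⟨ +-cong (*-identityʳ q) (sym (distribʳ _ _ _)) ⟩
        q + (q + ε) * (ε + s)               ≈⟨ +-congˡ (*-congʳ q+ε≈1) ⟩
        q + 1# * (ε + s)                    ≈⟨ +-congˡ (*-identityˡ _) ⟩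
        q + (ε + s)                         ≈⟨ +-assoc _ _ _ ⟨
        (q + ε) + s                         ≈⟨ +-congʳ q+ε≈1 ⟩
        1# + s                              ∎

    ^-bound : ∀ k → q ^ k * (fromℕ k * ε) ≤ 1#
    ^-bound k = ≤-trans
      (*-monoˡ-≤ (^-nonNegative (proj₁ 0<1-ε) k) (x≤y+x 0≤1))
      (bernoulli-bound k)

module Constants {a ℓ₁ ℓ₂} (𝔽 : ArchimedeanField a ℓ₁ ℓ₂) where
  open ArchimedeanField 𝔽
  open OrderedFieldProperties 𝔽
  open CommutativeSemigroupProperties *-commutativeSemigroup using (x∙yz≈y∙xz)
  open PartialOrderReasoning (DecTotalOrder.poset decTotalOrder)

  ⌈_⌉ : Carrier → ℕ
  ⌈ x ⌉ = least (λ k → x ≤? fromℕ k) (proj₁ (archimedean x))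

  -- ⌈log_{1-ε} ε⌉: since 0 < 1 - ε < 1, log_{1-ε} ε ≤ k iff (1 - ε)ᵏ ≤ ε.  For the
  -- search bound see ⌈log⌉-satisfies.
  ⌈log[1-_]_⌉ : Carrier → Carrier → ℕ
  ⌈log[1- ε ] x ⌉ = least (λ k → (1# - ε) ^ k ≤? x) ⌈ (x * ε) ⁻¹ ⌉

  gridPoint : Carrier → ℤ → Carrier
  gridPoint ε z = (1# - ε) ^ℤ (ℤ.- z)

  integersUpTo : ℕ → List ℤ
  integersUpTo m = map +_ (upTo (suc m)) ++ map -[1+_] (upTo m)

  -- The z ∈ ℤ with (1 - ε)^{-z} ∈ [lo , hi], each listed once.  For 0 < lo the
  -- search range is large enough by gridExponents-complete; for lo ≈ hi ≈ 0 there is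
  -- no such z.
  gridExponents : (ε lo hi : Carrier) → List ℤ
  gridExponents ε lo hi =
    filter (λ z → (lo ≤? gridPoint ε z) ×-dec (gridPoint ε z ≤? hi))
           (integersUpTo (⌈ hi / ε ⌉ ℕ.+ ⌈ (lo * ε) ⁻¹ ⌉))

  ⌈⌉-satisfies : ∀ x → x ≤ fromℕ ⌈ x ⌉
  ⌈⌉-satisfies x =
    least-satisfies (λ k → x ≤? fromℕ k) {proj₁ (archimedean x)} (proj₂ (archimedean x))

  module _ {ε} (0<ε : 0# < ε) (ε<1 : ε < 1#) where
    private q = 1# - ε

    ⌈log⌉-satisfies : ∀ {x} → 0# < x → q ^ ⌈log[1- ε ] x ⌉ ≤ x
    ⌈log⌉-satisfies {x} 0<x = least-satisfies (λ k → q ^ k ≤? x) {m} (begin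
      q ^ m                         ≈⟨ *-identityʳ _ ⟨
      q ^ m * 1#                    ≈⟨ *-congˡ (*-inverseʳ (<⇒≉ 0<xε)) ⟨
      q ^ m * (x * ε * (x * ε) ⁻¹)
        ≤⟨ *-monoˡ-≤ (^-nonNegative (proj₁ (0<1-ε 0<ε ε<1)) m)
             (*-monoˡ-≤ (proj₁ 0<xε) (⌈⌉-satisfies ((x * ε) ⁻¹))) ⟩
      q ^ m * (x * ε * fromℕ m)     ≈⟨ *-congˡ (*-assoc _ _ _) ⟩
      q ^ m * (x * (ε * fromℕ m))   ≈⟨ *-congˡ (*-congˡ (*-comm _ _)) ⟩
      q ^ m * (x * (fromℕ m * ε))   ≈⟨ x∙yz≈y∙xz _ _ _ ⟩
      x * (q ^ m * (fromℕ m * ε))   ≤⟨ *-monoˡ-≤ (proj₁ 0<x) (^-bound 0<ε ε<1 m) ⟩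
      x * 1#                        ≈⟨ *-identityʳ x ⟩
      x                             ∎)
      where
      m = ⌈ (x * ε) ⁻¹ ⌉
      0<xε = *-positive 0<x 0<ε

    gridExponents-complete : ∀ {lo hi} → 0# < lo → ∀ z →
      lo ≤ gridPoint ε z → gridPoint ε z ≤ hi → z ∈ˡ gridExponents ε lo hi
    gridExponents-complete {lo} {hi} 0<lo z lo≤ ≤hi =
      ∈-filter⁺ (λ z → (lo ≤? gridPoint ε z) ×-dec (gridPoint ε z ≤? hi))
                (inRange z lo≤ ≤hi) (lo≤ , ≤hi)
      where
      K₁ = ⌈ hi / ε ⌉
      K₂ = ⌈ (lo * ε) ⁻¹ ⌉

      inRange : ∀ z → lo ≤ gridPoint ε z → gridPoint ε z ≤ hi →
                z ∈ˡ integersUpTo (K₁ ℕ.+ K₂)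
      inRange (+ zero)  _ _ = here ≡.refl
      inRange (+ suc k) _ ≤hi = ∈-++⁺ˡ (∈-map⁺ +_ (∈-upTo⁺
        (s≤s (ℕₚ.m≤n⇒m≤n+o K₂ (fromℕ-cancel-≤ {suc k} {K₁} (≤-trans
          (*≤⇒≤/ 0<ε bound) (⌈⌉-satisfies (hi / ε))))))))
        where
        j = suc k
        r = (q ⁻¹) ^ j
        q≉0 = <⇒≉ (0<1-ε 0<ε ε<1)
        0≤r = ^-nonNegative (⁻¹-nonNegative (0<1-ε 0<ε ε<1)) j
        bound : fromℕ j * ε ≤ hi
        bound = begin
          fromℕ j * ε               ≈⟨ *-identityˡ _ ⟨
          1# * (fromℕ j * ε)        ≈⟨ *-congʳ (⁻¹^*^ q≉0 j) ⟨
          r * q ^ j * (fromℕ j * ε) ≈⟨ *-assoc _ _ _ ⟩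
          r * (q ^ j * (fromℕ j * ε)) ≤⟨ *-monoˡ-≤ 0≤r (^-bound 0<ε ε<1 j) ⟩
          r * 1#                    ≈⟨ *-identityʳ r ⟩
          r                         ≤⟨ ≤hi ⟩
          hi                        ∎
      inRange -[1+ k ] lo≤ _ = ∈-++⁺ʳ _ (∈-map⁺ -[1+_] (∈-upTo⁺
        (ℕₚ.m≤n⇒m≤o+n K₁ (fromℕ-cancel-≤ {suc k} {K₂} (≤-trans
          (≤-trans (*≤⇒≤/ 0<loε bound) (≤-reflexive (*-identityˡ _)))
          (⌈⌉-satisfies ((lo * ε) ⁻¹)))))))
        where
        j = suc k
        0<loε = *-positive 0<lo 0<ε
        bound : fromℕ j * (lo * ε) ≤ 1#
        bound = begin
          fromℕ j * (lo * ε)    ≈⟨ x∙yz≈y∙xz _ _ _ ⟩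
          lo * (fromℕ j * ε)
            ≤⟨ *-monoʳ-≤ (*-nonNegative (fromℕ-nonNegative j) (proj₁ 0<ε)) lo≤ ⟩
          q ^ j * (fromℕ j * ε) ≤⟨ ^-bound 0<ε ε<1 j ⟩
          1#                    ∎

-- Finitely supported distributions, as lists of (probability , outcome).
module Probability {a ℓ₁ ℓ₂} (𝔽 : ArchimedeanField a ℓ₁ ℓ₂) where
  open ArchimedeanField 𝔽

  private
    variable
      x y p : Level
      X : Set x
      Y : Set y

  Dist : Set x → Set (a ⊔ x)
  Dist X = List (Carrier × X)

  𝔼 : (X → Carrier) → Dist X → Carrier
  𝔼 g []            = 0#
  𝔼 g ((w , x) ∷ d) = w * g x + 𝔼 g d

  IsDistribution : {X : Set x} → Dist X → Set (a ⊔ ℓ₁ ⊔ ℓ₂ ⊔ x)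
  IsDistribution d = All (λ (w , _) → 0# ≤ w) d × 𝔼 (λ _ → 1#) d ≈ 1#

  AlmostSurely : {X : Set x} → Pred X p → Dist X → Set (a ⊔ ℓ₁ ⊔ ℓ₂ ⊔ x ⊔ p)
  AlmostSurely P d = All (λ (w , s) → 0# < w → P s) d

  return : X → Dist X
  return x = (1# , x) ∷ []

  infixl 1 _>>=_
  _>>=_ : Dist X → (X → Dist Y) → Dist Y
  d >>= k = concatMap (λ (w , x) → map (λ (v , y) → w * v , y) (k x)) d

  bernoulli : Carrier → Dist Bool
  bernoulli p = (p , true) ∷ (1# - p , false) ∷ []

  uniform : List X → Dist X
  uniform xs = map (λ x → fromℕ (length xs) ⁻¹ , x) xs

  independently : List (Dist X) → Dist (List X)
  independently []       = return []
  independently (d ∷ ds) = do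
    x  ← d
    xs ← independently ds
    return (x ∷ xs)

module Knapsack {a ℓ₁ ℓ₂} (𝔽 : ArchimedeanField a ℓ₁ ℓ₂) where
  open ArchimedeanField 𝔽
  open Constants 𝔽
  open Probability 𝔽

  Submodular : ∀ {n} → (Subset n → Carrier) → Set ℓ₂
  Submodular f = ∀ X Y → f (X ∪ Y) + f (X ∩ Y) ≤ f X + f Y

  Σ[_] : ∀ {m} → Subset m → (Fin m → Carrier) → Carrier
  Σ[ X ] g = sum (λ u → if does (u ∈? X) then g u else 0#)

  Feasible : ∀ {n} → (Fin n → Carrier) → Carrier → Pred (Subset n) ℓ₂
  Feasible c B X = Σ[ X ] c ≤ B

  IsMaximum : ∀ {n p} → (Subset n → Carrier) → Pred (Subset n) p → Carrier →
              Set (ℓ₁ ⊔ ℓ₂ ⊔ p)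
  IsMaximum f P m = (∃ λ X → P X × f X ≈ m) × (∀ X → P X → f X ≤ m)

  record IsUSM {n} (f : Subset n → Carrier) (ε : Carrier)
               (usm : Subset n → Dist (Subset n)) : Set (a ⊔ ℓ₁ ⊔ ℓ₂) where
    field
      isDistribution : ∀ X → IsDistribution (usm X)
      subset         : ∀ X → AlmostSurely (_⊆ X) (usm X)
      approximation  : ∀ X max → IsMaximum f (_⊆ X) max →
                       (fromℕ 2 ⁻¹ - ε) * max ≤ 𝔼 f (usm X)

  -- A rule choosing a maximiser of g in the nonempty list x ∷ xs; the rule used by
  -- the algorithm to break ties is left arbitrary.
  record ArgMax : Set (lsuc Level.zero ⊔ a ⊔ ℓ₂) where
    field
      argmax         : {X : Set} → (X → Carrier) → X → List X → X
      argmax-∈       : ∀ {X} (g : X → Carrier) x xs → argmax g x xs ∈ˡ x ∷ xs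
      argmax-maximal : ∀ {X} (g : X → Carrier) x xs {y} → y ∈ˡ x ∷ xs →
                       g y ≤ g (argmax g x xs)

  extremaArgMax : ArgMax
  extremaArgMax = record
    { argmax         = E.argmax
    ; argmax-∈       = λ g x xs → Sum.[ here , there ]′ (E.argmax-sel g x xs)
    ; argmax-maximal = λ where
        g x xs (here ≡.refl) → E.f[⊥]≤f[argmax] {f = g} x xs
        g x xs (there y∈xs)  → All.lookup (E.f[xs]≤f[argmax] {f = g} x xs) y∈xs
    } where module E = Extrema totalOrder

  module Algorithm (argMax : ArgMax) {n : ℕ}
                   (usm : Subset n → Dist (Subset n))
                   (B : Carrier) (f : Subset n → Carrier) (c : Fin n → Carrier)
                   where
    open ArgMax argMax

    infix 9 _∣_
    _∣_ : Fin n → Subset n → Carrier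
    u ∣ X = f (X ∪ ⁅ u ⁆) - f X

    cost : Subset n → Carrier
    cost X = Σ[ X ] c

    feasible? : Decidable (Feasible c B)
    feasible? X = cost X ≤? B

    -- Every round removes at least the first permuted element from L, so ∣ L ∣ rounds
    -- exhaust it.
    getSEQ : Subset n → Subset n → Dist (List (Fin n))
    getSEQ A L₀ = loop ∣ L₀ ∣ [] L₀
      where
      loop : ℕ → List (Fin n) → Subset n → Dist (List (Fin n))
      loop zero    V L = return V
      loop (suc k) V L = if does (nonempty? L)
        then (do
          vs ← uniform (permutations (elements L))
          let s  = greatest (λ i → feasible? (A ∪ fromList V ∪ fromList (take i vs)))
                            (length vs)
              V′ = V ++ take s vs
              L′ = ⟪ (λ u → u ∈? (L ─ fromList V′)
                            ×-dec feasible? (A ∪ fromList V′ ∪ ⁅ u ⁆)) ⟫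
          loop k V′ L′)
        else return V

    -- {u ∈ X : f(u ∣ G) / c(u) ≥ ρ, G ∪ {u} ∈ 𝓘}
    candidates : Carrier → Subset n → Subset n → Subset n
    candidates ρ X G =
      ⟪ (λ u → u ∈? X ×-dec ((ρ ≤? (u ∣ G) / c u) ×-dec feasible? (G ∪ ⁅ u ⁆))) ⟫

    -- t* for the sequence vs = v₁,…,v_d, and whether t₂ < t₁.  Both minima are taken
    -- over nonempty sets: at i = d the set E⁺ is empty when vs comes from getSEQ A L
    -- and ρ > 0.
    module Cut (ρ ε : Carrier) (A L : Subset n) (vs : List (Fin n)) where
      d : ℕ
      d = length vs

      V G E⁺ E⁻ : ℕ → Subset n
      V i  = fromList (take i vs)
      G i  = A ∪ V i
      E⁺ i = candidates ρ L (G i)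
      E⁻ i = ⟪ (λ u → u ∈? L ×-dec ((u ∣ G i) <? 0#)) ⟫

      -- Indices are shifted by one: j : Fin d stands for v_{j+1}, whose marginal is
      -- taken with respect to A ∪ V j.
      marginal : Fin d → Carrier
      marginal j = lookup vs j ∣ (A ∪ V (toℕ j))

      -- D i as a set of positions in vs.
      D : ℕ → Subset d
      D i = ⟪ (λ j → (toℕ j ℕₚ.<? i) ×-dec (marginal j <? 0#)) ⟫

      t₁ t₂ t* : ℕ
      t₁ = least (λ i → cost (E⁺ i) ≤? (1# - ε) * cost L) d
      t₂ = least (λ i → ε * Σ[ E⁺ i ] (_∣ G i) ≤?
                        Σ[ E⁻ i ] (λ u → abs (u ∣ G i)) +
                        Σ[ D i ] (λ j → abs (marginal j))) d
      t* = t₁ ℕ.⊓ t₂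

    -- Every round with ρ > 0 has t* ≥ 1 and so adds an element of L ⊆ ∁ U to U:
    -- n rounds suffice.
    randBatch : (ρ : Carrier) (I : Subset n) (M : ℕ) (p ε : Carrier) →
                Dist (Subset n × Subset n × Subset n)
    randBatch ρ I M p ε = loop n ⊥ ⊥ (candidates ρ I ⊥) 0
      where
      loop : ℕ → (A U L : Subset n) → ℕ → Dist (Subset n × Subset n × Subset n)
      loop zero    A U L count = return (A , U , L)
      loop (suc k) A U L count = if does (nonempty? L ×-dec (count ℕₚ.<? M))
        then (do
          vs ← getSEQ A L
          let open Cut ρ ε A L vs
              U′ = U ∪ V t*
          accept ← bernoulli p
          let A′     = if accept then A ∪ V t* else A
              count′ = if accept then (if does (t₂ ℕₚ.<? t₁) then suc count else count)
                                 else count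
          loop k A′ U′ (candidates ρ (L ─ U′) A′) count′)
        else return (A , U , L)

    probe : (ρ : Carrier) (N₁ N₂ : Subset n) (ε : Carrier) → Dist (Subset n)
    probe ρ N₁ N₂ ε = do
      (A₁ , _ , _) ← randBatch ρ N₁ M 1# ε
      (A₂ , _ , _) ← randBatch ρ (N₁ ─ A₁) M 1# ε
      let T = improve A₂ (improve A₁ ⊥)
      if does (feasible? (N₂ ∪ A₁))
        then (do
          A₃ ← usm (N₂ ∪ A₁)
          return (argmax f T (A₃ ∷ [])))
        else return T
      where
      M : ℕ
      M = ⌈ (ε ^ 2) ⁻¹ ⌉

      -- [ A ∪ {e} ] for a best feasible e ∈ N₁, or [] if there is none.
      augment : Subset n → List (Subset n)
      augment A with filter (λ u → feasible? (A ∪ ⁅ u ⁆)) (elements N₁)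
      ... | []     = []
      ... | u ∷ us = (A ∪ ⁅ argmax (λ e → f (A ∪ ⁅ e ⁆)) u us ⁆) ∷ []

      improve : Subset n → Subset n → Subset n
      improve A T = argmax f T (A ∷ augment A)

    -- u* is meant to be an element maximising f {u}.
    parSKP : (u* : Fin n) (α ε : Carrier) → Dist (Subset n)
    parSKP u* α ε = do
      S₀   ← usm N₂
      let S = argmax f S₀ (⁅ u* ⁆ ∷ [])
      outs ← independently
               (concatMap (λ z → replicate ⌈log[1- ε ] ε ⌉
                                           (probe (gridPoint ε z) N₁ N₂ ε))
                          (gridExponents ε ρmin ρmax))
      return (argmax f S outs)
      where
      N₁ N₂ : Subset n
      N₁ = ⟪ (λ u → ε * B / fromℕ n <? c u) ⟫
      N₂ = ∁ N₁

      ρmin ρmax : Carrier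
      ρmin = α * f ⁅ u* ⁆ / B
      ρmax = fromℕ n ^ 2 * α * f ⁅ u* ⁆ / (ε * B)

{-# OPTIONS --safe #-}

-- One run of Probe whose threshold satisfies (1 - ε) OPT / 4 ≤ ρ B ≤ OPT / 4 is good enough in
-- expectation, and if the grid contains no such ρ then USM(N₂) or {u*} is.  Charge each
-- element v that RandBatch adds to A with its deficit (ρ c(v) - f(v ∣ A))⁺, and let z be the
-- total charge.  Then pointwise f(A) ≥ ρ c(A) - z, and any set of elements that still fit
-- individually adds at most ρ times its cost plus ε (f(A) + z): a round that increments the
-- counter pays for the profit left in L with the loss of the elements it discards and with
-- the deficits it incurs.  In expectation z ≤ 3ε f(A), because 3ε f(A) - z is a
-- submartingale along the random sequence up to the cut.  If A₁ or A₂ costs at least B / 2,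
-- then its density makes it worth OPT / 8 - z.  Otherwise all elements of the optimum but
-- one of cost above B / 2 still fit into A₁ and A₂, and submodularity splits the optimum
-- into parts covered by A₁, A₂ and USM(N₂ ∪ A₁).

module Submission where

open import Defs
import Algebra.Properties.CommutativeMonoid.Sum as CommutativeMonoidSum
import Algebra.Properties.Ring as RingProperties
import Algebra.Properties.Semiring.Mult as SemiringMult
import Algebra.Properties.Semiring.Sum as SemiringSum
import Algebra.Solver.Ring as RingSolver
open import Algebra.Solver.Ring.AlmostCommutativeRing
  using (fromCommutativeRing; _-Raw-AlmostCommutative⟶_)
open import Data.Bool.Base using (true; if_then_else_)
open import Data.Fin.Base using (Fin; zero; suc; toℕ)
import Data.Fin.Properties as Finₚ
open import Data.Fin.Subset
  using (Subset; _∈_; _∉_; _⊆_; _∪_; _∩_; Nonempty; _─_; ∁; ⁅_⁆; ⊥; ∣_∣; inside; outside)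
open import Data.Fin.Subset.Properties
  using (_∈?_; nonempty?; ∉⊥; x∈⁅x⁆; x∈⁅y⁆⇒x≡y; ⊆-antisym; x∈p∪q⁻; x∈p∩q⁺; x∈p∩q⁻; x∈∁p⇒x∉p;
         x∉p⇒x∈∁p; p─q⊆p; x∈p∧x∉q⇒x∈p─q; p⊆p∪q; q⊆p∪q; ∪-assoc; ∪-comm; ∪-identityˡ;
         ∪-identityʳ; p∩q⊆p; p∩q⊆q; ∣⁅x⁆∣≡1; p⊆q⇒∣p∣≤∣q∣; p⊂q⇒∣p∣<∣q∣; ∣p∣≤n)
open import Data.Integer.Base as ℤ using (ℤ)
import Data.Integer.Properties as ℤₚ
open import Data.List.Base as List
  using (List; []; _∷_; _++_; map; concatMap; filter; length; take; lookup; allFin; replicate)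
open import Data.List.Membership.Propositional using () renaming (_∈_ to _∈ˡ_)
open import Data.List.Membership.Propositional.Properties
  using (∈-filter⁺; ∈-filter⁻; ∈-++⁺ˡ; ∈-++⁺ʳ; ∈-map⁺; ∈-allFin; ∈-concat⁺′)
import Data.List.Properties as Listₚ
open import Data.List.Relation.Binary.Permutation.Propositional
  using (_↭_; prep; swap; ↭-refl; ↭-sym; ↭-trans)
open import Data.List.Relation.Binary.Permutation.Propositional.Properties
  using (↭-length; ∈-resp-↭; All-resp-↭)
open import Data.List.Relation.Unary.All as All using (All; []; _∷_)
import Data.List.Relation.Unary.All.Properties as Allₚ
open import Data.List.Relation.Unary.Any using (here; there)
open import Data.List.Relation.Unary.Unique.Propositional using (Unique; []; _∷_)
import Data.List.Relation.Unary.Unique.Propositional.Properties as Uniqueₚ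
open import Data.Maybe.Base as Maybe using (Maybe)
open import Data.Nat.Base as ℕ using (ℕ; zero; suc; z≤n; s≤s; _!)
import Data.Nat.Properties as ℕₚ
open import Data.Product.Base using (_×_; _,_; ∃; proj₁; proj₂)
open import Data.Sign.Base as Sign using (Sign)
open import Data.Sum.Base as Sum using (_⊎_; inj₁; inj₂; [_,_]′)
open import Data.Vec.Base as Vec using (_∷_; [])
import Data.Vec.Properties as Vecₚ
open import Function.Base using (_∘_; id)
open import Level using (Level)
open import Relation.Binary.Bundles using (DecTotalOrder)
open import Relation.Binary.Consequences using (dec⇒weaklyDec)
open import Relation.Binary.PropositionalEquality as ≡ using (_≡_)
import Relation.Binary.Reasoning.PartialOrder as PartialOrderReasoning
open import Relation.Nullary using (¬_; Dec; yes; no; does; contradiction)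
open import Relation.Nullary.Decidable using (_×-dec_)
open import Relation.Unary using (Pred; Decidable)

module FiniteSets where

  private
    variable
      n : ℕ

  ∈⟪⟫⁺ : ∀ {p} {P : Pred (Fin n) p} (P? : Decidable P) {u} → P u → u ∈ ⟪ P? ⟫
  ∈⟪⟫⁺ P? {u} Pu = Vecₚ.lookup⇒[]= u _ (≡.trans (Vecₚ.lookup∘tabulate _ u) holds)
    where
    holds : does (P? u) ≡ true
    holds with P? u
    ... | yes _  = ≡.refl
    ... | no ¬Pu = contradiction Pu ¬Pu

  ∈⟪⟫⁻ : ∀ {p} {P : Pred (Fin n) p} (P? : Decidable P) {u} → u ∈ ⟪ P? ⟫ → P u
  ∈⟪⟫⁻ P? {u} u∈ with P? u | ≡.trans (≡.sym (Vecₚ.lookup∘tabulate (does ∘ P?) u)) (Vecₚ.[]=⇒lookup u∈)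
  ... | yes Pu | _ = Pu

  ─-∉ : ∀ (X Y : Subset n) {u} → u ∈ X ─ Y → u ∉ Y
  ─-∉ (_ ∷ X) (outside ∷ Y) {suc u} (Vec.there u∈) (Vec.there u∈Y) = ─-∉ X Y u∈ u∈Y
  ─-∉ (_ ∷ X) (inside ∷ Y)  {suc u} (Vec.there u∈) (Vec.there u∈Y) = ─-∉ X Y u∈ u∈Y

  ∪-elim : ∀ {p} {P : Pred (Fin n) p} (X Y : Subset n) → (∀ {u} → u ∈ X → P u) → (∀ {u} → u ∈ Y → P u) →
           ∀ {u} → u ∈ X ∪ Y → P u
  ∪-elim X Y X⊆P Y⊆P u∈ = [ X⊆P , Y⊆P ]′ (x∈p∪q⁻ X Y u∈)

  ∪-absorb : ∀ {X Y : Subset n} → Y ⊆ X → X ∪ Y ≡ X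
  ∪-absorb {X = X} {Y} Y⊆X = ⊆-antisym (∪-elim X Y id Y⊆X) (p⊆p∪q Y)

  ∈-⁅⁆⁻ : ∀ {u v : Fin n} → u ∈ ⁅ v ⁆ → u ≡ v
  ∈-⁅⁆⁻ {v = v} = x∈⁅y⁆⇒x≡y v

  ⁅⁆⊆ : ∀ {u} {X : Subset n} → u ∈ X → ⁅ u ⁆ ⊆ X
  ⁅⁆⊆ u∈X v∈ = ≡.subst (_∈ _) (≡.sym (∈-⁅⁆⁻ v∈)) u∈X

  ∈-fromList⁺ : ∀ {us : List (Fin n)} {u} → u ∈ˡ us → u ∈ fromList us
  ∈-fromList⁺ {us = v ∷ us} (here ≡.refl) = p⊆p∪q (fromList us) (x∈⁅x⁆ v)
  ∈-fromList⁺ {us = v ∷ us} (there u∈)    = q⊆p∪q ⁅ v ⁆ (fromList us) (∈-fromList⁺ u∈)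

  ∈-fromList⁻ : ∀ (us : List (Fin n)) {u} → u ∈ fromList us → u ∈ˡ us
  ∈-fromList⁻ []       u∈ = contradiction u∈ ∉⊥
  ∈-fromList⁻ (v ∷ us) u∈ = ∪-elim {P = _∈ˡ v ∷ us} ⁅ v ⁆ (fromList us)
    (λ u∈ → here (∈-⁅⁆⁻ u∈)) (λ u∈ → there (∈-fromList⁻ us u∈)) u∈

  fromList-++ : ∀ (us vs : List (Fin n)) → fromList (us ++ vs) ≡ fromList us ∪ fromList vs
  fromList-++ []       vs = ≡.sym (∪-identityˡ _)
  fromList-++ (u ∷ us) vs = ≡.trans (≡.cong (⁅ u ⁆ ∪_) (fromList-++ us vs)) (≡.sym (∪-assoc _ _ _))

  ∪-fromList-∷ : ∀ (X : Subset n) v vs → X ∪ fromList (v ∷ vs) ≡ (X ∪ ⁅ v ⁆) ∪ fromList vs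
  ∪-fromList-∷ X v vs = ≡.sym (∪-assoc X ⁅ v ⁆ (fromList vs))

  ∪-fromList-∷ʳ : ∀ (X : Subset n) vs v → X ∪ fromList (vs ++ v ∷ []) ≡ (X ∪ fromList vs) ∪ ⁅ v ⁆
  ∪-fromList-∷ʳ X vs v = ≡.trans
    (≡.cong (X ∪_) (≡.trans (fromList-++ vs (v ∷ [])) (≡.cong (fromList vs ∪_) (∪-identityʳ ⁅ v ⁆))))
    (≡.sym (∪-assoc X (fromList vs) ⁅ v ⁆))

  ∈-elements⁺ : ∀ {X : Subset n} {u} → u ∈ X → u ∈ˡ elements X
  ∈-elements⁺ {X = X} {u} u∈X = ∈-filter⁺ (_∈? X) (∈-allFin u) u∈X

  ∈-elements⁻ : ∀ {X : Subset n} {u} → u ∈ˡ elements X → u ∈ X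
  ∈-elements⁻ {X = X} u∈ = proj₂ (∈-filter⁻ (_∈? X) {xs = allFin _} u∈)

  elements-unique : ∀ (X : Subset n) → Unique (elements X)
  elements-unique X = Uniqueₚ.filter⁺ (_∈? X) (Uniqueₚ.allFin⁺ _)

  fromList-elements : ∀ (X : Subset n) → fromList (elements X) ≡ X
  fromList-elements X = ⊆-antisym (∈-elements⁻ ∘ ∈-fromList⁻ (elements X)) (∈-fromList⁺ ∘ ∈-elements⁺)

module Permutations where

  private
    variable
      a : Level
      A : Set a

  select : List A → List (A × List A)
  select []       = []
  select (x ∷ xs) = (x , xs) ∷ map (λ (y , ys) → y , x ∷ ys) (select xs)

  insertions-↭ : ∀ (x : A) xs → All (_↭ x ∷ xs) (insertions x xs)
  insertions-↭ x []       = ↭-refl ∷ []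
  insertions-↭ x (y ∷ ys) = ↭-refl ∷
    Allₚ.map⁺ (All.map (λ q↭ → ↭-trans (prep y q↭) (swap y x ↭-refl)) (insertions-↭ x ys))

  permutations-↭ : ∀ (xs : List A) → All (_↭ xs) (permutations xs)
  permutations-↭ []       = ↭-refl ∷ []
  permutations-↭ (x ∷ xs) = Allₚ.concat⁺ (Allₚ.map⁺ (All.map
    (λ {p} p↭ → All.map (λ q↭ → ↭-trans q↭ (prep x p↭)) (insertions-↭ x p)) (permutations-↭ xs)))

  length-insertions : ∀ (x : A) xs → length (insertions x xs) ≡ suc (length xs)
  length-insertions x []       = ≡.refl
  length-insertions x (y ∷ ys) = ≡.cong suc
    (≡.trans (Listₚ.length-map (y ∷_) (insertions x ys)) (length-insertions x ys))

  length-concatMap-insertions : ∀ (x : A) {m ps} → All (λ p → length p ≡ m) ps →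
                                length (concatMap (insertions x) ps) ≡ length ps ℕ.* suc m
  length-concatMap-insertions x {ps = []}     []            = ≡.refl
  length-concatMap-insertions x {ps = p ∷ ps} (eq ∷ lengths) = ≡.trans
    (Listₚ.length-++ (insertions x p))
    (≡.cong₂ ℕ._+_ (≡.trans (length-insertions x p) (≡.cong suc eq)) (length-concatMap-insertions x lengths))

  length-permutations : ∀ (xs : List A) → length (permutations xs) ≡ length xs !
  length-permutations []       = ≡.refl
  length-permutations (x ∷ xs) = ≡.trans
    (length-concatMap-insertions x (All.map ↭-length (permutations-↭ xs)))
    (≡.trans (≡.cong (ℕ._* suc (length xs)) (length-permutations xs)) (ℕₚ.*-comm (length xs !) _))

  select-↭ : ∀ (xs : List A) → All (λ (y , ys) → xs ↭ y ∷ ys) (select xs)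
  select-↭ []       = []
  select-↭ (x ∷ xs) = ↭-refl ∷
    Allₚ.map⁺ (All.map (λ xs↭ → ↭-trans (prep x xs↭) (swap x _ ↭-refl)) (select-↭ xs))

  select-unique : ∀ {xs : List A} → Unique xs → All (λ (y , ys) → Unique ys) (select xs)
  select-unique {xs = []}     []              = []
  select-unique {xs = x ∷ xs} (x∉xs ∷ unique) = unique ∷ Allₚ.map⁺ (All.map
    (λ { (xs↭ , unique-ys) → All.tail (All-resp-↭ xs↭ x∉xs) ∷ unique-ys })
    (All.zip (select-↭ xs , select-unique unique)))

module Searches where

  private
    variable
      p q : Level
      P : Pred ℕ p
      Q : Pred ℕ q

  greatest-satisfies : ∀ (P? : Decidable P) m → P 0 → P (greatest P? m)
  greatest-satisfies P? zero    P0 = P0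
  greatest-satisfies P? (suc m) P0 with P? (suc m)
  ... | yes Pm = Pm
  ... | no  _  = greatest-satisfies P? m P0

  greatest-cong : ∀ (P? : Decidable P) (Q? : Decidable Q) m → (∀ {i} → P i → Q i) → (∀ {i} → Q i → P i) →
                  greatest P? m ≡ greatest Q? m
  greatest-cong P? Q? zero    P⇒Q Q⇒P = ≡.refl
  greatest-cong P? Q? (suc m) P⇒Q Q⇒P with P? (suc m) | Q? (suc m)
  ... | yes _ | yes _ = ≡.refl
  ... | no  _ | no  _ = greatest-cong P? Q? m P⇒Q Q⇒P
  ... | yes P | no ¬Q = contradiction (P⇒Q P) ¬Q
  ... | no ¬P | yes Q = contradiction (Q⇒P Q) ¬P

  greatest-suc : ∀ (P? : Decidable P) m → P 1 → greatest P? (suc m) ≡ suc (greatest (P? ∘ suc) m)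
  greatest-suc P? zero    P1 with P? 1
  ... | yes _  = ≡.refl
  ... | no ¬P1 = contradiction P1 ¬P1
  greatest-suc P? (suc m) P1 with P? (suc (suc m))
  ... | yes _ = ≡.refl
  ... | no  _ = greatest-suc P? m P1

  greatest-none : ∀ (P? : Decidable P) m → (∀ i → ¬ P (suc i)) → greatest P? m ≡ 0
  greatest-none P? zero    ¬P = ≡.refl
  greatest-none P? (suc m) ¬P with P? (suc m)
  ... | yes Pm = contradiction Pm (¬P m)
  ... | no  _  = greatest-none P? m ¬P

  least-≤ : ∀ (P? : Decidable P) m → least P? m ℕ.≤ m
  least-≤ P? zero    = z≤n
  least-≤ P? (suc m) with P? 0
  ... | yes _ = z≤n
  ... | no  _ = s≤s (least-≤ (P? ∘ suc) m)

  least-or-none : ∀ (P? : Decidable P) m → P (least P? m) ⊎ (∀ {i} → i ℕ.≤ m → ¬ P i)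
  least-or-none P? zero with P? 0
  ... | yes P0 = inj₁ P0
  ... | no ¬P0 = inj₂ λ { z≤n → ¬P0 }
  least-or-none P? (suc m) with P? 0
  ... | yes P0 = inj₁ P0
  ... | no ¬P0 = Sum.map₂ (λ { ¬P z≤n → ¬P0 ; ¬P (s≤s i≤m) → ¬P i≤m }) (least-or-none (P? ∘ suc) m)

  least-none : ∀ (P? : Decidable P) m → (∀ {i} → i ℕ.< m → ¬ P i) → least P? m ≡ m
  least-none P? zero    ¬P = ≡.refl
  least-none P? (suc m) ¬P with P? 0
  ... | yes P0 = contradiction P0 (¬P (s≤s z≤n))
  ... | no  _  = ≡.cong suc (least-none (P? ∘ suc) m (¬P ∘ s≤s))

  least-cong-suc : ∀ (P? : Decidable P) (Q? : Decidable Q) m →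
    (∀ {i} → i ℕ.≤ m → P i → Q i) → (∀ {i} → i ℕ.≤ m → Q i → P i) →
    P (least P? m) → least Q? (suc m) ≡ least P? m
  least-cong-suc P? Q? zero    P⇒Q Q⇒P P0 with Q? 0
  ... | yes _  = ≡.refl
  ... | no ¬Q0 = contradiction (P⇒Q z≤n P0) ¬Q0
  least-cong-suc P? Q? (suc m) P⇒Q Q⇒P Pl with P? 0 | Q? 0
  ... | yes P0 | yes _  = ≡.refl
  ... | yes P0 | no ¬Q0 = contradiction (P⇒Q z≤n P0) ¬Q0
  ... | no ¬P0 | yes Q0 = contradiction (Q⇒P z≤n Q0) ¬P0
  ... | no _   | no _   = ≡.cong suc (least-cong-suc (P? ∘ suc) (Q? ∘ suc) m (P⇒Q ∘ s≤s) (Q⇒P ∘ s≤s) Pl)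

  take-++ : ∀ {a} {A : Set a} i (xs ys : List A) → i ℕ.≤ length xs → take i (xs ++ ys) ≡ take i xs
  take-++ zero    xs       ys _         = ≡.refl
  take-++ (suc i) (x ∷ xs) ys (s≤s i≤)  = ≡.cong (x ∷_) (take-++ i xs ys i≤)

module Analysis {a ℓ₁ ℓ₂} (𝔽 : ArchimedeanField a ℓ₁ ℓ₂) where
  open ArchimedeanField 𝔽 hiding (zero)
  open OrderedFieldProperties 𝔽 renaming (fromℕ-nonNegative to 0≤fromℕ)
  open Constants 𝔽
  open Probability 𝔽
  open Knapsack 𝔽
  open FiniteSets
  open Permutations
  open Searches
  open PartialOrderReasoning (DecTotalOrder.poset decTotalOrder)

  private
    variable
      x y p q : Level
      X : Set x
      Y : Set y
      n : ℕ

  -- Ordered fields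

  open RingProperties ring using (-‿distribʳ-*; -‿distribˡ-*; -‿involutive; -0#≈0#; -‿+-comm)
  open SemiringMult semiring using (×-homo-+; ×1-homo-*)

  module IntegerSolver where
    open import Data.Integer.Base using (+_; -[1+_]; _⊖_; _◃_)

    -- The numerals 0 and 1 are sent to 0# and 1# on the nose, so that goals mentioning
    -- these constants match the solver's denotation of con.
    numeral : ℕ → Carrier
    numeral zero          = 0#
    numeral (suc zero)    = 1#
    numeral (suc (suc k)) = fromℕ (suc (suc k))

    ⟦_⟧ : ℤ → Carrier
    ⟦ + k ⟧      = numeral k
    ⟦ -[1+ k ] ⟧ = - numeral (suc k)

    fromℤ : ℤ → Carrier
    fromℤ (+ k)    = fromℕ k
    fromℤ -[1+ k ] = - fromℕ (suc k)

    numeral≈fromℕ : ∀ k → numeral k ≈ fromℕ k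
    numeral≈fromℕ zero          = refl
    numeral≈fromℕ (suc zero)    = sym (+-identityʳ 1#)
    numeral≈fromℕ (suc (suc k)) = refl

    ⟦⟧≈fromℤ : ∀ i → ⟦ i ⟧ ≈ fromℤ i
    ⟦⟧≈fromℤ (+ k)    = numeral≈fromℕ k
    ⟦⟧≈fromℤ -[1+ k ] = -‿cong (numeral≈fromℕ (suc k))

    fromℤ-⊖ : ∀ j k → fromℤ (j ⊖ k) ≈ fromℕ j - fromℕ k
    fromℤ-⊖ j       zero    = sym (trans (+-congˡ -0#≈0#) (+-identityʳ _))
    fromℤ-⊖ zero    (suc k) = sym (+-identityˡ _)
    fromℤ-⊖ (suc j) (suc k) = begin-equality
      fromℤ (suc j ⊖ suc k)              ≡⟨ ≡.cong fromℤ (ℤₚ.[1+m]⊖[1+n]≡m⊖n j k) ⟩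
      fromℤ (j ⊖ k)                      ≈⟨ fromℤ-⊖ j k ⟩
      fromℕ j - fromℕ k                  ≈⟨ +-congʳ (+-identityʳ _) ⟨
      fromℕ j + 0# - fromℕ k             ≈⟨ +-congʳ (+-congˡ (-‿inverseʳ 1#)) ⟨
      fromℕ j + (1# - 1#) - fromℕ k      ≈⟨ +-congʳ (+-assoc _ _ _) ⟨
      fromℕ j + 1# - 1# - fromℕ k        ≈⟨ +-congʳ (+-congʳ (+-comm _ _)) ⟩
      1# + fromℕ j - 1# - fromℕ k        ≈⟨ +-assoc _ _ _ ⟩
      1# + fromℕ j + (- 1# + - fromℕ k)  ≈⟨ +-congˡ (-‿+-comm _ _) ⟩
      fromℕ (suc j) - fromℕ (suc k)      ∎

    fromℤ-+ : ∀ i j → fromℤ (i ℤ.+ j) ≈ fromℤ i + fromℤ j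
    fromℤ-+ (+ j)    (+ k)    = ×-homo-+ 1# j k
    fromℤ-+ (+ j)    -[1+ k ] = fromℤ-⊖ j (suc k)
    fromℤ-+ -[1+ j ] (+ k)    = trans (fromℤ-⊖ k (suc j)) (+-comm _ _)
    fromℤ-+ -[1+ j ] -[1+ k ] = begin-equality
      - fromℕ (suc (suc (j ℕ.+ k)))       ≡⟨ ≡.cong (λ l → - fromℕ (suc l)) (≡.sym (ℕₚ.+-suc j k)) ⟩
      - fromℕ (suc j ℕ.+ suc k)           ≈⟨ -‿cong (×-homo-+ 1# (suc j) (suc k)) ⟩
      - (fromℕ (suc j) + fromℕ (suc k))   ≈⟨ -‿+-comm _ _ ⟨
      - fromℕ (suc j) + - fromℕ (suc k)   ∎

    signed : Sign → Carrier → Carrier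
    signed Sign.+ x = x
    signed Sign.- x = - x

    fromℤ-◃ : ∀ s k → fromℤ (s ◃ k) ≈ signed s (fromℕ k)
    fromℤ-◃ Sign.+ zero    = refl
    fromℤ-◃ Sign.- zero    = sym -0#≈0#
    fromℤ-◃ Sign.+ (suc k) = refl
    fromℤ-◃ Sign.- (suc k) = refl

    fromℤ-* : ∀ i j → fromℤ (i ℤ.* j) ≈ fromℤ i * fromℤ j
    fromℤ-* (+ j)    (+ k)    = trans (fromℤ-◃ Sign.+ (j ℕ.* k)) (×1-homo-* j k)
    fromℤ-* (+ j)    -[1+ k ] = trans (fromℤ-◃ Sign.- (j ℕ.* suc k))
      (trans (-‿cong (×1-homo-* j (suc k))) (-‿distribʳ-* _ _))
    fromℤ-* -[1+ j ] (+ k)    = trans (fromℤ-◃ Sign.- (suc j ℕ.* k))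
      (trans (-‿cong (×1-homo-* (suc j) k)) (-‿distribˡ-* _ _))
    fromℤ-* -[1+ j ] -[1+ k ] = begin-equality
      fromℤ (Sign.+ ◃ (suc j ℕ.* suc k))   ≈⟨ ×1-homo-* (suc j) (suc k) ⟩
      fromℕ (suc j) * fromℕ (suc k)        ≈⟨ -‿involutive _ ⟨
      - - (fromℕ (suc j) * fromℕ (suc k))  ≈⟨ -‿cong (-‿distribˡ-* _ _) ⟩
      - (- fromℕ (suc j) * fromℕ (suc k))  ≈⟨ -‿distribʳ-* _ _ ⟩
      - fromℕ (suc j) * - fromℕ (suc k)    ∎

    fromℤ-neg : ∀ i → fromℤ (ℤ.- i) ≈ - fromℤ i
    fromℤ-neg (+ zero)  = sym -0#≈0#
    fromℤ-neg (+ suc k) = refl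
    fromℤ-neg -[1+ k ]  = sym (-‿involutive _)

    homomorphism : ℤ.+-*-rawRing -Raw-AlmostCommutative⟶ fromCommutativeRing commutativeRing
    homomorphism = record
      { ⟦_⟧    = ⟦_⟧
      ; +-homo = λ i j → trans (⟦⟧≈fromℤ (i ℤ.+ j)) (trans (fromℤ-+ i j)
          (sym (+-cong (⟦⟧≈fromℤ i) (⟦⟧≈fromℤ j))))
      ; *-homo = λ i j → trans (⟦⟧≈fromℤ (i ℤ.* j)) (trans (fromℤ-* i j)
          (sym (*-cong (⟦⟧≈fromℤ i) (⟦⟧≈fromℤ j))))
      ; -‿homo = λ i → trans (⟦⟧≈fromℤ (ℤ.- i)) (trans (fromℤ-neg i) (-‿cong (sym (⟦⟧≈fromℤ i))))
      ; 0-homo = refl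
      ; 1-homo = refl
      }

    _coeff≟_ : ∀ i j → Maybe (⟦ i ⟧ ≈ ⟦ j ⟧)
    i coeff≟ j = Maybe.map (λ where ≡.refl → refl) (dec⇒weaklyDec ℤₚ._≟_ i j)

  open RingSolver ℤ.+-*-rawRing (fromCommutativeRing commutativeRing)
    IntegerSolver.homomorphism IntegerSolver._coeff≟_ public
    using (Polynomial; solve; con; _:=_; _:+_; _:*_; _:-_; :-_)

  num : ∀ {m} → ℕ → Polynomial m
  num k = con (ℤ.+ k)

  0≤y-x : ∀ {x y} → x ≤ y → 0# ≤ y - x
  0≤y-x {x} {y} x≤y = begin
    0#      ≈⟨ -‿inverseˡ x ⟨
    - x + x ≤⟨ +-monoʳ-≤ _ x≤y ⟩
    - x + y ≈⟨ +-comm _ _ ⟩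
    y - x   ∎

  -- Linear inequalities are proved by exhibiting the difference of the two sides as a
  -- combination r of nonnegative terms; the identity y ≈ x + r is left to the ring solver.
  ≤-by : ∀ {x y r} → 0# ≤ r → y ≈ x + r → x ≤ y
  ≤-by {x} {y} {r} 0≤r y≈x+r = begin
    x      ≤⟨ x≤y+x 0≤r ⟩
    r + x  ≈⟨ +-comm _ _ ⟩
    x + r  ≈⟨ y≈x+r ⟨
    y      ∎

  infixl 6 _⊕_
  infixl 7 _⊗_
  _⊕_ : ∀ {x y} → 0# ≤ x → 0# ≤ y → 0# ≤ x + y
  _⊕_ = +-nonNegative
  _⊗_ : ∀ {x y} → 0# ≤ x → 0# ≤ y → 0# ≤ x * y
  _⊗_ = *-nonNegative

  +-mono-≤ : ∀ {x y u v} → x ≤ y → u ≤ v → x + u ≤ y + v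
  +-mono-≤ {x} {y} {u} {v} x≤y u≤v = ≤-by (0≤y-x x≤y ⊕ 0≤y-x u≤v)
    (solve 4 (λ x y u v → y :+ v := x :+ u :+ (y :- x :+ (v :- u))) refl x y u v)

  ≰⇒≥ : ∀ {x y} → ¬ (x ≤ y) → y ≤ x
  ≰⇒≥ {x} {y} x≰y with ≤-total x y
  ... | inj₁ x≤y = contradiction x≤y x≰y
  ... | inj₂ y≤x = y≤x

  ≰⇒> : ∀ {x y} → ¬ (x ≤ y) → y < x
  ≰⇒> x≰y = ≰⇒≥ x≰y , λ y≈x → x≰y (≤-reflexive (sym y≈x))

  <⇒≱ : ∀ {x y} → x < y → ¬ (y ≤ x)
  <⇒≱ (x≤y , x≉y) y≤x = x≉y (≤-antisym x≤y y≤x)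

  ≮⇒≥ : ∀ {x y} → ¬ (x < y) → y ≤ x
  ≮⇒≥ {x} {y} x≮y with y ≤? x
  ... | yes y≤x = y≤x
  ... | no  y≰x = contradiction (≰⇒> y≰x) x≮y

  ≤-<-trans : ∀ {x y z} → x ≤ y → y < z → x < z
  ≤-<-trans x≤y y<z = ≰⇒> (λ z≤x → <⇒≱ y<z (≤-trans z≤x x≤y))

  <-≤-trans : ∀ {x y z} → x < y → y ≤ z → x < z
  <-≤-trans x<y y≤z = ≰⇒> (λ z≤x → <⇒≱ x<y (≤-trans y≤z z≤x))

  *-cancelˡ-≤ : ∀ {z x y} → 0# < z → z * x ≤ z * y → x ≤ y
  *-cancelˡ-≤ {z} {x} {y} 0<z zx≤zy = begin
    x              ≈⟨ undo x ⟨
    z ⁻¹ * (z * x) ≤⟨ *-monoˡ-≤ (⁻¹-nonNegative 0<z) zx≤zy ⟩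
    z ⁻¹ * (z * y) ≈⟨ undo y ⟩
    y              ∎
    where
    undo : ∀ v → z ⁻¹ * (z * v) ≈ v
    undo v = begin-equality
      z ⁻¹ * (z * v) ≈⟨ *-assoc _ _ _ ⟨
      z ⁻¹ * z * v   ≈⟨ *-congʳ (trans (*-comm _ _) (*-inverseʳ (<⇒≉ 0<z))) ⟩
      1# * v         ≈⟨ *-identityˡ v ⟩
      v              ∎

  /-*-cancel : ∀ {x z} → 0# < z → x / z * z ≈ x
  /-*-cancel {x} {z} 0<z = begin-equality
    x * z ⁻¹ * z   ≈⟨ *-assoc _ _ _ ⟩
    x * (z ⁻¹ * z) ≈⟨ *-congˡ (trans (*-comm _ _) (*-inverseʳ (<⇒≉ 0<z))) ⟩
    x * 1#         ≈⟨ *-identityʳ x ⟩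
    x              ∎

  ≤/⇒*≤ : ∀ {x y z} → 0# < z → x ≤ y / z → x * z ≤ y
  ≤/⇒*≤ 0<z x≤y/z = ≤-trans (*-monoʳ-≤ (proj₁ 0<z) x≤y/z) (≤-reflexive (/-*-cancel 0<z))

  /≤⇒≤* : ∀ {x y z} → 0# < z → x / z ≤ y → x ≤ y * z
  /≤⇒≤* 0<z x/z≤y = ≤-trans (≤-reflexive (sym (/-*-cancel 0<z))) (*-monoʳ-≤ (proj₁ 0<z) x/z≤y)

  ≤*⇒/≤ : ∀ {x y z} → 0# < z → x ≤ y * z → x / z ≤ y
  ≤*⇒/≤ {x} {y} {z} 0<z x≤yz = *-cancelˡ-≤ 0<z (begin
    z * (x / z)  ≈⟨ *-comm _ _ ⟩
    x / z * z    ≈⟨ /-*-cancel 0<z ⟩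
    x            ≤⟨ x≤yz ⟩
    y * z        ≈⟨ *-comm _ _ ⟩
    z * y        ∎)

  0<1 : 0# < 1#
  0<1 = 0≤1 , 0≉1

  ⁻¹-positive : ∀ {x} → 0# < x → 0# < x ⁻¹
  ⁻¹-positive {x} 0<x = ⁻¹-nonNegative 0<x , λ 0≈x⁻¹ → 0≉1 (begin-equality
    0#        ≈⟨ zeroʳ x ⟨
    x * 0#    ≈⟨ *-congˡ 0≈x⁻¹ ⟩
    x * x ⁻¹  ≈⟨ *-inverseʳ (<⇒≉ 0<x) ⟩
    1#        ∎)

  0<fromℕ : ∀ k → 0# < fromℕ (suc k)
  0<fromℕ k = <-≤-trans 0<1 (≤-by (0≤fromℕ k) refl)

  fromℕ⁻¹* : ∀ k {x} → fromℕ (suc k) * (fromℕ (suc k) ⁻¹ * x) ≈ x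
  fromℕ⁻¹* k {x} = trans (sym (*-assoc _ _ _))
    (trans (*-congʳ (*-inverseʳ (<⇒≉ (0<fromℕ k)))) (*-identityˡ x))

  if-elim : ∀ {p r t} {P : Set p} {T : Set t} (P? : Dec P) (R : T → Set r) {x y} →
            (P → R x) → (¬ P → R y) → R (if does P? then x else y)
  if-elim (yes p) R Rx Ry = Rx p
  if-elim (no ¬p) R Rx Ry = Ry ¬p

  infix 8 _⁺
  _⁺ : Carrier → Carrier
  x ⁺ = if does (0# ≤? x) then x else 0#

  ⁺-nonNegative : ∀ x → 0# ≤ x ⁺
  ⁺-nonNegative x with 0# ≤? x
  ... | yes 0≤x = 0≤x
  ... | no  _   = ≤-refl

  x≤x⁺ : ∀ x → x ≤ x ⁺
  x≤x⁺ x with 0# ≤? x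
  ... | yes _   = ≤-refl
  ... | no  0≰x = ≰⇒≥ 0≰x

  ⁺-least : ∀ {x y} → 0# ≤ y → x ≤ y → x ⁺ ≤ y
  ⁺-least {x} 0≤y x≤y with 0# ≤? x
  ... | yes _ = x≤y
  ... | no  _ = 0≤y

  abs-nonNegative : ∀ x → 0# ≤ abs x
  abs-nonNegative x with 0# ≤? x
  ... | yes 0≤x = 0≤x
  ... | no  0≰x = ≤-by (0≤y-x (≰⇒≥ 0≰x)) (solve 1 (λ x → :- x := num 0 :+ (num 0 :- x)) refl x)

  abs-negative : ∀ {x} → x < 0# → abs x ≈ - x
  abs-negative {x} x<0 with 0# ≤? x
  ... | yes 0≤x = contradiction 0≤x (<⇒≱ x<0)
  ... | no  _   = refl

  -- Expectations

  sumˡ : (X → Carrier) → List X → Carrier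
  sumˡ g []       = 0#
  sumˡ g (x ∷ xs) = g x + sumˡ g xs

  sumˡ-++ : ∀ (g : X → Carrier) xs ys → sumˡ g (xs ++ ys) ≈ sumˡ g xs + sumˡ g ys
  sumˡ-++ g []       ys = sym (+-identityˡ _)
  sumˡ-++ g (x ∷ xs) ys = trans (+-congˡ (sumˡ-++ g xs ys)) (sym (+-assoc _ _ _))

  sumˡ-map : ∀ (g : Y → Carrier) (h : X → Y) xs → sumˡ g (map h xs) ≡ sumˡ (λ x → g (h x)) xs
  sumˡ-map g h []       = ≡.refl
  sumˡ-map g h (x ∷ xs) = ≡.cong (λ s → g (h x) + s) (sumˡ-map g h xs)

  sumˡ-mono : ∀ {g h : X → Carrier} xs → (∀ {x} → x ∈ˡ xs → g x ≤ h x) → sumˡ g xs ≤ sumˡ h xs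
  sumˡ-mono []       g≤h = ≤-refl
  sumˡ-mono (x ∷ xs) g≤h = +-mono-≤ (g≤h (here ≡.refl)) (sumˡ-mono xs (λ x∈ → g≤h (there x∈)))

  sumˡ-cong : ∀ {g h : X → Carrier} xs → (∀ {x} → x ∈ˡ xs → g x ≈ h x) → sumˡ g xs ≈ sumˡ h xs
  sumˡ-cong []       g≈h = refl
  sumˡ-cong (x ∷ xs) g≈h = +-cong (g≈h (here ≡.refl)) (sumˡ-cong xs (λ x∈ → g≈h (there x∈)))

  sumˡ-concatMap : ∀ (g : Y → Carrier) (k : X → List Y) xs →
                   sumˡ g (concatMap k xs) ≈ sumˡ (λ x → sumˡ g (k x)) xs
  sumˡ-concatMap g k []       = refl
  sumˡ-concatMap g k (x ∷ xs) = trans (sumˡ-++ g (k x) _) (+-congˡ (sumˡ-concatMap g k xs))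

  sumˡ-+ : ∀ (g h : X → Carrier) xs → sumˡ (λ x → g x + h x) xs ≈ sumˡ g xs + sumˡ h xs
  sumˡ-+ g h []       = sym (+-identityˡ _)
  sumˡ-+ g h (x ∷ xs) = trans (+-congˡ (sumˡ-+ g h xs))
    (solve 4 (λ a b c d → a :+ b :+ (c :+ d) := a :+ c :+ (b :+ d)) refl _ _ _ _)

  sumˡ-*ˡ : ∀ v (g : X → Carrier) xs → sumˡ (λ x → v * g x) xs ≈ v * sumˡ g xs
  sumˡ-*ˡ v g []       = sym (zeroʳ v)
  sumˡ-*ˡ v g (x ∷ xs) = trans (+-congˡ (sumˡ-*ˡ v g xs)) (sym (distribˡ v _ _))

  sumˡ-const : ∀ (v : Carrier) (xs : List X) → sumˡ (λ _ → v) xs ≈ fromℕ (length xs) * v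
  sumˡ-const v []       = sym (zeroˡ v)
  sumˡ-const v (x ∷ xs) = trans (+-congˡ (sumˡ-const v xs))
    (solve 2 (λ v l → v :+ l :* v := (num 1 :+ l) :* v) refl v _)

  𝔼-cong : ∀ {g h : X → Carrier} d → (∀ x → g x ≈ h x) → 𝔼 g d ≈ 𝔼 h d
  𝔼-cong []            g≈h = refl
  𝔼-cong ((w , x) ∷ d) g≈h = +-cong (*-congˡ (g≈h x)) (𝔼-cong d g≈h)

  𝔼-+ : ∀ (g h : X → Carrier) d → 𝔼 (λ x → g x + h x) d ≈ 𝔼 g d + 𝔼 h d
  𝔼-+ g h []            = sym (+-identityˡ _)
  𝔼-+ g h ((w , x) ∷ d) = trans (+-congˡ (𝔼-+ g h d))
    (solve 5 (λ w a b c d → w :* (a :+ b) :+ (c :+ d) := w :* a :+ c :+ (w :* b :+ d))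
      refl w (g x) (h x) _ _)

  𝔼-*ˡ : ∀ v (g : X → Carrier) d → 𝔼 (λ x → v * g x) d ≈ v * 𝔼 g d
  𝔼-*ˡ v g []            = sym (zeroʳ v)
  𝔼-*ˡ v g ((w , x) ∷ d) = trans (+-congˡ (𝔼-*ˡ v g d))
    (solve 4 (λ w v a b → w :* (v :* a) :+ v :* b := v :* (w :* a :+ b)) refl w v (g x) _)

  𝔼-const : ∀ v (d : Dist X) → IsDistribution d → 𝔼 (λ _ → v) d ≈ v
  𝔼-const v d (_ , mass) = begin-equality
    𝔼 (λ _ → v) d        ≈⟨ 𝔼-cong d (λ _ → sym (*-identityʳ v)) ⟩
    𝔼 (λ _ → v * 1#) d   ≈⟨ 𝔼-*ˡ v (λ _ → 1#) d ⟩
    v * 𝔼 (λ _ → 1#) d   ≈⟨ *-congˡ mass ⟩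
    v * 1#               ≈⟨ *-identityʳ v ⟩
    v                    ∎

  𝔼-++ : ∀ (g : X → Carrier) d e → 𝔼 g (d ++ e) ≈ 𝔼 g d + 𝔼 g e
  𝔼-++ g []            e = sym (+-identityˡ _)
  𝔼-++ g ((w , x) ∷ d) e = trans (+-congˡ (𝔼-++ g d e)) (sym (+-assoc _ _ _))

  scale : Carrier → Dist X → Dist X
  scale w = map (λ (v , x) → w * v , x)

  𝔼-scale : ∀ w (g : X → Carrier) d → 𝔼 g (scale w d) ≈ w * 𝔼 g d
  𝔼-scale w g []            = sym (zeroʳ w)
  𝔼-scale w g ((v , x) ∷ d) = trans (+-congˡ (𝔼-scale w g d))
    (solve 4 (λ w v a b → w :* v :* a :+ w :* b := w :* (v :* a :+ b)) refl w v (g x) _)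

  𝔼->>= : ∀ (g : Y → Carrier) (d : Dist X) (k : X → Dist Y) →
          𝔼 g (d >>= k) ≈ 𝔼 (λ x → 𝔼 g (k x)) d
  𝔼->>= g []            k = refl
  𝔼->>= g ((w , x) ∷ d) k = begin-equality
    𝔼 g (scale w (k x) ++ (d >>= k))         ≈⟨ 𝔼-++ g (scale w (k x)) _ ⟩
    𝔼 g (scale w (k x)) + 𝔼 g (d >>= k)      ≈⟨ +-cong (𝔼-scale w g (k x)) (𝔼->>= g d k) ⟩
    w * 𝔼 g (k x) + 𝔼 (λ x → 𝔼 g (k x)) d    ∎

  𝔼-return : ∀ (g : X → Carrier) x → 𝔼 g (return x) ≈ g x
  𝔼-return g x = solve 1 (λ v → num 1 :* v :+ num 0 := v) refl (g x)

  𝔼-uniform : ∀ (g : X → Carrier) xs → 𝔼 g (uniform xs) ≈ fromℕ (length xs) ⁻¹ * sumˡ g xs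
  𝔼-uniform {X = X} g xs = go xs
    where
    go : ∀ ys → 𝔼 g (map (λ x → fromℕ (length xs) ⁻¹ , x) ys) ≈ fromℕ (length xs) ⁻¹ * sumˡ g ys
    go []       = sym (zeroʳ _)
    go (y ∷ ys) = trans (+-congˡ (go ys)) (sym (distribˡ _ _ _))

  NonNegative : {X : Set x} → Dist X → Set _
  NonNegative = All (λ (w , _) → 0# ≤ w)

  𝔼-mono : ∀ {P : Pred X p} {g h : X → Carrier} {d} → NonNegative d → AlmostSurely P d →
           (∀ {x} → P x → g x ≤ h x) → 𝔼 g d ≤ 𝔼 h d
  𝔼-mono {d = []} _ _ _ = ≤-refl
  𝔼-mono {g = g} {h} {(w , x) ∷ d} (0≤w ∷ 0≤d) (Px ∷ Pd) g≤h =
    +-mono-≤ head (𝔼-mono 0≤d Pd g≤h)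
    where
    head : w * g x ≤ w * h x
    head with 0# ≟ w
    ... | yes 0≈w = ≤-reflexive (trans (*-congʳ (sym 0≈w))
      (trans (zeroˡ _) (trans (sym (zeroˡ _)) (*-congʳ 0≈w))))
    ... | no  0≉w = *-monoˡ-≤ 0≤w (g≤h (Px (0≤w , 0≉w)))

  always : ∀ {P : Pred X p} (d : Dist X) → (∀ x → P x) → AlmostSurely P d
  always d Px = All.universal (λ (_ , x) _ → Px x) d

  𝔼-mono-always : ∀ {g h : X → Carrier} {d} → NonNegative d → (∀ x → g x ≤ h x) → 𝔼 g d ≤ 𝔼 h d
  𝔼-mono-always {g = g} {h} {d} 0≤d g≤h = 𝔼-mono {P = λ x → g x ≤ h x} 0≤d (always d g≤h) (λ g≤h → g≤h)

  𝔼-≥ : ∀ {P : Pred X p} {g : X → Carrier} {v d} → IsDistribution d → AlmostSurely P d →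
        (∀ {x} → P x → v ≤ g x) → v ≤ 𝔼 g d
  𝔼-≥ {g = g} {v} {d} isD Pd v≤g = ≤-trans (≤-reflexive (sym (𝔼-const v d isD))) (𝔼-mono (proj₁ isD) Pd v≤g)

  scale-nonNegative : ∀ {w} {d : Dist X} → 0# ≤ w → NonNegative d → NonNegative (scale w d)
  scale-nonNegative 0≤w 0≤d = Allₚ.map⁺ (All.map (*-nonNegative 0≤w) 0≤d)

  >>=-nonNegative : ∀ {d : Dist X} {k : X → Dist Y} → NonNegative d → (∀ x → NonNegative (k x)) →
                    NonNegative (d >>= k)
  >>=-nonNegative {d = []}          []          0≤k = []
  >>=-nonNegative {d = (w , x) ∷ d} (0≤w ∷ 0≤d) 0≤k =
    Allₚ.++⁺ (scale-nonNegative 0≤w (0≤k x)) (>>=-nonNegative 0≤d 0≤k)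

  >>=-isDistribution : ∀ {d : Dist X} {k : X → Dist Y} → IsDistribution d →
                       (∀ x → IsDistribution (k x)) → IsDistribution (d >>= k)
  >>=-isDistribution {d = d} {k} (0≤d , mass) k-dist =
    >>=-nonNegative 0≤d (λ x → proj₁ (k-dist x)) ,
    trans (𝔼->>= _ d k) (trans (𝔼-cong d (λ x → proj₂ (k-dist x))) mass)

  return-isDistribution : (x : X) → IsDistribution (return x)
  return-isDistribution x = 0≤1 ∷ [] , 𝔼-return (λ _ → 1#) x

  uniform-isDistribution : ∀ (x : X) xs → IsDistribution (uniform (x ∷ xs))
  uniform-isDistribution x xs =
    Allₚ.map⁺ (All.universal (λ _ → ⁻¹-nonNegative (0<fromℕ (length xs))) (x ∷ xs)) ,
    (begin-equality
      𝔼 (λ _ → 1#) (uniform (x ∷ xs))       ≈⟨ 𝔼-uniform (λ _ → 1#) (x ∷ xs) ⟩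
      l ⁻¹ * sumˡ (λ _ → 1#) (x ∷ xs)       ≈⟨ *-congˡ (sumˡ-const 1# (x ∷ xs)) ⟩
      l ⁻¹ * (l * 1#)                       ≈⟨ *-congˡ (*-identityʳ l) ⟩
      l ⁻¹ * l                              ≈⟨ *-comm _ _ ⟩
      l * l ⁻¹                              ≈⟨ *-inverseʳ (<⇒≉ (0<fromℕ (length xs))) ⟩
      1#                                    ∎)
    where l = fromℕ (suc (length xs))

  return-surely : ∀ {P : Pred X p} {x} → P x → AlmostSurely P (return x)
  return-surely Px = (λ _ → Px) ∷ []

  scale-surely : ∀ {P : Pred X p} {w} {d : Dist X} → 0# ≤ w → (0# < w → AlmostSurely P d) →
                 AlmostSurely P (scale w d)
  scale-surely {P = P} {w} {d} 0≤w Pd with 0# ≟ w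
  ... | yes 0≈w = Allₚ.map⁺ (All.universal (λ (v , _) 0<wv →
        contradiction (trans (sym (zeroˡ v)) (*-congʳ 0≈w)) (proj₂ 0<wv)) d)
  ... | no  0≉w = Allₚ.map⁺ (All.map (λ { {v , _} Px 0<wv → Px (positiveʳ v 0<wv) }) (Pd (0≤w , 0≉w)))
    where
    positiveʳ : ∀ v → 0# < w * v → 0# < v
    positiveʳ v 0<wv = ≰⇒> λ v≤0 → <⇒≱ 0<wv (≤-trans (*-monoˡ-≤ 0≤w v≤0) (≤-reflexive (zeroʳ w)))

  >>=-surely : ∀ {P : Pred X p} {Q : Pred Y q} {d : Dist X} {k : X → Dist Y} → NonNegative d →
               AlmostSurely P d → (∀ {x} → P x → AlmostSurely Q (k x)) → AlmostSurely Q (d >>= k)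
  >>=-surely {d = []}          []          []        Qk = []
  >>=-surely {d = (w , x) ∷ d} (0≤w ∷ 0≤d) (Px ∷ Pd) Qk =
    Allₚ.++⁺ (scale-surely 0≤w (λ 0<w → Qk (Px 0<w))) (>>=-surely 0≤d Pd Qk)

  independently-isDistribution : ∀ {ds : List (Dist X)} → All IsDistribution ds →
                                 IsDistribution (independently ds)
  independently-isDistribution []       = return-isDistribution []
  independently-isDistribution (d ∷ ds) = >>=-isDistribution d λ x →
    >>=-isDistribution (independently-isDistribution ds) λ xs → return-isDistribution (x ∷ xs)

  independently-surely : ∀ {P : Pred X p} {ds : List (Dist X)} → All IsDistribution ds →
                         All (AlmostSurely P) ds → AlmostSurely (All P) (independently ds)
  independently-surely []         []         = return-surely []
  independently-surely (d ∷ ds) (Pd ∷ Pds) = >>=-surely (proj₁ d) Pd λ Px →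
    >>=-surely (proj₁ (independently-isDistribution ds)) (independently-surely ds Pds) λ Pxs →
    return-surely (Px ∷ Pxs)

  𝔼-independently : ∀ {g : X → Carrier} {F : List X → Carrier} {ds d} → All IsDistribution ds → d ∈ˡ ds →
                    (∀ {x xs} → x ∈ˡ xs → g x ≤ F xs) → 𝔼 g d ≤ 𝔼 F (independently ds)
  𝔼-independently {g = g} {F} {d ∷ ds} (d-dist ∷ ds-dist) d∈ g≤F = begin
    _                                               ≤⟨ lower d∈ ⟩
    𝔼 (λ x → 𝔼 (λ xs → F (x ∷ xs)) (independently ds)) d
      ≈⟨ 𝔼-cong d (λ x → trans (𝔼->>= F (independently ds) (λ xs → return (x ∷ xs)))
        (𝔼-cong (independently ds) λ xs → 𝔼-return F (x ∷ xs))) ⟨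
    𝔼 (λ x → 𝔼 F (independently ds >>= λ xs → return (x ∷ xs))) d
      ≈⟨ 𝔼->>= F d _ ⟨
    𝔼 F (independently (d ∷ ds))                    ∎
    where
    lower : ∀ {e} → e ∈ˡ d ∷ ds → 𝔼 g e ≤ 𝔼 (λ x → 𝔼 (λ xs → F (x ∷ xs)) (independently ds)) d
    lower (here ≡.refl) = 𝔼-mono-always (proj₁ d-dist) λ x →
      𝔼-≥ (independently-isDistribution ds-dist) (always _ λ xs → g≤F {x} {x ∷ xs} (here ≡.refl)) (λ g≤ → g≤)
    lower (there e∈) = 𝔼-≥ d-dist (always d λ x → 𝔼-independently ds-dist e∈ (λ x∈ → g≤F (there x∈)))
      (λ ≤F → ≤F)

  -- Sums over finite sets

  open CommutativeMonoidSum +-commutativeMonoid using (sum-cong-≋; ∑-distrib-+)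
  open SemiringSum semiring using (*-distribˡ-sum)

  sum-mono : ∀ {m} {g h : Fin m → Carrier} → (∀ u → g u ≤ h u) → sum g ≤ sum h
  sum-mono {zero}  g≤h = ≤-refl
  sum-mono {suc m} g≤h = +-mono-≤ (g≤h zero) (sum-mono (g≤h ∘ suc))

  sum-zero : ∀ m → sum {m} (λ _ → 0#) ≈ 0#
  sum-zero zero    = refl
  sum-zero (suc m) = trans (+-identityˡ _) (sum-zero m)

  restrict : Subset n → (Fin n → Carrier) → Fin n → Carrier
  restrict X g u = if does (u ∈? X) then g u else 0#

  restrict-∈ : ∀ (X : Subset n) g {u} → u ∈ X → restrict X g u ≡ g u
  restrict-∈ X g {u} u∈X with u ∈? X
  ... | yes _   = ≡.refl
  ... | no  u∉X = contradiction u∈X u∉X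

  restrict-∉ : ∀ (X : Subset n) g {u} → u ∉ X → restrict X g u ≡ 0#
  restrict-∉ X g {u} u∉X with u ∈? X
  ... | yes u∈X = contradiction u∈X u∉X
  ... | no  _   = ≡.refl

  restrict-≤ : ∀ (X : Subset n) g {u v} → (u ∈ X → g u ≤ v) → (u ∉ X → 0# ≤ v) → restrict X g u ≤ v
  restrict-≤ X g {u} ∈≤ ∉≤ with u ∈? X
  ... | yes u∈X = ∈≤ u∈X
  ... | no  u∉X = ∉≤ u∉X

  ≤-restrict : ∀ (X : Subset n) g {u v} → (u ∈ X → v ≤ g u) → (u ∉ X → v ≤ 0#) → v ≤ restrict X g u
  ≤-restrict X g {u} ≤∈ ≤∉ with u ∈? X
  ... | yes u∈X = ≤∈ u∈X
  ... | no  u∉X = ≤∉ u∉X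

  Σ-mono-⊆ : ∀ (X Y : Subset n) g → (∀ {u} → u ∈ Y → 0# ≤ g u) → X ⊆ Y → Σ[ X ] g ≤ Σ[ Y ] g
  Σ-mono-⊆ X Y g 0≤g X⊆Y = sum-mono {g = restrict X g} {restrict Y g} λ u → restrict-≤ X g
    (λ u∈X → ≤-reflexive (reflexive (≡.sym (restrict-∈ Y g (X⊆Y u∈X)))))
    (λ _ → ≤-restrict Y g 0≤g (λ _ → ≤-refl))

  Σ-mono : ∀ (X : Subset n) g h → (∀ {u} → u ∈ X → g u ≤ h u) → Σ[ X ] g ≤ Σ[ X ] h
  Σ-mono X g h g≤h = sum-mono {g = restrict X g} {restrict X h} λ u → restrict-≤ X g
    (λ u∈X → ≤-trans (g≤h u∈X) (≤-reflexive (reflexive (≡.sym (restrict-∈ X h u∈X)))))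
    (λ u∉X → ≤-reflexive (reflexive (≡.sym (restrict-∉ X h u∉X))))

  Σ-cong : ∀ (X : Subset n) g h → (∀ {u} → u ∈ X → g u ≈ h u) → Σ[ X ] g ≈ Σ[ X ] h
  Σ-cong X g h g≈h = ≤-antisym (Σ-mono X g h (λ u∈ → ≤-reflexive (g≈h u∈)))
                               (Σ-mono X h g (λ u∈ → ≤-reflexive (sym (g≈h u∈))))

  Σ-*ˡ : ∀ (X : Subset n) v g → Σ[ X ] (λ u → v * g u) ≈ v * Σ[ X ] g
  Σ-*ˡ X v g = trans (sum-cong-≋ pointwise) (sym (*-distribˡ-sum v (restrict X g)))
    where
    pointwise : ∀ u → restrict X (λ u → v * g u) u ≈ v * restrict X g u
    pointwise u with u ∈? X
    ... | yes _ = refl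
    ... | no  _ = sym (zeroʳ v)

  Σ-+ : ∀ (X : Subset n) g h → Σ[ X ] (λ u → g u + h u) ≈ Σ[ X ] g + Σ[ X ] h
  Σ-+ X g h = trans (sum-cong-≋ pointwise) (∑-distrib-+ (restrict X g) (restrict X h))
    where
    pointwise : ∀ u → restrict X (λ u → g u + h u) u ≈ restrict X g u + restrict X h u
    pointwise u with u ∈? X
    ... | yes _ = refl
    ... | no  _ = sym (+-identityˡ _)

  Σ-zero : ∀ (X : Subset n) → Σ[ X ] (λ _ → 0#) ≈ 0#
  Σ-zero {n} X = trans (sum-cong-≋ pointwise) (sum-zero n)
    where
    pointwise : ∀ u → restrict X (λ _ → 0#) u ≈ 0#
    pointwise u with u ∈? X
    ... | yes _ = refl
    ... | no  _ = refl

  Σ-nonNegative : ∀ (X : Subset n) g → (∀ {u} → u ∈ X → 0# ≤ g u) → 0# ≤ Σ[ X ] g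
  Σ-nonNegative X g 0≤g = ≤-trans (≤-reflexive (sym (Σ-zero X))) (Σ-mono X (λ _ → 0#) g 0≤g)

  Σ-⊥ : ∀ (g : Fin n → Carrier) → Σ[ ⊥ ] g ≈ 0#
  Σ-⊥ {n} g = trans (Σ-cong ⊥ g (λ _ → 0#) (λ u∈ → contradiction u∈ ∉⊥)) (Σ-zero {n} ⊥)

  Σ-∪-disjoint : ∀ (X Y : Subset n) g → (∀ {u} → u ∈ X → u ∉ Y) → Σ[ X ∪ Y ] g ≈ Σ[ X ] g + Σ[ Y ] g
  Σ-∪-disjoint X Y g disjoint = trans (sum-cong-≋ pointwise) (∑-distrib-+ (restrict X g) (restrict Y g))
    where
    pointwise : ∀ u → restrict (X ∪ Y) g u ≈ restrict X g u + restrict Y g u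
    pointwise u with u ∈? X | u ∈? Y
    ... | yes u∈X | yes u∈Y = contradiction u∈Y (disjoint u∈X)
    ... | yes u∈X | no _ = trans (reflexive (restrict-∈ (X ∪ Y) g (p⊆p∪q Y u∈X))) (sym (+-identityʳ _))
    ... | no _ | yes u∈Y = trans (reflexive (restrict-∈ (X ∪ Y) g (q⊆p∪q X Y u∈Y))) (sym (+-identityˡ _))
    ... | no u∉X | no u∉Y = trans (reflexive (restrict-∉ (X ∪ Y) g (λ u∈ → [ u∉X , u∉Y ]′ (x∈p∪q⁻ X Y u∈))))
                                    (sym (+-identityˡ _))

  Σ-∪-≤ : ∀ (X Y : Subset n) g → (∀ u → 0# ≤ g u) → Σ[ X ∪ Y ] g ≤ Σ[ X ] g + Σ[ Y ] g
  Σ-∪-≤ X Y g 0≤g = begin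
    Σ[ X ∪ Y ] g              ≡⟨ ≡.cong (λ Z → Σ[ Z ] g) (⊆-antisym to from) ⟩
    Σ[ X ∪ (Y ─ X) ] g        ≈⟨ Σ-∪-disjoint X (Y ─ X) g (λ u∈X u∈ → ─-∉ Y X u∈ u∈X) ⟩
    Σ[ X ] g + Σ[ Y ─ X ] g   ≤⟨ +-monoʳ-≤ _ (Σ-mono-⊆ (Y ─ X) Y g (λ _ → 0≤g _) (p─q⊆p Y X)) ⟩
    Σ[ X ] g + Σ[ Y ] g       ∎
    where
    to : X ∪ Y ⊆ X ∪ (Y ─ X)
    to {u} u∈ with u ∈? X
    ... | yes u∈X = p⊆p∪q _ u∈X
    ... | no u∉X = q⊆p∪q X _ (x∈p∧x∉q⇒x∈p─q ([ (λ u∈X → contradiction u∈X u∉X) , id ]′ (x∈p∪q⁻ X Y u∈)) u∉X)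
    from : X ∪ (Y ─ X) ⊆ X ∪ Y
    from = ∪-elim X (Y ─ X) (p⊆p∪q Y) (λ u∈ → q⊆p∪q X Y (p─q⊆p Y X u∈))

  Σ-⁅⁆ : ∀ (g : Fin n → Carrier) v → Σ[ ⁅ v ⁆ ] g ≈ g v
  Σ-⁅⁆ {suc n} g zero    = trans (+-congˡ (Σ-⊥ (g ∘ suc))) (+-identityʳ _)
  Σ-⁅⁆ {suc n} g (suc v) = trans (+-identityˡ _) (Σ-⁅⁆ (g ∘ suc) v)

  Σ-fromList : ∀ {us : List (Fin n)} (g : Fin n → Carrier) → Unique us → Σ[ fromList us ] g ≈ sumˡ g us
  Σ-fromList g []                    = Σ-⊥ g
  Σ-fromList {us = u ∷ us} g (u∉us ∷ unique) = begin-equality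
    Σ[ ⁅ u ⁆ ∪ fromList us ] g             ≈⟨ Σ-∪-disjoint ⁅ u ⁆ (fromList us) g disjoint ⟩
    Σ[ ⁅ u ⁆ ] g + Σ[ fromList us ] g      ≈⟨ +-cong (Σ-⁅⁆ g u) (Σ-fromList g unique) ⟩
    g u + sumˡ g us                        ∎
    where
    disjoint : ∀ {v} → v ∈ ⁅ u ⁆ → v ∉ fromList us
    disjoint v∈ v∈us = All.lookup u∉us (∈-fromList⁻ us v∈us) (≡.sym (∈-⁅⁆⁻ v∈))

  -- Submodular functions

  module _ {n} {f : Subset n → Carrier} (submodular : Submodular f) where

    gain : Fin n → Subset n → Carrier
    gain u X = f (X ∪ ⁅ u ⁆) - f X

    diminishing : ∀ {X Y W} → X ⊆ Y → W ∩ Y ⊆ X → f (Y ∪ W) + f X ≤ f (X ∪ W) + f Y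
    diminishing {X} {Y} {W} X⊆Y W∩Y⊆X =
      ≡.subst₂ (λ U V → f U + f V ≤ f (X ∪ W) + f Y) union intersection (submodular (X ∪ W) Y)
      where
      union : (X ∪ W) ∪ Y ≡ Y ∪ W
      union = ⊆-antisym
        (∪-elim (X ∪ W) Y (∪-elim X W (p⊆p∪q W ∘ X⊆Y) (q⊆p∪q Y W)) (p⊆p∪q W))
        (∪-elim Y W (q⊆p∪q (X ∪ W) Y) (p⊆p∪q Y ∘ q⊆p∪q X W))
      intersection : (X ∪ W) ∩ Y ≡ X
      intersection = ⊆-antisym
        (λ u∈ → let u∈X∪W , u∈Y = x∈p∩q⁻ (X ∪ W) Y u∈ in
          [ id , (λ u∈W → W∩Y⊆X (x∈p∩q⁺ (u∈W , u∈Y))) ]′ (x∈p∪q⁻ X W u∈X∪W))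
        (λ u∈X → x∈p∩q⁺ (p⊆p∪q W u∈X , X⊆Y u∈X))

    gain-∈ : ∀ {u X} → u ∈ X → gain u X ≈ 0#
    gain-∈ {u} {X} u∈X = trans (+-congʳ (reflexive (≡.cong f (∪-absorb (⁅⁆⊆ u∈X))))) (-‿inverseʳ _)

    gain-antitone : ∀ {u X Y} → X ⊆ Y → u ∉ Y → gain u Y ≤ gain u X
    gain-antitone {u} {X} {Y} X⊆Y u∉Y = ≤-by (0≤y-x (diminishing X⊆Y (λ v∈ →
        let v∈⁅u⁆ , v∈Y = x∈p∩q⁻ ⁅ u ⁆ Y v∈ in contradiction (≡.subst (_∈ Y) (∈-⁅⁆⁻ v∈⁅u⁆) v∈Y) u∉Y)))
      (solve 4 (λ Yu X Xu Y → Xu :- X := Yu :- Y :+ (Xu :+ Y :- (Yu :+ X))) refl _ _ _ _)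

    gains-bound : ∀ X {us} → Unique us → f (X ∪ fromList us) ≤ f X + Σ[ fromList us ] (λ u → gain u X)
    gains-bound X {[]}     _                = begin
      f (X ∪ ⊥)                             ≡⟨ ≡.cong f (∪-identityʳ X) ⟩
      f X                                   ≈⟨ +-identityʳ _ ⟨
      f X + 0#                              ≈⟨ +-congˡ (Σ-⊥ (λ u → gain u X)) ⟨
      f X + Σ[ ⊥ ] (λ u → gain u X)         ∎
    gains-bound X {u ∷ us} (u∉us ∷ unique) = begin
      f (X ∪ (⁅ u ⁆ ∪ fromList us))                       ≡⟨ ≡.cong (λ Z → f (X ∪ Z)) (∪-comm ⁅ u ⁆ _) ⟩
      f (X ∪ (fromList us ∪ ⁅ u ⁆))                       ≡⟨ ≡.cong f (∪-assoc X _ _) ⟨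
      f (Z ∪ ⁅ u ⁆) ≈⟨ solve 2 (λ a b → a := b :+ (a :- b)) refl _ (f Z) ⟩
      f Z + gain u Z                                      ≤⟨ +-mono-≤ (gains-bound X unique) last ⟩
      f X + Σ[ fromList us ] g + gain u X ≈⟨ solve 3 (λ a b c → a :+ b :+ c := a :+ (c :+ b)) refl _ _ _ ⟩
      f X + (gain u X + Σ[ fromList us ] g)               ≈⟨ +-congˡ (+-congˡ (Σ-fromList g unique)) ⟩
      f X + (gain u X + sumˡ g us)                        ≈⟨ +-congˡ (Σ-fromList g (u∉us ∷ unique)) ⟨
      f X + Σ[ fromList (u ∷ us) ] g                      ∎
      where
      g : Fin n → Carrier
      g v = gain v X
      Z = X ∪ fromList us
      last : gain u Z ≤ gain u X
      last with u ∈? X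
      ... | yes u∈X = ≤-reflexive (trans (gain-∈ (p⊆p∪q (fromList us) u∈X)) (sym (gain-∈ u∈X)))
      ... | no  u∉X = gain-antitone (p⊆p∪q (fromList us))
        (λ u∈Z → [ u∉X , (λ u∈us → All.lookup u∉us (∈-fromList⁻ us u∈us) ≡.refl) ]′ (x∈p∪q⁻ X _ u∈Z))

    union-bound : ∀ X Y → f (X ∪ Y) ≤ f X + Σ[ Y ] (λ u → gain u X)
    union-bound X Y = ≡.subst (λ Z → f (X ∪ Z) ≤ f X + Σ[ Z ] (λ u → gain u X))
      (fromList-elements Y) (gains-bound X (elements-unique Y))

    union-≤ : (∀ X → 0# ≤ f X) → ∀ X Y → f (X ∪ Y) ≤ f X + f Y
    union-≤ 0≤f X Y = ≤-trans (≤-by (0≤f (X ∩ Y)) refl) (submodular X Y)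

  -- Uniformly random permutations

  sumˡ-select : ∀ (g : X → Carrier) xs → sumˡ (λ (y , _) → g y) (select xs) ≈ sumˡ g xs
  sumˡ-select g []       = refl
  sumˡ-select g (x ∷ xs) = +-congˡ (trans (reflexive (sumˡ-map _ _ (select xs))) (sumˡ-select g xs))

  -- Conditioning a uniformly random permutation on its first entry.
  sumˡ-permutations : ∀ (h : List X → Carrier) x xs →
    sumˡ h (permutations (x ∷ xs)) ≈
    sumˡ (λ (y , ys) → sumˡ (λ p → h (y ∷ p)) (permutations ys)) (select (x ∷ xs))
  sumˡ-permutations h x []       = sym (+-identityʳ _)
  sumˡ-permutations h x (z ∷ zs) = begin-equality
    sumˡ h (permutations (x ∷ xs))
      ≈⟨ sumˡ-concatMap h (insertions x) (permutations xs) ⟩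
    sumˡ (λ p → sumˡ h (insertions x p)) (permutations xs)
      ≈⟨ sumˡ-permutations _ z zs ⟩
    sumˡ (λ (y , ys) → sumˡ (λ p → h (x ∷ y ∷ p) + sumˡ h (map (y ∷_) (insertions x p)))
      (permutations ys)) (select xs)
      ≈⟨ sumˡ-cong (select xs) (λ {(y , ys)} _ → trans (sumˡ-+ _ _ (permutations ys)) (+-congˡ (trans
           (sumˡ-cong (permutations ys) (λ {p} _ → reflexive (sumˡ-map h (y ∷_) (insertions x p))))
           (sym (sumˡ-concatMap (λ q → h (y ∷ q)) (insertions x) (permutations ys)))))) ⟩
    sumˡ (λ (y , ys) → sumˡ (λ p → h (x ∷ y ∷ p)) (permutations ys) +
                       sumˡ (λ q → h (y ∷ q)) (permutations (x ∷ ys))) (select xs)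
      ≈⟨ sumˡ-+ _ _ (select xs) ⟩
    sumˡ (λ (y , ys) → sumˡ (λ p → h (x ∷ y ∷ p)) (permutations ys)) (select xs) +
    sumˡ (λ (y , ys) → sumˡ (λ q → h (y ∷ q)) (permutations (x ∷ ys))) (select xs)
      ≈⟨ +-cong (sumˡ-permutations (λ p → h (x ∷ p)) z zs) (reflexive (sumˡ-map _ _ (select xs))) ⟨
    sumˡ (λ p → h (x ∷ p)) (permutations xs) +
    sumˡ (λ (y , ys) → sumˡ (λ p → h (y ∷ p)) (permutations ys)) (map (λ (y , ys) → y , x ∷ ys) (select xs))
      ∎
    where xs = z ∷ zs

  uniform-permutations-isDistribution : ∀ (xs : List X) → IsDistribution (uniform (permutations xs))
  uniform-permutations-isDistribution xs with permutations xs | length-permutations xs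
  ... | [] | 0≡n! = contradiction (ℕₚ.1≤n! (length xs)) (λ 1≤n! → ℕₚ.1+n≰n (≡.subst (1 ℕ.≤_) (≡.sym 0≡n!) 1≤n!))
  ... | p ∷ ps | _    = uniform-isDistribution p ps

  -- GetSEQ

  module Sampling (argMax : ArgMax) {n : ℕ} (usm : Subset n → Dist (Subset n)) (B : Carrier)
                  (f : Subset n → Carrier) (c : Fin n → Carrier) (0<c : ∀ u → 0# < c u) where
    open Algorithm argMax usm B f c

    feasible-⊆ : ∀ {X Y} → X ⊆ Y → Feasible c B Y → Feasible c B X
    feasible-⊆ {X} {Y} X⊆Y = ≤-trans (Σ-mono-⊆ X Y c (λ {u} _ → proj₁ (0<c u)) X⊆Y)

    prefixLength : Subset n → List (Fin n) → List (Fin n) → ℕ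
    prefixLength A V vs = greatest (λ i → feasible? (A ∪ fromList V ∪ fromList (take i vs))) (length vs)

    extend : Subset n → List (Fin n) → List (Fin n) → List (Fin n)
    extend A V vs = V ++ take (prefixLength A V vs) vs

    remaining : Subset n → List (Fin n) → Subset n → Subset n
    remaining A V L = ⟪ (λ u → u ∈? (L ─ fromList V) ×-dec feasible? (A ∪ fromList V ∪ ⁅ u ⁆)) ⟫

    remaining-⊆ : ∀ A V L → remaining A V L ⊆ L
    remaining-⊆ A V L u∈ = p─q⊆p L (fromList V)
      (proj₁ (∈⟪⟫⁻ (λ u → u ∈? (L ─ fromList V) ×-dec feasible? (A ∪ fromList V ∪ ⁅ u ⁆)) u∈))

    feasible-prefix : ∀ A {V V′ u} → fromList V ⊆ fromList V′ →
                      Feasible c B (A ∪ fromList V′ ∪ ⁅ u ⁆) → Feasible c B (A ∪ fromList V ∪ ⁅ u ⁆)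
    feasible-prefix A {V} V⊆V′ = feasible-⊆ (∪-elim A _ (p⊆p∪q _)
      (q⊆p∪q A _ ∘ ∪-elim (fromList V) _ (p⊆p∪q _ ∘ V⊆V′) (q⊆p∪q _ _)))

    -- The loop of getSEQ is local to its where block.  The placeholders below are solved
    -- to it by unification against one unfolding of getSEQ.
    mutual
      seqLoop : (A L₀ : Subset n) → ℕ → List (Fin n) → Subset n → Dist (List (Fin n))
      seqLoop = _

      private
        firstRound : (A L₀ : Subset n) → ℕ → List (Fin n) → Dist (List (Fin n))
        firstRound = _

        getSEQ-unfold : ∀ A L k → ∣ L ∣ ≡ suc k →
          getSEQ A L ≡ (if does (nonempty? L) then uniform (permutations (elements L)) >>= firstRound A L k
                                              else return [])
        getSEQ-unfold A L k eq rewrite eq = ≡.refl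

        firstRound-loop : ∀ A L k vs →
          firstRound A L k vs ≡ seqLoop A L k (extend A [] vs) (remaining A (extend A [] vs) L)
        firstRound-loop A L k vs with extend A [] vs
        ... | V with remaining A V L
        ... | L′ = ≡.refl

    Next : Subset n → Subset n → List (Fin n) → Fin n → Set ℓ₂
    Next A L V u = u ∈ L × u ∉ fromList V × Feasible c B (A ∪ fromList V ∪ ⁅ u ⁆)

    step : Subset n → (List (Fin n) → Carrier) → List (Fin n) → Fin n → Carrier
    step A H V u = if does (feasible? (A ∪ fromList V ∪ ⁅ u ⁆)) then H (V ++ u ∷ []) - H V else 0#

    Drift : Subset n → Subset n → (List (Fin n) → Carrier) → Set ℓ₂
    Drift A L H = ∀ V {ys} → Unique ys → (∀ {u} → u ∈ˡ ys → u ∈ L) → (∀ {u} → Next A L V u → u ∈ˡ ys) →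
                  0# ≤ sumˡ (step A H V) ys

    extend-infeasible : ∀ A V {y} p → ¬ Feasible c B (A ∪ fromList V ∪ ⁅ y ⁆) → extend A V (y ∷ p) ≡ V
    extend-infeasible A V {y} p infeasible = ≡.trans
      (≡.cong (λ l → V ++ take l (y ∷ p)) (greatest-none
        (λ i → feasible? (A ∪ fromList V ∪ fromList (take i (y ∷ p)))) (suc (length p))
        λ i Pi → infeasible (feasible-⊆ (∪-elim A _ (p⊆p∪q _)
          (q⊆p∪q A _ ∘ ∪-elim (fromList V) _ (p⊆p∪q _) (q⊆p∪q (fromList V) _ ∘ p⊆p∪q _))) Pi)))
      (Listₚ.++-identityʳ V)

    fromList-snoc : ∀ (A : Subset n) V y ys →
      A ∪ fromList V ∪ fromList (y ∷ ys) ≡ A ∪ fromList (V ++ y ∷ []) ∪ fromList ys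
    fromList-snoc A V y ys = ≡.cong (A ∪_) (≡.trans (≡.sym (∪-assoc (fromList V) ⁅ y ⁆ (fromList ys)))
      (≡.cong (_∪ fromList ys) (≡.sym (≡.trans (fromList-++ V (y ∷ []))
        (≡.cong (fromList V ∪_) (∪-identityʳ ⁅ y ⁆))))))

    extend-feasible : ∀ A V {y} p → Feasible c B (A ∪ fromList V ∪ ⁅ y ⁆) →
                      extend A V (y ∷ p) ≡ extend A (V ++ y ∷ []) p
    extend-feasible A V {y} p feasible = ≡.trans
      (≡.cong (λ l → V ++ take l (y ∷ p)) (≡.trans (greatest-suc P? (length p) P1)
        (≡.cong suc (greatest-cong (λ i → P? (suc i)) Q? (length p)
          (λ {i} → ≡.subst (Feasible c B) (fromList-snoc A V y (take i p)))
          (λ {i} → ≡.subst (Feasible c B) (≡.sym (fromList-snoc A V y (take i p))))))))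
      (≡.sym (Listₚ.++-assoc V (y ∷ []) _))
      where
      P? = λ i → feasible? (A ∪ fromList V ∪ fromList (take i (y ∷ p)))
      Q? = λ i → feasible? (A ∪ fromList (V ++ y ∷ []) ∪ fromList (take i p))
      P1 : Feasible c B (A ∪ fromList V ∪ fromList (y ∷ []))
      P1 = ≡.subst (λ Z → Feasible c B (A ∪ fromList V ∪ Z)) (≡.sym (∪-identityʳ ⁅ y ⁆)) feasible

    permutations-drift : ∀ {A L H} → Drift A L H → ∀ m V {ys} → length ys ≡ m → Unique ys →
      (∀ {u} → u ∈ˡ ys → u ∈ L) → (∀ {u} → Next A L V u → u ∈ˡ ys) →
      0# ≤ sumˡ (λ p → H (extend A V p) - H V) (permutations ys)
    permutations-drift {A} {L} {H} drift zero V {[]} ≡.refl unique ys⊆L next = ≤-reflexive (begin-equality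
      0#                              ≈⟨ -‿inverseʳ (H V) ⟨
      H V - H V                       ≡⟨ ≡.cong (λ W → H W - H V) (Listₚ.++-identityʳ V) ⟨
      H (extend A V []) - H V         ≈⟨ +-identityʳ _ ⟨
      H (extend A V []) - H V + 0#    ∎)
    permutations-drift {A} {L} {H} drift (suc m) V {ys = z ∷ zs} eq unique ys⊆L next = begin
      0#
        ≤⟨ *-nonNegative (0≤fromℕ (m !)) (drift V unique ys⊆L next) ⟩
      K * sumˡ (step A H V) ys
        ≈⟨ *-congˡ (sumˡ-select (step A H V) ys) ⟨
      K * sumˡ (λ (y , _) → step A H V y) (select ys)
        ≈⟨ sumˡ-*ˡ K _ (select ys) ⟨
      sumˡ (λ (y , _) → K * step A H V y) (select ys)
        ≤⟨ sumˡ-mono (select ys) (λ {(y , ys′)} y∈ → branch y ys′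
             (All.lookup (select-↭ ys) y∈) (All.lookup (select-unique unique) y∈)) ⟩
      sumˡ (λ (y , ys) → sumˡ (λ p → H (extend A V (y ∷ p)) - H V) (permutations ys)) (select ys)
        ≈⟨ sumˡ-permutations (λ p → H (extend A V p) - H V) z zs ⟨
      sumˡ (λ p → H (extend A V p) - H V) (permutations ys)
        ∎
      where
      ys = z ∷ zs
      K  = fromℕ (m !)

      branch : ∀ y ys′ → ys ↭ y ∷ ys′ → Unique ys′ →
               K * step A H V y ≤ sumˡ (λ p → H (extend A V (y ∷ p)) - H V) (permutations ys′)
      branch y ys′ ys↭ unique′ with feasible? (A ∪ fromList V ∪ ⁅ y ⁆)
      ... | no infeasible = ≤-reflexive (begin-equality
        K * 0#                                                        ≈⟨ zeroʳ K ⟩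
        0#                                                            ≈⟨ zeroʳ _ ⟨
        fromℕ (length (permutations ys′)) * 0# ≈⟨ sumˡ-const 0# (permutations ys′) ⟨
        sumˡ (λ _ → 0#) (permutations ys′) ≈⟨ sumˡ-cong (permutations ys′) (λ {p} _ →
          trans (sym (-‿inverseʳ (H V))) (+-congʳ (reflexive
            (≡.cong H (≡.sym (extend-infeasible A V p infeasible)))))) ⟩
        sumˡ (λ p → H (extend A V (y ∷ p)) - H V) (permutations ys′)  ∎)
      ... | yes feasible = begin
        K * (H V′ - H V)
          ≡⟨ ≡.cong (λ l → fromℕ l * (H V′ - H V)) (≡.sym
            (≡.trans (length-permutations ys′) (≡.cong _! length-ys′))) ⟩
        fromℕ (length (permutations ys′)) * (H V′ - H V)
          ≈⟨ sumˡ-const (H V′ - H V) (permutations ys′) ⟨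
        sumˡ (λ _ → H V′ - H V) (permutations ys′)
          ≤⟨ x≤y+x (permutations-drift drift m V′ length-ys′ unique′ ys′⊆L next′) ⟩
        sumˡ (λ p → H (extend A V′ p) - H V′) (permutations ys′) + sumˡ (λ _ → H V′ - H V) (permutations ys′)
          ≈⟨ sumˡ-+ _ _ (permutations ys′) ⟨
        sumˡ (λ p → H (extend A V′ p) - H V′ + (H V′ - H V)) (permutations ys′)
          ≈⟨ sumˡ-cong (permutations ys′) (λ {p} _ → trans
               (solve 3 (λ a b c → a :- b :+ (b :- c) := a :- c) refl _ (H V′) (H V))
               (+-congʳ (reflexive (≡.cong H (≡.sym (extend-feasible A V p feasible)))))) ⟩
        sumˡ (λ p → H (extend A V (y ∷ p)) - H V) (permutations ys′)
          ∎
        where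
        V′ = V ++ y ∷ []
        length-ys′ : length ys′ ≡ m
        length-ys′ = ℕₚ.suc-injective (≡.trans (≡.sym (↭-length ys↭)) eq)
        ys′⊆L : ∀ {u} → u ∈ˡ ys′ → u ∈ L
        ys′⊆L u∈ = ys⊆L (∈-resp-↭ (↭-sym ys↭) (there u∈))
        V⊆V′ : fromList V ⊆ fromList V′
        V⊆V′ u∈ = ∈-fromList⁺ (∈-++⁺ˡ (∈-fromList⁻ V u∈))
        next′ : ∀ {u} → Next A L V′ u → u ∈ˡ ys′
        next′ {u} (u∈L , u∉V′ , feasible′) with ∈-resp-↭ ys↭ (next (u∈L , u∉V′ ∘ V⊆V′ ,
          feasible-prefix A {V} {V′} V⊆V′ feasible′))
        ... | there u∈ys′ = u∈ys′
        ... | here ≡.refl = contradiction (∈-fromList⁺ {us = V′} (∈-++⁺ʳ V (here ≡.refl))) u∉V′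

    uniform-drift : ∀ {A L H} → Drift A L H → ∀ V {ys} → Unique ys →
      (∀ {u} → u ∈ˡ ys → u ∈ L) → (∀ {u} → Next A L V u → u ∈ˡ ys) →
      H V ≤ 𝔼 (λ p → H (extend A V p)) (uniform (permutations ys))
    uniform-drift {A} {L} {H} drift V {ys} unique ys⊆L next = begin
      H V
        ≈⟨ 𝔼-const (H V) (uniform ps) is-dist ⟨
      𝔼 (λ _ → H V) (uniform ps)
        ≤⟨ x≤y+x (≤-trans 0≤mean (≤-reflexive (sym (𝔼-uniform (λ p → H (extend A V p) - H V) ps)))) ⟩
      𝔼 (λ p → H (extend A V p) - H V) (uniform ps) + 𝔼 (λ _ → H V) (uniform ps)
        ≈⟨ 𝔼-+ (λ p → H (extend A V p) - H V) (λ _ → H V) (uniform ps) ⟨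
      𝔼 (λ p → H (extend A V p) - H V + H V) (uniform ps)
        ≈⟨ 𝔼-cong (uniform ps) (λ p → solve 2 (λ a b → a :- b :+ b := a) refl (H (extend A V p)) (H V)) ⟩
      𝔼 (λ p → H (extend A V p)) (uniform ps)
        ∎
      where
      ps = permutations ys
      is-dist = uniform-permutations-isDistribution ys
      0≤mean : 0# ≤ fromℕ (length ps) ⁻¹ * sumˡ (λ p → H (extend A V p) - H V) ps
      0≤mean with length ps | length-permutations ys
      ... | l | ≡.refl with length ys ! | ℕₚ.1≤n! (length ys)
      ... | suc l | _ = *-nonNegative (⁻¹-nonNegative (0<fromℕ l))
        (permutations-drift drift (length ys) V ≡.refl unique ys⊆L next)

    seqLoop-isDistribution : ∀ A L₀ k V L → IsDistribution (seqLoop A L₀ k V L)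
    seqLoop-isDistribution A L₀ zero    V L = return-isDistribution V
    seqLoop-isDistribution A L₀ (suc k) V L with nonempty? L
    ... | no  _ = return-isDistribution V
    ... | yes _ = >>=-isDistribution (uniform-permutations-isDistribution (elements L))
                    λ vs → seqLoop-isDistribution A L₀ k _ _

    getSEQ-isDistribution : ∀ A L → IsDistribution (getSEQ A L)
    getSEQ-isDistribution A L = seqLoop-isDistribution A L ∣ L ∣ [] L

    seqLoop-drift : ∀ {A L H} → Drift A L H → ∀ L₀ k V L′ → L′ ⊆ L → (∀ {u} → Next A L V u → u ∈ L′) →
                    H V ≤ 𝔼 H (seqLoop A L₀ k V L′)
    seqLoop-drift {H = H} drift L₀ zero    V L′ L′⊆L next = ≤-reflexive (sym (𝔼-return H V))
    seqLoop-drift {A} {L} {H} drift L₀ (suc k) V L′ L′⊆L next with nonempty? L′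
    ... | no  _ = ≤-reflexive (sym (𝔼-return H V))
    ... | yes _ = begin
      H V
        ≤⟨ uniform-drift drift V (elements-unique L′) (L′⊆L ∘ ∈-elements⁻) (∈-elements⁺ ∘ next) ⟩
      𝔼 (λ vs → H (extend A V vs)) (uniform ps)
        ≤⟨ 𝔼-mono-always (proj₁ (uniform-permutations-isDistribution (elements L′))) (λ vs →
             seqLoop-drift drift L₀ k (extend A V vs) (remaining A (extend A V vs) L′)
               (L′⊆L ∘ remaining-⊆ A (extend A V vs) L′) (next′ vs)) ⟩
      𝔼 (λ vs → 𝔼 H (seqLoop A L₀ k (extend A V vs) (remaining A (extend A V vs) L′))) (uniform ps)
        ≈⟨ 𝔼->>= H (uniform ps) (λ vs → seqLoop A L₀ k (extend A V vs) (remaining A (extend A V vs) L′)) ⟨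
      𝔼 H (uniform ps >>= (λ vs → seqLoop A L₀ k (extend A V vs) (remaining A (extend A V vs) L′)))
        ∎
      where
      ps = permutations (elements L′)
      module _ (vs : List (Fin n)) where
        V′ = extend A V vs
        R? = λ u → u ∈? (L′ ─ fromList V′) ×-dec feasible? (A ∪ fromList V′ ∪ ⁅ u ⁆)
        V⊆V′ : fromList V ⊆ fromList V′
        V⊆V′ u∈ = ∈-fromList⁺ (∈-++⁺ˡ (∈-fromList⁻ V u∈))
        next′ : ∀ {u} → Next A L V′ u → u ∈ remaining A V′ L′
        next′ (u∈L , u∉V′ , feasible) = ∈⟪⟫⁺ R? (x∈p∧x∉q⇒x∈p─q (next (u∈L , u∉V′ ∘ V⊆V′ ,
          feasible-prefix A {V} {V′} V⊆V′ feasible)) u∉V′ ,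
          feasible)

    getSEQ-drift : ∀ {A L H} → Drift A L H → H [] ≤ 𝔼 H (getSEQ A L)
    getSEQ-drift {A} {L} drift = seqLoop-drift drift L ∣ L ∣ [] L id proj₁

    Valid : Subset n → Subset n → List (Fin n) → Set ℓ₂
    Valid A L V = All (_∈ L) V × Feasible c B (A ∪ fromList V)

    permutations-surely : ∀ {X : Set} (xs : List X) → AlmostSurely (_↭ xs) (uniform (permutations xs))
    permutations-surely xs = Allₚ.map⁺ (All.map (λ p↭ _ → p↭) (permutations-↭ xs))

    extend-valid : ∀ {A L V vs} → Valid A L V → All (_∈ L) vs → Valid A L (extend A V vs)
    extend-valid {A} {L} {V} {vs} (V⊆L , feasible) vs⊆L =
      Allₚ.++⁺ V⊆L (Allₚ.take⁺ (prefixLength A V vs) vs⊆L) ,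
      ≡.subst (λ Z → Feasible c B (A ∪ Z)) (≡.sym (fromList-++ V _))
        (greatest-satisfies (λ i → feasible? (A ∪ fromList V ∪ fromList (take i vs))) (length vs)
          (≡.subst (λ Z → Feasible c B (A ∪ Z)) (≡.sym (∪-identityʳ (fromList V))) feasible))

    seqLoop-valid : ∀ {A L} L₀ k V L′ → L′ ⊆ L → Valid A L V →
      AlmostSurely (λ W → Valid A L W × length V ℕ.≤ length W) (seqLoop A L₀ k V L′)
    seqLoop-valid L₀ zero V L′ L′⊆L valid = return-surely (valid , ℕₚ.≤-refl)
    seqLoop-valid {A} {L} L₀ (suc k) V L′ L′⊆L valid with nonempty? L′
    ... | no  _ = return-surely (valid , ℕₚ.≤-refl)
    ... | yes _ = >>=-surely (proj₁ (uniform-permutations-isDistribution (elements L′)))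
      (permutations-surely (elements L′))
      λ {vs} vs↭ → All.map
        (λ v-valid 0<w → proj₁ (v-valid 0<w) , ℕₚ.≤-trans (Listₚ.length-++-≤ˡ V) (proj₂ (v-valid 0<w)))
        (seqLoop-valid L₀ k (extend A V vs) (remaining A (extend A V vs) L′)
          (L′⊆L ∘ remaining-⊆ A (extend A V vs) L′)
          (extend-valid valid (All.tabulate (λ v∈ → L′⊆L (∈-elements⁻ (∈-resp-↭ vs↭ v∈))))))

    getSEQ-valid : ∀ {A L u} → u ∈ L → (∀ {v} → v ∈ L → Feasible c B (A ∪ ⁅ v ⁆)) →
                   AlmostSurely (λ V → Valid A L V × 1 ℕ.≤ length V) (getSEQ A L)
    getSEQ-valid {A} {L} {u} u∈L feasible with ∣ L ∣ | ℕₚ.≤-trans (ℕₚ.≤-reflexive (≡.sym (∣⁅x⁆∣≡1 u)))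
      (p⊆q⇒∣p∣≤∣q∣ (⁅⁆⊆ u∈L))
    ... | suc k | _ with nonempty? L
    ... | no  empty = contradiction (u , u∈L) empty
    ... | yes _ = >>=-surely (proj₁ (uniform-permutations-isDistribution (elements L)))
      (permutations-surely (elements L))
      λ {vs} vs↭ → All.map
        (λ v-valid 0<w → proj₁ (v-valid 0<w) , ℕₚ.≤-trans (nonempty-extend vs↭) (proj₂ (v-valid 0<w)))
        (seqLoop-valid L k (extend A [] vs) (remaining A (extend A [] vs) L)
          (remaining-⊆ A (extend A [] vs) L)
          (extend-valid ([] , feasible-⊆ (∪-elim A ⊥ (p⊆p∪q _) (λ u∈⊥ → contradiction u∈⊥ ∉⊥)) (feasible u∈L))
            (All.tabulate (λ v∈ → ∈-elements⁻ (∈-resp-↭ vs↭ v∈)))))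
      where
      nonempty-extend : ∀ {vs} → vs ↭ elements L → 1 ℕ.≤ length (extend A [] vs)
      nonempty-extend {[]}     vs↭ with ∈-resp-↭ (↭-sym vs↭) (∈-elements⁺ u∈L)
      ... | ()
      nonempty-extend {v ∷ vs} vs↭ = ≡.subst (λ V → 1 ℕ.≤ length V)
        (≡.sym (extend-feasible A [] vs (≡.subst (λ Z → Feasible c B (A ∪ Z)) (≡.sym (∪-identityˡ ⁅ v ⁆))
          (feasible (∈-elements⁻ (∈-resp-↭ vs↭ (here ≡.refl)))))))
        (s≤s z≤n)

  -- Truncating the sequence

  does-∈⟪⟫ : ∀ {m p} {P : Pred (Fin m) p} (P? : Decidable P) u → does (u ∈? ⟪ P? ⟫) ≡ does (P? u)
  does-∈⟪⟫ P? u with u ∈? ⟪ P? ⟫ | P? u in eq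
  ... | yes _  | yes _  = ≡.refl
  ... | no  _  | no  _  = ≡.refl
  ... | yes u∈ | no ¬Pu = contradiction (∈⟪⟫⁻ P? u∈) ¬Pu
  ... | no u∉  | yes Pu = contradiction (∈⟪⟫⁺ P? Pu) u∉

  module Deficits (argMax : ArgMax) {n : ℕ} (usm : Subset n → Dist (Subset n)) (B : Carrier)
                  (f : Subset n → Carrier) (c : Fin n → Carrier) (0<c : ∀ u → 0# < c u)
                  (0≤f : ∀ X → 0# ≤ f X) (submodular : Submodular f)
                  (ρ ε : Carrier) (0<ρ : 0# < ρ) where
    open Algorithm argMax usm B f c

    0≤c : ∀ u → 0# ≤ c u
    0≤c u = proj₁ (0<c u)

    0≤ρc : ∀ u → 0# ≤ ρ * c u
    0≤ρc u = proj₁ 0<ρ ⊗ 0≤c u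

    deficit : Subset n → Fin n → Carrier
    deficit X u = (ρ * c u - u ∣ X) ⁺

    shortfall : Subset n → List (Fin n) → Carrier
    shortfall X []       = 0#
    shortfall X (v ∷ vs) = deficit X v + shortfall (X ∪ ⁅ v ⁆) vs

    debit : Subset n → Fin n → Carrier
    debit X u = if does (u ∣ X <? 0#) then abs (u ∣ X) else 0#

    debits : Subset n → List (Fin n) → Carrier
    debits X []       = 0#
    debits X (v ∷ vs) = debit X v + debits (X ∪ ⁅ v ⁆) vs

    debit-nonNegative : ∀ X u → 0# ≤ debit X u
    debit-nonNegative X u = if-elim (u ∣ X <? 0#) (0# ≤_) (λ _ → abs-nonNegative _) (λ _ → ≤-refl)

    debits-nonNegative : ∀ X vs → 0# ≤ debits X vs
    debits-nonNegative X []       = ≤-refl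
    debits-nonNegative X (v ∷ vs) = debit-nonNegative X v ⊕ debits-nonNegative _ vs

    debit≤deficit : ∀ X u → debit X u ≤ deficit X u
    debit≤deficit X u = if-elim (u ∣ X <? 0#) (_≤ deficit X u) (λ g<0 → begin
      abs (u ∣ X)          ≈⟨ abs-negative g<0 ⟩
      - (u ∣ X)            ≤⟨ x≤y+x (0≤ρc u) ⟩
      ρ * c u - u ∣ X      ≤⟨ x≤x⁺ _ ⟩
      deficit X u          ∎)
      (λ _ → ⁺-nonNegative _)

    debits≤shortfall : ∀ X vs → debits X vs ≤ shortfall X vs
    debits≤shortfall X []       = ≤-refl
    debits≤shortfall X (v ∷ vs) = +-mono-≤ (debit≤deficit X v) (debits≤shortfall _ vs)

    shortfall-nonNegative : ∀ X vs → 0# ≤ shortfall X vs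
    shortfall-nonNegative X vs = ≤-trans (debits-nonNegative X vs) (debits≤shortfall X vs)

    shortfall-∷ʳ : ∀ X vs u → shortfall X (vs ++ u ∷ []) ≈ shortfall X vs + deficit (X ∪ fromList vs) u
    shortfall-∷ʳ X [] u = trans (+-comm _ _) (+-congˡ (reflexive
      (≡.cong (λ Y → deficit Y u) (≡.sym (∪-identityʳ X)))))
    shortfall-∷ʳ X (v ∷ vs) u = begin-equality
      deficit X v + shortfall (X ∪ ⁅ v ⁆) (vs ++ u ∷ [])
        ≈⟨ +-congˡ (shortfall-∷ʳ (X ∪ ⁅ v ⁆) vs u) ⟩
      deficit X v + (shortfall (X ∪ ⁅ v ⁆) vs + deficit ((X ∪ ⁅ v ⁆) ∪ fromList vs) u)
        ≈⟨ +-assoc _ _ _ ⟨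
      deficit X v + shortfall (X ∪ ⁅ v ⁆) vs + deficit ((X ∪ ⁅ v ⁆) ∪ fromList vs) u
        ≡⟨ ≡.cong (λ Y → deficit X v + shortfall (X ∪ ⁅ v ⁆) vs + deficit Y u) (∪-fromList-∷ X v vs) ⟨
      deficit X v + shortfall (X ∪ ⁅ v ⁆) vs + deficit (X ∪ fromList (v ∷ vs)) u
        ∎

    cost-∪-⁅⁆ : ∀ X v → ρ * cost (X ∪ ⁅ v ⁆) ≤ ρ * cost X + ρ * c v
    cost-∪-⁅⁆ X v = begin
      ρ * cost (X ∪ ⁅ v ⁆)           ≤⟨ *-monoˡ-≤ (proj₁ 0<ρ) (Σ-∪-≤ X ⁅ v ⁆ c 0≤c) ⟩
      ρ * (cost X + cost ⁅ v ⁆)      ≈⟨ distribˡ ρ _ _ ⟩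
      ρ * cost X + ρ * cost ⁅ v ⁆    ≈⟨ +-congˡ (*-congˡ (Σ-⁅⁆ c v)) ⟩
      ρ * cost X + ρ * c v           ∎

    density : ∀ X vs → f X + ρ * cost (X ∪ fromList vs) ≤ f (X ∪ fromList vs) + ρ * cost X + shortfall X vs
    density X [] = ≡.subst (λ Y → f X + ρ * cost Y ≤ f Y + ρ * cost X + 0#) (≡.sym (∪-identityʳ X))
                           (≤-reflexive (sym (+-identityʳ _)))
    density X (v ∷ vs) = ≡.subst
      (λ Y → f X + ρ * cost Y ≤ f Y + ρ * cost X + (deficit X v + shortfall (X ∪ ⁅ v ⁆) vs))
      (≡.sym (∪-fromList-∷ X v vs))
      (≤-by (0≤y-x (density (X ∪ ⁅ v ⁆) vs) ⊕ 0≤y-x (cost-∪-⁅⁆ X v) ⊕ 0≤y-x (x≤x⁺ (ρ * c v - v ∣ X)))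
        (solve 9 (λ fX fX′ fY rcY rcX rcX′ rcv d s →
            fY :+ rcX :+ (d :+ s) :=
            fX :+ rcY :+ (fY :+ rcX′ :+ s :- (fX′ :+ rcY) :+ (rcX :+ rcv :- rcX′) :+
              (d :- (rcv :- (fX′ :- fX)))))
          refl (f X) (f (X ∪ ⁅ v ⁆)) (f ((X ∪ ⁅ v ⁆) ∪ fromList vs)) (ρ * cost ((X ∪ ⁅ v ⁆) ∪ fromList vs))
          (ρ * cost X) (ρ * cost (X ∪ ⁅ v ⁆)) (ρ * c v) (deficit X v) (shortfall (X ∪ ⁅ v ⁆) vs)))

    module _ (A L : Subset n) where

      E⁻ : Subset n → Subset n
      E⁻ G = ⟪ (λ u → u ∈? L ×-dec (u ∣ G <? 0#)) ⟫

      loss : Subset n → Carrier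
      loss G = Σ[ E⁻ G ] (λ u → abs (u ∣ G))

      profit : Subset n → Carrier
      profit G = Σ[ candidates ρ L G ] (_∣ G)

      CostDrops Unprofitable : List (Fin n) → Set ℓ₂
      CostDrops    V = cost (candidates ρ L (A ∪ fromList V)) ≤ (1# - ε) * cost L
      Unprofitable V = ε * profit (A ∪ fromList V) ≤ loss (A ∪ fromList V) + debits A V

      cut : List (Fin n) → List (Fin n)
      cut V = take (Cut.t* ρ ε A L V) V

    module _ (L : Subset n) where
      Σ-debits : ∀ A vs i →
        sum (λ j → if does ((toℕ j ℕₚ.<? i) ×-dec (Cut.marginal ρ ε A L vs j <? 0#))
                   then abs (Cut.marginal ρ ε A L vs j) else 0#) ≈ debits A (take i vs)
      Σ-debits A []       zero    = refl
      Σ-debits A []       (suc i) = refl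
      Σ-debits A (v ∷ vs) zero    = sum-zero (suc (length vs))
      Σ-debits A (v ∷ vs) (suc i) = +-cong
        (reflexive (≡.cong (λ X → debit X v) (∪-identityʳ A)))
        (trans (sum-cong-≋ λ j → reflexive (≡.cong (λ X →
            if does ((toℕ j ℕₚ.<? i) ×-dec (lookup vs j ∣ X <? 0#)) then abs (lookup vs j ∣ X) else 0#)
            (∪-fromList-∷ A v (take (toℕ j) vs))))
          (Σ-debits (A ∪ ⁅ v ⁆) vs i))

      Σ-D : ∀ A vs i → Σ[ Cut.D ρ ε A L vs i ] (λ j → abs (Cut.marginal ρ ε A L vs j)) ≈ debits A (take i vs)
      Σ-D A vs i = trans
        (sum-cong-≋ λ j → reflexive (≡.cong (λ b → if b then abs (Cut.marginal ρ ε A L vs j) else 0#)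
          (does-∈⟪⟫ (λ j → (toℕ j ℕₚ.<? i) ×-dec (Cut.marginal ρ ε A L vs j <? 0#)) j)))
        (Σ-debits A vs i)

    module _ (A L : Subset n) where

      costDrops? : ∀ vs → Decidable (λ i → CostDrops A L (take i vs))
      costDrops? vs i = _ ≤? _

      UnprofitableAt : List (Fin n) → ℕ → Set ℓ₂
      UnprofitableAt vs i = let open Cut ρ ε A L vs in
        ε * Σ[ E⁺ i ] (_∣ G i) ≤ Σ[ Cut.E⁻ ρ ε A L vs i ] (λ u → abs (u ∣ G i)) +
                                 Σ[ D i ] (λ j → abs (marginal j))

      unprofitable? : ∀ vs → Decidable (UnprofitableAt vs)
      unprofitable? vs i = _ ≤? _

      unprofitable⁺ : ∀ vs {i} → UnprofitableAt vs i → Unprofitable A L (take i vs)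
      unprofitable⁺ vs {i} = λ h → ≤-trans h (≤-reflexive (+-congˡ (Σ-D L A vs i)))

      unprofitable⁻ : ∀ vs {i} → Unprofitable A L (take i vs) → UnprofitableAt vs i
      unprofitable⁻ vs {i} = λ h → ≤-trans h (≤-reflexive (+-congˡ (sym (Σ-D L A vs i))))

      t₁-≤ : ∀ vs → Cut.t₁ ρ ε A L vs ℕ.≤ length vs
      t₁-≤ vs = least-≤ (costDrops? vs) (length vs)

      t₂-≤ : ∀ vs → Cut.t₂ ρ ε A L vs ℕ.≤ length vs
      t₂-≤ vs = least-≤ (unprofitable? vs) (length vs)

      length-∷ʳ : ∀ (vs : List (Fin n)) u → length (vs ++ u ∷ []) ≡ suc (length vs)
      length-∷ʳ vs u = ≡.trans (Listₚ.length-++ vs) (ℕₚ.+-comm (length vs) 1)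

      take-length-∷ʳ : ∀ vs u → take (suc (length vs)) (vs ++ u ∷ []) ≡ vs ++ u ∷ []
      take-length-∷ʳ vs u = Listₚ.take-all _ _ (ℕₚ.≤-reflexive (length-∷ʳ vs u))

      least-∷ʳ : ∀ {p} {P : List (Fin n) → ℕ → Set p} (Q : List (Fin n) → Set p)
        (P? : ∀ vs → Decidable (P vs)) → (∀ vs {i} → P vs i → Q (take i vs)) →
        (∀ vs {i} → Q (take i vs) → P vs i) →
        ∀ vs → (∀ u → least (P? (vs ++ u ∷ [])) (length (vs ++ u ∷ [])) ≡ least (P? vs) (length vs)) ⊎
               (¬ Q vs × least (P? vs) (length vs) ≡ length vs ×
                ∀ u → least (P? (vs ++ u ∷ [])) (length (vs ++ u ∷ [])) ≡ suc (length vs))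
      least-∷ʳ Q P? P⇒Q Q⇒P vs = Sum.map
        (λ Pl u → ≡.trans (≡.cong (least (P? (vs ++ u ∷ []))) (length-∷ʳ vs u))
          (least-cong-suc (P? vs) (P? (vs ++ u ∷ [])) (length vs)
            (λ {i} i≤ Pi → Q⇒P _ (≡.subst Q (≡.sym (take-++ i vs (u ∷ []) i≤)) (P⇒Q vs Pi)))
            (λ {i} i≤ Pi → Q⇒P vs (≡.subst Q (take-++ i vs (u ∷ []) i≤) (P⇒Q _ Pi))) Pl))
        (λ ¬P → (λ Qvs → ¬P ℕₚ.≤-refl (Q⇒P vs (≡.subst Q (≡.sym (Listₚ.take-all _ vs ℕₚ.≤-refl)) Qvs))) ,
                least-none (P? vs) (length vs) (λ i< → ¬P (ℕₚ.<⇒≤ i<)) ,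
                λ u → ≡.trans (≡.cong (least (P? (vs ++ u ∷ []))) (length-∷ʳ vs u))
                  (least-none (P? (vs ++ u ∷ [])) (suc (length vs)) λ {i} → λ { (s≤s i≤) Pi →
                    ¬P i≤ (Q⇒P vs (≡.subst Q (take-++ i vs (u ∷ []) i≤) (P⇒Q _ Pi))) }))
        (least-or-none (P? vs) (length vs))

      -- Whether the sequence is cut before position i only depends on its first i entries.
      cut-∷ʳ : ∀ V → (∀ u → cut A L (V ++ u ∷ []) ≡ cut A L V) ⊎
                     (¬ CostDrops A L V × ¬ Unprofitable A L V × cut A L V ≡ V ×
                      ∀ u → cut A L (V ++ u ∷ []) ≡ V ++ u ∷ [])
      cut-∷ʳ V with least-∷ʳ (CostDrops A L) costDrops? (λ _ h → h) (λ _ h → h) V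
                  | least-∷ʳ (Unprofitable A L) unprofitable? unprofitable⁺ unprofitable⁻ V
      ... | inj₁ t₁≡ | inj₁ t₂≡ = inj₁ λ u →
        ≡.trans (≡.cong₂ (λ t t′ → take (t ℕ.⊓ t′) (V ++ u ∷ [])) (t₁≡ u) (t₂≡ u))
                (take-++ _ V (u ∷ []) (ℕₚ.≤-trans (ℕₚ.m⊓n≤m _ _) (t₁-≤ V)))
      ... | inj₁ t₁≡ | inj₂ (_ , t₂≡ , t₂≡′) = inj₁ λ u →
        ≡.trans (≡.cong₂ (λ t t′ → take (t ℕ.⊓ t′) (V ++ u ∷ [])) (t₁≡ u) (t₂≡′ u))
          (≡.trans (≡.cong (λ t → take t (V ++ u ∷ [])) (≡.trans
              (ℕₚ.m≤n⇒m⊓n≡m (ℕₚ.≤-trans (t₁-≤ V) (ℕₚ.n≤1+n _)))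
              (≡.sym (ℕₚ.m≤n⇒m⊓n≡m (ℕₚ.≤-trans (t₁-≤ V) (ℕₚ.≤-reflexive (≡.sym t₂≡)))))))
            (take-++ _ V (u ∷ []) (ℕₚ.≤-trans (ℕₚ.m⊓n≤m _ _) (t₁-≤ V))))
      ... | inj₂ (_ , t₁≡ , t₁≡′) | inj₁ t₂≡ = inj₁ λ u →
        ≡.trans (≡.cong₂ (λ t t′ → take (t ℕ.⊓ t′) (V ++ u ∷ [])) (t₁≡′ u) (t₂≡ u))
          (≡.trans (≡.cong (λ t → take t (V ++ u ∷ [])) (≡.trans
              (ℕₚ.m≥n⇒m⊓n≡n (ℕₚ.≤-trans (t₂-≤ V) (ℕₚ.n≤1+n _)))
              (≡.sym (ℕₚ.m≥n⇒m⊓n≡n (ℕₚ.≤-trans (t₂-≤ V) (ℕₚ.≤-reflexive (≡.sym t₁≡)))))))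
            (take-++ _ V (u ∷ []) (ℕₚ.≤-trans (ℕₚ.m⊓n≤m _ _) (t₁-≤ V))))
      ... | inj₂ (¬Q₁ , t₁≡ , t₁≡′) | inj₂ (¬Q₂ , t₂≡ , t₂≡′) = inj₂ (¬Q₁ , ¬Q₂ ,
        ≡.trans (≡.cong₂ (λ t t′ → take (t ℕ.⊓ t′) V) t₁≡ t₂≡)
                (Listₚ.take-all _ V (ℕₚ.≤-reflexive (≡.sym (ℕₚ.⊓-idem (length V))))) ,
        λ u → ≡.trans (≡.cong₂ (λ t t′ → take (t ℕ.⊓ t′) (V ++ u ∷ [])) (t₁≡′ u) (t₂≡′ u))
          (≡.trans (≡.cong (λ t → take t (V ++ u ∷ [])) (ℕₚ.⊓-idem (suc (length V)))) (take-length-∷ʳ V u)))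

      open Sampling argMax usm B f c 0<c using (Next; step; Drift; getSEQ-drift; feasible-⊆)

      isCandidate? : ∀ X G → Decidable (λ u → u ∈ X × (ρ ≤ (u ∣ G) / c u × Feasible c B (G ∪ ⁅ u ⁆)))
      isCandidate? X G u = u ∈? X ×-dec ((ρ ≤? (u ∣ G) / c u) ×-dec feasible? (G ∪ ⁅ u ⁆))

      isLossy? : ∀ G → Decidable (λ u → u ∈ L × u ∣ G < 0#)
      isLossy? G u = u ∈? L ×-dec (u ∣ G <? 0#)

      potential : List (Fin n) → Carrier
      potential V = fromℕ 3 * (ε * f (A ∪ fromList V)) - shortfall A V

      module _ (0<ε : 0# < ε) (8ε≤1 : fromℕ 8 * ε ≤ 1#) where

        0≤ε : 0# ≤ ε
        0≤ε = proj₁ 0<ε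

        increment : Subset n → Fin n → Carrier
        increment G u = fromℕ 3 * (ε * (u ∣ G)) - deficit G u

        increment-feasible : Subset n → Fin n → Carrier
        increment-feasible G u = if does (feasible? (G ∪ ⁅ u ⁆)) then increment G u else 0#

        lossWeight : 0# ≤ fromℕ 2 + fromℕ 6 * ε
        lossWeight = 0≤fromℕ 2 ⊕ 0≤fromℕ 6 ⊗ 0≤ε

        lossAt : Subset n → Fin n → Carrier
        lossAt G = restrict (E⁻ A L G) (λ u → abs (u ∣ G))

        0≤lossAt : ∀ G u → 0# ≤ (fromℕ 2 + fromℕ 6 * ε) * lossAt G u
        0≤lossAt G u = lossWeight ⊗
          ≤-restrict (E⁻ A L G) (λ u → abs (u ∣ G)) {u} (λ _ → abs-nonNegative (u ∣ G)) (λ _ → ≤-refl)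

        0≤ρcL : ∀ u → 0# ≤ fromℕ 2 * (ρ * restrict L c u)
        0≤ρcL u = 0≤fromℕ 2 ⊗ (proj₁ 0<ρ ⊗ ≤-restrict L c {u} (λ _ → 0≤c u) (λ _ → ≤-refl))

        increment-candidate : ∀ G {u} → u ∈ candidates ρ L G →
          fromℕ 6 * (ε * (u ∣ G)) + fromℕ 2 * (ρ * c u) ≤
          fromℕ 2 * increment-feasible G u + fromℕ 2 * (ρ * c u) + (fromℕ 2 + fromℕ 6 * ε) * lossAt G u
        increment-candidate G {u} u∈E with ∈⟪⟫⁻ (isCandidate? L G) u∈E
        ... | _ , ρ≤g/c , feasible = begin
          fromℕ 6 * (ε * g) + fromℕ 2 * (ρ * c u)
            ≤⟨ ≤-by (0≤fromℕ 2 ⊗ 0≤y-x (⁺-least ≤-refl (≤-by (0≤y-x (≤/⇒*≤ (0<c u) ρ≤g/c))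
                 (solve 2 (λ g rc → num 0 := rc :- g :+ (g :- rc)) refl g (ρ * c u)))))
               (solve 4 (λ e g rc d → num 2 :* (num 3 :* (e :* g) :- d) :+ num 2 :* rc :=
                 num 6 :* (e :* g) :+ num 2 :* rc :+ num 2 :* (num 0 :- d)) refl ε g (ρ * c u) (deficit G u)) ⟩
          fromℕ 2 * increment G u + fromℕ 2 * (ρ * c u)
            ≈⟨ +-congʳ (*-congˡ (if-elim (feasible? (G ∪ ⁅ u ⁆)) (increment G u ≈_) (λ _ → refl)
                 (λ infeasible → contradiction feasible infeasible))) ⟩
          fromℕ 2 * increment-feasible G u + fromℕ 2 * (ρ * c u)
            ≤⟨ ≤-by (0≤lossAt G u) refl ⟩
          fromℕ 2 * increment-feasible G u + fromℕ 2 * (ρ * c u) + (fromℕ 2 + fromℕ 6 * ε) * lossAt G u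
            ∎
          where g = u ∣ G

        increment-member : ∀ G {u} → u ∈ L →
          0# ≤ fromℕ 2 * increment G u + fromℕ 2 * (ρ * c u) + (fromℕ 2 + fromℕ 6 * ε) * lossAt G u
        increment-member G {u} u∈L = cases (0# ≤? g)
          where
          g = u ∣ G
          cases : Dec (0# ≤ g) →
            0# ≤ fromℕ 2 * increment G u + fromℕ 2 * (ρ * c u) + (fromℕ 2 + fromℕ 6 * ε) * lossAt G u
          cases (yes 0≤g) = ≤-by (0≤fromℕ 6 ⊗ (0≤ε ⊗ 0≤g) ⊕ 0≤fromℕ 2 ⊗ 0≤y-x
              (⁺-least (0≤ρc u) (≤-by 0≤g (solve 2 (λ rc g → rc := rc :- g :+ g) refl (ρ * c u) g))) ⊕
                0≤lossAt G u)
            (solve 5 (λ e g rc d l → num 2 :* (num 3 :* (e :* g) :- d) :+ num 2 :* rc :+ l :=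
              num 0 :+ (num 6 :* (e :* g) :+ num 2 :* (rc :- d) :+ l))
              refl ε g (ρ * c u) (deficit G u) ((fromℕ 2 + fromℕ 6 * ε) * lossAt G u))
          cases (no 0≰g) = ≤-by
            (0≤fromℕ 2 ⊗ 0≤y-x (⁺-least (≤-trans (0≤ρc u) (≤-by (0≤y-x (≰⇒≥ 0≰g))
               (solve 2 (λ rc g → rc :- g := rc :+ (num 0 :- g)) refl (ρ * c u) g))) ≤-refl))
            (trans (+-congˡ (*-congˡ (trans (reflexive (restrict-∈ (E⁻ A L G) (λ u → abs (u ∣ G))
                     (∈⟪⟫⁺ (isLossy? G) (u∈L , ≰⇒> 0≰g)))) (abs-negative (≰⇒> 0≰g)))))
              (solve 4 (λ e g rc d → num 2 :* (num 3 :* (e :* g) :- d) :+ num 2 :* rc :+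
                (num 2 :+ num 6 :* e) :* (:- g) :=
                num 0 :+ num 2 :* (rc :- g :- d)) refl ε g (ρ * c u) (deficit G u)))

        increment-noncandidate : ∀ G Y → (∀ {u} → u ∈ Y → u ∈ L) → ∀ u →
          0# ≤ fromℕ 2 * restrict Y (increment-feasible G) u + fromℕ 2 * (ρ * restrict L c u) +
               (fromℕ 2 + fromℕ 6 * ε) * lossAt G u
        increment-noncandidate G Y Y⊆L u = if-elim (u ∈? Y) R
          (λ u∈Y → if-elim (feasible? (G ∪ ⁅ u ⁆)) R
            (λ _ → ≡.subst (λ l → 0# ≤ fromℕ 2 * increment G u + fromℕ 2 * (ρ * l) +
              (fromℕ 2 + fromℕ 6 * ε) * lossAt G u)
                     (≡.sym (restrict-∈ L c (Y⊆L u∈Y))) (increment-member G (Y⊆L u∈Y)))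
            (λ _ → none))
          (λ _ → none)
          where
          R : Carrier → Set ℓ₂
          R y = 0# ≤ fromℕ 2 * y + fromℕ 2 * (ρ * restrict L c u) + (fromℕ 2 + fromℕ 6 * ε) * lossAt G u
          none : R 0#
          none = 0≤fromℕ 2 ⊗ ≤-refl ⊕ 0≤ρcL u ⊕ 0≤lossAt G u

        increment-bound : ∀ G Y → (∀ {u} → u ∈ Y → u ∈ L) → candidates ρ L G ⊆ Y → ∀ u →
          fromℕ 6 * (ε * restrict (candidates ρ L G) (_∣ G) u) +
            fromℕ 2 * (ρ * restrict (candidates ρ L G) c u) ≤
          fromℕ 2 * restrict Y (increment-feasible G) u + fromℕ 2 * (ρ * restrict L c u) +
            (fromℕ 2 + fromℕ 6 * ε) * lossAt G u
        increment-bound G Y Y⊆L E⊆Y u = cases (u ∈? candidates ρ L G)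
          where
          rhs = fromℕ 2 * restrict Y (increment-feasible G) u + fromℕ 2 * (ρ * restrict L c u) +
                (fromℕ 2 + fromℕ 6 * ε) * lossAt G u
          R : Carrier → Carrier → Set ℓ₂
          R g c′ = fromℕ 6 * (ε * g) + fromℕ 2 * (ρ * c′) ≤ rhs
          cases : Dec (u ∈ candidates ρ L G) → R (restrict (candidates ρ L G) (_∣ G) u)
            (restrict (candidates ρ L G) c u)
          cases (yes u∈E) = ≡.subst₂ R
            (≡.sym (restrict-∈ (candidates ρ L G) (_∣ G) u∈E)) (≡.sym (restrict-∈ (candidates ρ L G) c u∈E))
            (≡.subst₂ (λ y l → fromℕ 6 * (ε * (u ∣ G)) + fromℕ 2 * (ρ * c u) ≤
                fromℕ 2 * y + fromℕ 2 * (ρ * l) + (fromℕ 2 + fromℕ 6 * ε) * lossAt G u)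
              (≡.sym (restrict-∈ Y (increment-feasible G) (E⊆Y u∈E))) (≡.sym (restrict-∈ L c (Y⊆L (E⊆Y u∈E))))
              (increment-candidate G u∈E))
          cases (no u∉E) = ≡.subst₂ R
            (≡.sym (restrict-∉ (candidates ρ L G) (_∣ G) u∉E)) (≡.sym (restrict-∉ (candidates ρ L G) c u∉E))
            (≤-trans (≤-reflexive (solve 2 (λ e r → num 6 :* (e :* num 0) :+ num 2 :* (r :* num 0) :=
              num 0) refl ε ρ))
              (increment-noncandidate G Y Y⊆L u))

  sum-*-* : ∀ {m} a b (g : Fin m → Carrier) → sum (λ u → a * (b * g u)) ≈ a * (b * sum g)
  sum-*-* a b g = sym (trans (*-congˡ (*-distribˡ-sum b g)) (*-distribˡ-sum a (λ u → b * g u)))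

  -- S and N are the profit and the loss at the current prefix, Ψ is the sum of the increments.
  drift-certificate : ∀ {ε ρ S cE cL N Ψ} → 0# ≤ ε → fromℕ 8 * ε ≤ 1# → 0# ≤ ρ → 0# ≤ S → 0# ≤ cL →
    fromℕ 6 * (ε * S) + fromℕ 2 * (ρ * cE) ≤ fromℕ 2 * Ψ + fromℕ 2 * (ρ * cL) + (fromℕ 2 + fromℕ 6 * ε) * N →
    ρ * cE ≤ S → (1# - ε) * cL ≤ cE → N ≤ ε * S → 0# ≤ Ψ
  drift-certificate {ε} {ρ} {S} {cE} {cL} {N} {Ψ} 0≤ε 8ε≤1 0≤ρ 0≤S 0≤cL sums density drops losses =
    *-cancelˡ-≤ (0<fromℕ 1) (begin
      fromℕ 2 * 0#  ≈⟨ zeroʳ _ ⟩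
      0#            ≤⟨ 0≤y-x sums ⊕ (0≤fromℕ 2 ⊕ 0≤fromℕ 6 ⊗ 0≤ε) ⊗ 0≤y-x losses ⊕
                       0≤fromℕ 2 ⊗ 0≤ρ ⊗ 0≤y-x drops ⊕
                       0≤ε ⊗ (0≤fromℕ 3 ⊗ 0≤y-x density ⊕ 0≤fromℕ 3 ⊗ 0≤ρ ⊗ 0≤y-x drops ⊕
                              0≤ρ ⊗ 0≤cL ⊗ 0≤1-3ε) ⊕
                       0≤ε ⊗ 0≤S ⊗ 0≤1-6ε ⟩
      _             ≈⟨ solve 7 (λ e r S cE cL N P →
                         num 2 :* P :+ num 2 :* (r :* cL) :+
                           (num 2 :+ num 6 :* e) :* N :- (num 6 :* (e :* S) :+ num 2 :* (r :* cE)) :+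
                         (num 2 :+ num 6 :* e) :* (e :* S :- N) :+
                         num 2 :* r :* (cE :- (num 1 :- e) :* cL) :+
                         e :* (num 3 :* (S :- r :* cE) :+ num 3 :* r :* (cE :- (num 1 :- e) :* cL) :+
                           r :* cL :* (num 1 :- num 3 :* e)) :+
                         e :* S :* (num 1 :- num 6 :* e) := num 2 :* P) refl ε ρ S cE cL N Ψ ⟩
      fromℕ 2 * Ψ   ∎)
    where
    0≤1-3ε : 0# ≤ 1# - fromℕ 3 * ε
    0≤1-3ε = ≤-by (0≤y-x 8ε≤1 ⊕ 0≤fromℕ 5 ⊗ 0≤ε)
      (solve 1 (λ e → num 1 :- num 3 :* e := num 0 :+ (num 1 :- num 8 :* e :+ num 5 :* e)) refl ε)
    0≤1-6ε : 0# ≤ 1# - fromℕ 6 * ε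
    0≤1-6ε = ≤-by (0≤y-x 8ε≤1 ⊕ 0≤fromℕ 2 ⊗ 0≤ε)
      (solve 1 (λ e → num 1 :- num 6 :* e := num 0 :+ (num 1 :- num 8 :* e :+ num 2 :* e)) refl ε)

  module _ (argMax : ArgMax) {n : ℕ} (usm : Subset n → Dist (Subset n)) (B : Carrier)
           (f : Subset n → Carrier) (c : Fin n → Carrier) (0<c : ∀ u → 0# < c u)
           (0≤f : ∀ X → 0# ≤ f X) (submodular : Submodular f)
           (ρ ε : Carrier) (0<ρ : 0# < ρ) (0<ε : 0# < ε) (8ε≤1 : fromℕ 8 * ε ≤ 1#) (A L : Subset n) where
    open Algorithm argMax usm B f c
    open Sampling argMax usm B f c 0<c
    open Deficits argMax usm B f c 0<c 0≤f submodular ρ ε 0<ρ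

    increments : Subset n → Subset n → Carrier
    increments G Y = Σ[ Y ] (increment-feasible A L 0<ε 8ε≤1 G)

    Σ-increment-bound : ∀ G Y → (∀ {u} → u ∈ Y → u ∈ L) → candidates ρ L G ⊆ Y →
      fromℕ 6 * (ε * profit A L G) + fromℕ 2 * (ρ * cost (candidates ρ L G)) ≤
      fromℕ 2 * increments G Y + fromℕ 2 * (ρ * cost L) + (fromℕ 2 + fromℕ 6 * ε) * loss A L G
    Σ-increment-bound G Y Y⊆L E⊆Y = begin
      fromℕ 6 * (ε * sum gE) + fromℕ 2 * (ρ * sum cE)
        ≈⟨ +-cong (sum-*-* (fromℕ 6) ε gE) (sum-*-* (fromℕ 2) ρ cE) ⟨
      sum (λ u → fromℕ 6 * (ε * gE u)) + sum (λ u → fromℕ 2 * (ρ * cE u))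
        ≈⟨ ∑-distrib-+ (λ u → fromℕ 6 * (ε * gE u)) (λ u → fromℕ 2 * (ρ * cE u)) ⟨
      sum (λ u → fromℕ 6 * (ε * gE u) + fromℕ 2 * (ρ * cE u))
        ≤⟨ sum-mono {g = λ u → fromℕ 6 * (ε * gE u) + fromℕ 2 * (ρ * cE u)}
             {λ u → fromℕ 2 * ψ u + fromℕ 2 * (ρ * cL u) + κ * l u}
             (increment-bound A L 0<ε 8ε≤1 G Y Y⊆L E⊆Y) ⟩
      sum (λ u → fromℕ 2 * ψ u + fromℕ 2 * (ρ * cL u) + κ * l u)
        ≈⟨ ∑-distrib-+ (λ u → fromℕ 2 * ψ u + fromℕ 2 * (ρ * cL u)) (λ u → κ * l u) ⟩
      sum (λ u → fromℕ 2 * ψ u + fromℕ 2 * (ρ * cL u)) + sum (λ u → κ * l u)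
        ≈⟨ +-congʳ (∑-distrib-+ (λ u → fromℕ 2 * ψ u) (λ u → fromℕ 2 * (ρ * cL u))) ⟩
      sum (λ u → fromℕ 2 * ψ u) + sum (λ u → fromℕ 2 * (ρ * cL u)) + sum (λ u → κ * l u)
        ≈⟨ +-cong (+-cong (*-distribˡ-sum (fromℕ 2) ψ) (sym (sum-*-* (fromℕ 2) ρ cL))) (*-distribˡ-sum κ l) ⟨
      fromℕ 2 * sum ψ + fromℕ 2 * (ρ * sum cL) + κ * sum l
        ∎
      where
      κ  = fromℕ 2 + fromℕ 6 * ε
      gE = restrict (candidates ρ L G) (_∣ G)
      cE = restrict (candidates ρ L G) c
      cL = restrict L c
      ψ  = restrict Y (increment-feasible A L 0<ε 8ε≤1 G)
      l  = lossAt A L 0<ε 8ε≤1 G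

    ρcost≤profit : ∀ G → ρ * cost (candidates ρ L G) ≤ profit A L G
    ρcost≤profit G = ≤-trans (≤-reflexive (sym (Σ-*ˡ (candidates ρ L G) ρ c)))
      (Σ-mono (candidates ρ L G) (λ u → ρ * c u) (_∣ G) λ {u} u∈ →
        ≤/⇒*≤ (0<c u) (proj₁ (proj₂ (∈⟪⟫⁻ (isCandidate? A L L G) u∈))))

    increments-nonNegative : ∀ V {Y} → ¬ CostDrops A L V → ¬ Unprofitable A L V →
      (∀ {u} → u ∈ Y → u ∈ L) → candidates ρ L (A ∪ fromList V) ⊆ Y → 0# ≤ increments (A ∪ fromList V) Y
    increments-nonNegative V {Y} ¬drops ¬unprofitable Y⊆L E⊆Y = drift-certificate (proj₁ 0<ε) 8ε≤1 (proj₁ 0<ρ)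
      (≤-trans (proj₁ 0<ρ ⊗ Σ-nonNegative (candidates ρ L G) c (λ _ → 0≤c _)) (ρcost≤profit G))
      (Σ-nonNegative L c (λ _ → 0≤c _))
      (Σ-increment-bound G Y Y⊆L E⊆Y)
      (ρcost≤profit G)
      (≰⇒≥ ¬drops)
      (≤-trans (≤-by (debits-nonNegative A V) refl) (≰⇒≥ ¬unprofitable))
      where G = A ∪ fromList V

    stopped : List (Fin n) → Carrier
    stopped V = potential A L (cut A L V)

    potential-∷ʳ : ∀ V u → potential A L (V ++ u ∷ []) - potential A L V ≈
                   increment A L 0<ε 8ε≤1 (A ∪ fromList V) u
    potential-∷ʳ V u = begin-equality
      fromℕ 3 * (ε * f (A ∪ fromList (V ++ u ∷ []))) - shortfall A (V ++ u ∷ []) - potential A L V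
        ≈⟨ +-congʳ (+-cong (*-congˡ (*-congˡ (reflexive (≡.cong f (∪-fromList-∷ʳ A V u)))))
          (-‿cong (shortfall-∷ʳ A V u))) ⟩
      fromℕ 3 * (ε * f ((A ∪ fromList V) ∪ ⁅ u ⁆)) - (shortfall A V + deficit (A ∪ fromList V) u) -
        potential A L V
        ≈⟨ solve 5 (λ e fX fY s d → num 3 :* (e :* fY) :- (s :+ d) :- (num 3 :* (e :* fX) :- s) :=
             num 3 :* (e :* (fY :- fX)) :- d) refl ε (f (A ∪ fromList V)) (f ((A ∪ fromList V) ∪ ⁅ u ⁆)) _ _ ⟩
      increment A L 0<ε 8ε≤1 (A ∪ fromList V) u
        ∎

    stopped-drift : Drift A L stopped
    stopped-drift V {ys} unique ys⊆L next with cut-∷ʳ A L V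
    ... | inj₁ cut≡ = ≤-reflexive (begin-equality
      0#                             ≈⟨ zeroʳ _ ⟨
      fromℕ (length ys) * 0#         ≈⟨ sumˡ-const 0# ys ⟨
      sumˡ (λ _ → 0#) ys ≈⟨ sumˡ-cong ys (λ {u} _ → if-elim (feasible? (A ∪ fromList V ∪ ⁅ u ⁆)) (0# ≈_)
        (λ _ → trans (sym (-‿inverseʳ (stopped V))) (+-congʳ
          (reflexive (≡.cong (potential A L) (≡.sym (cut≡ u))))))
        (λ _ → refl)) ⟩
      sumˡ (step A stopped V) ys     ∎)
    ... | inj₂ (¬drops , ¬unprofitable , cut≡ , cut≡′) = begin
      0# ≤⟨ increments-nonNegative V {fromList ys} ¬drops ¬unprofitable
                                                        (ys⊆L ∘ ∈-fromList⁻ ys)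
                                                          (λ u∈ → ∈-fromList⁺ (next (candidate⇒next u∈))) ⟩
      increments G (fromList ys) ≈⟨ Σ-fromList (increment-feasible A L 0<ε 8ε≤1 G) unique ⟩
      sumˡ (increment-feasible A L 0<ε 8ε≤1 G) ys  ≈⟨ sumˡ-cong ys (λ {u} _ → step≈ u) ⟩
      sumˡ (step A stopped V) ys                   ∎
      where
      G = A ∪ fromList V

      candidate⇒next : ∀ {u} → u ∈ candidates ρ L G → Next A L V u
      candidate⇒next {u} u∈ with ∈⟪⟫⁻ (isCandidate? A L L G) u∈
      ... | u∈L , ρ≤g/c , feasible = u∈L , u∉V , ≡.subst (Feasible c B) (∪-assoc A (fromList V) ⁅ u ⁆) feasible
        where
        u∉V : u ∉ fromList V
        u∉V u∈V = <⇒≱ (*-positive 0<ρ (0<c u))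
          (≤-trans (≤/⇒*≤ (0<c u) ρ≤g/c) (≤-reflexive (gain-∈ submodular (q⊆p∪q A (fromList V) u∈V))))

      step≈ : ∀ u → increment-feasible A L 0<ε 8ε≤1 G u ≈ step A stopped V u
      step≈ u = ≡.subst (λ Z → increment-feasible A L 0<ε 8ε≤1 G u ≈
                               (if does (feasible? Z) then stopped (V ++ u ∷ []) - stopped V else 0#))
        (∪-assoc A (fromList V) ⁅ u ⁆) (branches (feasible? (G ∪ ⁅ u ⁆)))
        where
        branches : ∀ {P : Set ℓ₂} (P? : Dec P) → (if does P? then increment A L 0<ε 8ε≤1 G u else 0#) ≈
                                      (if does P? then stopped (V ++ u ∷ []) - stopped V else 0#)
        branches (no _)  = refl
        branches (yes _) = trans (sym (potential-∷ʳ V u)) (+-cong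
          (reflexive (≡.cong (potential A L) (≡.sym (cut≡′ u))))
          (-‿cong (reflexive (≡.cong (potential A L) (≡.sym cut≡)))))

    getSEQ-potential : fromℕ 3 * (ε * f A) ≤ 𝔼 (λ vs → potential A L (cut A L vs)) (getSEQ A L)
    getSEQ-potential = ≤-trans (≤-reflexive (begin-equality
        fromℕ 3 * (ε * f A)              ≡⟨ ≡.cong (λ X → fromℕ 3 * (ε * f X)) (∪-identityʳ A) ⟨
        fromℕ 3 * (ε * f (A ∪ ⊥))        ≈⟨ solve 1 (λ x → x := x :- num 0) refl _ ⟩
        potential A L []                 ∎))
      (getSEQ-drift stopped-drift)

  -- RandBatch

  module _ (argMax : ArgMax) {n : ℕ} (usm : Subset n → Dist (Subset n))
           (B : Carrier) (f : Subset n → Carrier) (c : Fin n → Carrier)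
           (ρ ε : Carrier) (A L : Subset n) (vs : List (Fin n)) where
    open Algorithm argMax usm B f c
    open Cut ρ ε A L vs

    grown : Subset n
    grown = A ∪ V t*

    counted : ℕ → ℕ
    counted count = if does (t₂ ℕₚ.<? t₁) then suc count else count

  -- As for getSEQ, placeholders solved by unification give access to the local loop of
  -- randBatch.  What can be named this way is a whole round after drawing the sequence:
  -- the mixture of the loop after acceptance, in state A = U, and after rejection, in
  -- state A′ and U.
  mutual
    batch : (argMax : ArgMax) {n : ℕ} (usm : Subset n → Dist (Subset n))
            (B : Carrier) (f : Subset n → Carrier) (c : Fin n → Carrier)
            (ρ : Carrier) (I : Subset n) (M : ℕ) (p ε : Carrier) →
            ℕ → (U L : Subset n) → ℕ → (A′ L′ : Subset n) → ℕ → Dist (Subset n × Subset n × Subset n)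
    batch = _

    private
      firstBatch : (argMax : ArgMax) {k : ℕ} (usm : Subset (suc k) → Dist (Subset (suc k)))
                   (B : Carrier) (f : Subset (suc k) → Carrier) (c : Fin (suc k) → Carrier)
                   (ρ : Carrier) (I : Subset (suc k)) (M : ℕ) (p ε : Carrier) → List (Fin (suc k)) →
                   Dist (Subset (suc k) × Subset (suc k) × Subset (suc k))
      firstBatch = _

      randBatch-unfold : ∀ argMax {k} usm B f c ρ I M p ε →
        let open Algorithm argMax {suc k} usm B f c
            L = candidates ρ I ⊥
        in randBatch ρ I M p ε ≡ (if does (nonempty? L ×-dec (0 ℕₚ.<? M))
                                  then (getSEQ ⊥ L >>= firstBatch argMax usm B f c ρ I M p ε)
                                  else return (⊥ , ⊥ , L))
      randBatch-unfold argMax usm B f c ρ I M p ε = ≡.refl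

    firstBatch-batch : ∀ argMax {k} usm B f c ρ I M p ε vs →
      let open Algorithm argMax {suc k} usm B f c
          L = candidates ρ I ⊥
          U = grown argMax usm B f c ρ ε ⊥ L vs
      in firstBatch argMax usm B f c ρ I M p ε vs ≡
         batch argMax usm B f c ρ I M p ε k
           U (candidates ρ (L ─ U) U) (counted argMax usm B f c ρ ε ⊥ L vs 0)
           ⊥ (candidates ρ (L ─ U) ⊥) 0
    firstBatch-batch argMax {k} usm B f c ρ I M p ε vs
      with counted argMax usm B f c ρ ε ⊥ (Algorithm.candidates argMax usm B f c ρ I ⊥) vs 0
    ... | count with grown argMax usm B f c ρ ε ⊥ (Algorithm.candidates argMax usm B f c ρ I ⊥) vs
    ... | U with Algorithm.candidates argMax usm B f c ρ (Algorithm.candidates argMax usm B f c ρ I ⊥ ─ U) U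
               | Algorithm.candidates argMax usm B f c ρ (Algorithm.candidates argMax usm B f c ρ I ⊥ ─ U) ⊥
    ... | L | L′ with ⊥ {suc k} | 0
    ... | A | none with suc k | usm | f | c | I | A | U | L | L′
    ... | _ | _ | _ | _ | _ | _ | _ | _ | _ = ≡.refl

  module _ (argMax : ArgMax) {n : ℕ} (usm : Subset n → Dist (Subset n))
           (B : Carrier) (f : Subset n → Carrier) (c : Fin n → Carrier)
           (ρ : Carrier) (I : Subset n) (M : ℕ) (p ε : Carrier) where
    open Algorithm argMax usm B f c

    mixture : ℕ → (A L : Subset n) → ℕ → List (Fin n) → Dist (Subset n × Subset n × Subset n)
    mixture k A L count vs =
      batch argMax usm B f c ρ I M p ε k
        A′ (candidates ρ (L ─ A′) A′) (counted argMax usm B f c ρ ε A L vs count)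
        A (candidates ρ (L ─ A′) A) count
      where A′ = grown argMax usm B f c ρ ε A L vs

    rounds : ℕ → (A L : Subset n) → ℕ → Dist (Subset n × Subset n × Subset n)
    rounds zero    A L count = return (A , A , L)
    rounds (suc k) A L count = if does (nonempty? L ×-dec (count ℕₚ.<? M))
      then getSEQ A L >>= mixture k A L count
      else return (A , A , L)

    batch-rounds : ∀ k A L count A′ L′ count′ → ∃ λ R →
      batch argMax usm B f c ρ I M p ε k A L count A′ L′ count′ ≡
      scale p (rounds k A L count) ++ scale (1# - p) R ++ []
    batch-rounds zero    A L count A′ L′ count′ = _ , ≡.refl
    batch-rounds (suc k) A L count A′ L′ count′ = _ , ≡.refl

  randBatch-rounds : ∀ argMax {n} usm B f c ρ (I : Subset n) M p ε →
    let open Algorithm argMax usm B f c in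
    randBatch ρ I M p ε ≡ rounds argMax usm B f c ρ I M p ε n ⊥ (candidates ρ I ⊥) 0
  randBatch-rounds argMax {zero}  usm B f c ρ I M p ε = ≡.refl
  randBatch-rounds argMax {suc k} usm B f c ρ I M p ε = ≡.refl

  module _ {X : Set} (d e : Dist X) where

    𝔼-accepted : ∀ (g : X → Carrier) → 𝔼 g (scale 1# d ++ scale (1# - 1#) e ++ []) ≈ 𝔼 g d
    𝔼-accepted g = begin-equality
      𝔼 g (scale 1# d ++ scale (1# - 1#) e ++ [])
        ≈⟨ 𝔼-++ g (scale 1# d) _ ⟩
      𝔼 g (scale 1# d) + 𝔼 g (scale (1# - 1#) e ++ [])
        ≈⟨ +-cong (𝔼-scale 1# g d) (trans (𝔼-++ g (scale (1# - 1#) e) []) (+-congʳ (𝔼-scale (1# - 1#) g e))) ⟩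
      1# * 𝔼 g d + ((1# - 1#) * 𝔼 g e + 0#)
        ≈⟨ solve 2 (λ x y → num 1 :* x :+ ((num 1 :- num 1) :* y :+ num 0) := x) refl _ _ ⟩
      𝔼 g d ∎

    0≈1-1 : 0# ≈ 1# - 1#
    0≈1-1 = sym (-‿inverseʳ 1#)

    accepted-isDistribution : IsDistribution d → IsDistribution (scale 1# d ++ scale (1# - 1#) e ++ [])
    accepted-isDistribution (0≤d , mass) =
      Allₚ.++⁺ (scale-nonNegative 0≤1 0≤d) (Allₚ.++⁺ (Allₚ.map⁺ (All.universal
        (λ (v , _) → ≤-reflexive (trans (sym (zeroˡ v)) (*-congʳ 0≈1-1))) e)) []) ,
      trans (𝔼-accepted (λ _ → 1#)) mass

    accepted-surely : ∀ {p} {P : Pred X p} → AlmostSurely P d →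
                      AlmostSurely P (scale 1# d ++ scale (1# - 1#) e ++ [])
    accepted-surely Pd = Allₚ.++⁺ (scale-surely 0≤1 (λ _ → Pd)) (Allₚ.++⁺
      (scale-surely (≤-reflexive 0≈1-1) (λ 0<0 → contradiction 0≈1-1 (proj₂ 0<0))) [])

  module BatchResults (argMax : ArgMax) {n : ℕ} (usm : Subset n → Dist (Subset n)) (B : Carrier)
                      (f : Subset n → Carrier) (c : Fin n → Carrier) (0<c : ∀ u → 0# < c u)
                      (ρ : Carrier) (I : Subset n) (M : ℕ) (ε : Carrier) where
    open Algorithm argMax usm B f c
    open Sampling argMax usm B f c 0<c

    Outcome : Set
    Outcome = Subset n × Subset n × Subset n

    roundsOf : ℕ → (A L : Subset n) → ℕ → Dist Outcome
    roundsOf = rounds argMax usm B f c ρ I M 1# ε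

    mixtureOf : ℕ → (A L : Subset n) → ℕ → List (Fin n) → Dist Outcome
    mixtureOf = mixture argMax usm B f c ρ I M 1# ε

    module _ (A L : Subset n) (count : ℕ) (vs : List (Fin n)) where
      open Cut ρ ε A L vs
      nextA nextL : Subset n
      nextA = A ∪ V t*
      nextL = candidates ρ (L ─ nextA) nextA
      nextCount : ℕ
      nextCount = if does (t₂ ℕₚ.<? t₁) then suc count else count

    isCandidate : ∀ {X G u} → u ∈ candidates ρ X G → u ∈ X × (ρ ≤ (u ∣ G) / c u × Feasible c B (G ∪ ⁅ u ⁆))
    isCandidate {X} {G} u∈ = ∈⟪⟫⁻ (λ u → u ∈? X ×-dec ((ρ ≤? (u ∣ G) / c u) ×-dec feasible? (G ∪ ⁅ u ⁆))) u∈

    candidate : ∀ {X G u} → u ∈ X → ρ ≤ (u ∣ G) / c u → Feasible c B (G ∪ ⁅ u ⁆) → u ∈ candidates ρ X G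
    candidate {X} {G} u∈X ρ≤ feasible =
      ∈⟪⟫⁺ (λ u → u ∈? X ×-dec ((ρ ≤? (u ∣ G) / c u) ×-dec feasible? (G ∪ ⁅ u ⁆))) (u∈X , ρ≤ , feasible)

    afterRound : ℕ → (A L : Subset n) → ℕ → List (Fin n) → Dist Outcome
    afterRound k A L count vs = roundsOf k (nextA A L count vs) (nextL A L count vs) (nextCount A L count vs)

    mixture-split : ∀ k A L count vs → ∃ λ R →
      mixtureOf k A L count vs ≡ scale 1# (afterRound k A L count vs) ++ scale (1# - 1#) R ++ []
    mixture-split k A L count vs = batch-rounds argMax usm B f c ρ I M 1# ε k
      (nextA A L count vs) (nextL A L count vs) (nextCount A L count vs)
      A (candidates ρ (L ─ nextA A L count vs) A) count

    𝔼-mixture : ∀ (g : Outcome → Carrier) k A L count vs →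
                𝔼 g (mixtureOf k A L count vs) ≈ 𝔼 g (afterRound k A L count vs)
    𝔼-mixture g k A L count vs =
      let R , eq = mixture-split k A L count vs
      in trans (reflexive (≡.cong (𝔼 g) eq)) (𝔼-accepted (afterRound k A L count vs) R g)

    rounds-isDistribution : ∀ k A L count → IsDistribution (roundsOf k A L count)
    rounds-isDistribution zero    A L count = return-isDistribution _
    rounds-isDistribution (suc k) A L count = if-elim (nonempty? L ×-dec (count ℕₚ.<? M)) IsDistribution
      (λ _ → >>=-isDistribution (getSEQ-isDistribution A L) mixed) (λ _ → return-isDistribution _)
      where
      mixed : ∀ vs → IsDistribution (mixtureOf k A L count vs)
      mixed vs =
        let R , eq = mixture-split k A L count vs
        in ≡.subst IsDistribution (≡.sym eq) (accepted-isDistribution (afterRound k A L count vs) R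
             (rounds-isDistribution k (nextA A L count vs) (nextL A L count vs) (nextCount A L count vs)))

    fromList-take : ∀ m (vs : List (Fin n)) → fromList (take m vs) ⊆ fromList vs
    fromList-take zero    vs       u∈ = contradiction u∈ ∉⊥
    fromList-take (suc m) []       u∈ = u∈
    fromList-take (suc m) (v ∷ vs) u∈ = ∪-elim ⁅ v ⁆ _ (p⊆p∪q (fromList vs))
      (q⊆p∪q ⁅ v ⁆ (fromList vs) ∘ fromList-take m vs) u∈

    nextA-feasible : ∀ A L count vs → Valid A L vs → Feasible c B (nextA A L count vs)
    nextA-feasible A L count vs (_ , feasible) = feasible-⊆
      (∪-elim A _ (p⊆p∪q (fromList vs)) (q⊆p∪q A (fromList vs) ∘ fromList-take (Cut.t* ρ ε A L vs) vs)) feasible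

    rounds-feasible : ∀ k A L count → Feasible c B A → (∀ {u} → u ∈ L → Feasible c B (A ∪ ⁅ u ⁆)) →
                      AlmostSurely (λ (A , _) → Feasible c B A) (roundsOf k A L count)
    rounds-feasible zero    A L count feasible _ = return-surely feasible
    rounds-feasible (suc k) A L count feasible L-feasible = if-elim (nonempty? L ×-dec (count ℕₚ.<? M))
      (AlmostSurely (λ (A , _) → Feasible c B A))
      (λ ((u , u∈L) , _) → >>=-surely (proj₁ (getSEQ-isDistribution A L)) (getSEQ-valid u∈L L-feasible)
        (λ {vs} → mixed vs))
      (λ _ → return-surely feasible)
      where
      mixed : ∀ vs → Valid A L vs × 1 ℕ.≤ length vs →
              AlmostSurely (λ (A , _) → Feasible c B A) (mixtureOf k A L count vs)
      mixed vs (valid , _) =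
        let R , eq = mixture-split k A L count vs
        in ≡.subst (AlmostSurely (λ (A , _) → Feasible c B A)) (≡.sym eq)
             (accepted-surely (afterRound k A L count vs) R
               (rounds-feasible k (nextA A L count vs) (nextL A L count vs) (nextCount A L count vs)
                 (nextA-feasible A L count vs valid)
                 (λ u∈ → proj₂ (proj₂ (isCandidate u∈)))))

    randBatch-isDistribution : IsDistribution (randBatch ρ I M 1# ε)
    randBatch-isDistribution = ≡.subst IsDistribution (≡.sym (randBatch-rounds argMax usm B f c ρ I M 1# ε))
      (rounds-isDistribution n ⊥ (candidates ρ I ⊥) 0)

    randBatch-feasible : 0# ≤ B → AlmostSurely (λ (A , _) → Feasible c B A) (randBatch ρ I M 1# ε)
    randBatch-feasible 0≤B = ≡.subst (AlmostSurely (λ (A , _) → Feasible c B A))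
      (≡.sym (randBatch-rounds argMax usm B f c ρ I M 1# ε))
      (rounds-feasible n ⊥ (candidates ρ I ⊥) 0 (≤-trans (≤-reflexive (Σ-⊥ c)) 0≤B)
        (λ u∈ → proj₂ (proj₂ (isCandidate u∈))))

  least-suc : ∀ {p} {P : Pred ℕ p} (P? : Decidable P) m → ¬ P 0 → ∃ λ k → least P? (suc m) ≡ suc k
  least-suc P? m ¬P0 with P? 0
  ... | yes P0 = contradiction P0 ¬P0
  ... | no  _  = _ , ≡.refl

  module Invariants (argMax : ArgMax) {n : ℕ} (usm : Subset n → Dist (Subset n)) (B : Carrier)
                    (f : Subset n → Carrier) (c : Fin n → Carrier) (0<c : ∀ u → 0# < c u)
                    (0≤f : ∀ X → 0# ≤ f X) (submodular : Submodular f)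
                    (ρ ε : Carrier) (0<ρ : 0# < ρ) (0<ε : 0# < ε) (8ε≤1 : fromℕ 8 * ε ≤ 1#)
                    (I : Subset n) (M : ℕ) (1≤εεM : 1# ≤ ε * (ε * fromℕ M)) where
    open Algorithm argMax usm B f c
    open Sampling argMax usm B f c 0<c
    open Deficits argMax usm B f c 0<c 0≤f submodular ρ ε 0<ρ
    open BatchResults argMax usm B f c 0<c ρ I M ε

    -- What the analysis of Probe needs to know about an outcome A of randBatch; the
    -- debt z is the total shortfall incurred while building A.
    record Certificate (A : Subset n) (z : Carrier) : Set ℓ₂ where
      field
        0≤z   : 0# ≤ z
        A⊆I   : A ⊆ I
        dense : ρ * cost A ≤ f A + z
        cover : ∀ X → X ⊆ I → (∀ {u} → u ∈ X → Feasible c B (A ∪ ⁅ u ⁆)) →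
                f (A ∪ X) ≤ f A + ρ * cost X + ε * (f A + z)

    gains : Subset n → Subset n → Carrier
    gains L A = Σ[ L ] (_∣ A)

    -- W collects the lossy elements discarded in the rounds that incremented the counter.
    record Invariant (A L : Subset n) (count : ℕ) (z : Carrier) : Set ℓ₂ where
      field
        feasible  : Feasible c B A
        A⊆I       : A ⊆ I
        0≤z       : 0# ≤ z
        dense     : ρ * cost A ≤ f A + z
        L⊆I       : L ⊆ I
        L-dense   : ∀ {u} → u ∈ L → ρ * c u ≤ u ∣ A
        L-feasible : ∀ {u} → u ∈ L → Feasible c B (A ∪ ⁅ u ⁆)
        dropped   : ∀ {u} → u ∈ I → Feasible c B (A ∪ ⁅ u ⁆) → u ∈ L ⊎ (u ∣ A ≤ ρ * c u)
        W         : Subset n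
        W∩L       : ∀ {u} → u ∈ W → u ∉ L
        charge    : fromℕ count * (ε * gains L A) + f (A ∪ W) ≤ f A + z

    initial : 0# ≤ B → Invariant ⊥ (candidates ρ I ⊥) 0 0#
    initial 0≤B = record
      { feasible   = ≤-trans (≤-reflexive (Σ-⊥ c)) 0≤B
      ; A⊆I        = λ u∈ → contradiction u∈ ∉⊥
      ; 0≤z        = ≤-refl
      ; dense      = ≤-trans (≤-reflexive (trans (*-congˡ (Σ-⊥ c)) (zeroʳ ρ))) (0≤f ⊥ ⊕ ≤-refl)
      ; L⊆I        = proj₁ ∘ isCandidate
      ; L-dense    = λ {u} u∈ → ≤/⇒*≤ (0<c u) (proj₁ (proj₂ (isCandidate u∈)))
      ; L-feasible = λ u∈ → proj₂ (proj₂ (isCandidate u∈))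
      ; dropped    = dropped
      ; W          = ⊥
      ; W∩L        = λ u∈ → contradiction u∈ ∉⊥
      ; charge     = ≤-reflexive (begin-equality
          0# * (ε * gains (candidates ρ I ⊥) ⊥) + f (⊥ ∪ ⊥)
            ≡⟨ ≡.cong (λ X → 0# * (ε * gains (candidates ρ I ⊥) ⊥) + f X) (∪-identityʳ ⊥) ⟩
          0# * (ε * gains (candidates ρ I ⊥) ⊥) + f ⊥
            ≈⟨ solve 2 (λ x y → num 0 :* x :+ y := y :+ num 0) refl _ (f ⊥) ⟩
          f ⊥ + 0#                                          ∎)
      }
      where
      dropped : ∀ {u} → u ∈ I → Feasible c B (⊥ ∪ ⁅ u ⁆) → u ∈ candidates ρ I ⊥ ⊎ (u ∣ ⊥ ≤ ρ * c u)
      dropped {u} u∈I feasible with ρ ≤? (u ∣ ⊥) / c u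
      ... | yes ρ≤ = inj₁ (candidate u∈I ρ≤ feasible)
      ... | no  ρ≰ = inj₂ (/≤⇒≤* (0<c u) (≰⇒≥ ρ≰))

    module _ {A L count z} (inv : Invariant A L count z) where
      open Invariant inv

      0<gain : ∀ {u} → u ∈ L → 0# < u ∣ A
      0<gain {u} u∈L = <-≤-trans (*-positive 0<ρ (0<c u)) (L-dense u∈L)

      0≤gains : 0# ≤ gains L A
      0≤gains = Σ-nonNegative L (_∣ A) (λ u∈L → proj₁ (0<gain u∈L))

      Σ-dropped : ∀ X → X ⊆ I → (∀ {u} → u ∈ X → Feasible c B (A ∪ ⁅ u ⁆)) →
                  Σ[ X ] (_∣ A) ≤ ρ * cost X + gains L A
      Σ-dropped X X⊆I X-feasible = begin
        sum (restrict X (_∣ A))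
          ≤⟨ sum-mono {g = restrict X (_∣ A)} {λ u → ρ * restrict X c u + restrict L (_∣ A) u} pointwise ⟩
        sum (λ u → ρ * restrict X c u + restrict L (_∣ A) u)
          ≈⟨ ∑-distrib-+ (λ u → ρ * restrict X c u) (restrict L (_∣ A)) ⟩
        sum (λ u → ρ * restrict X c u) + gains L A
          ≈⟨ +-congʳ (*-distribˡ-sum ρ (restrict X c)) ⟨
        ρ * cost X + gains L A
          ∎
        where
        0≤restrict : ∀ u → 0# ≤ restrict L (_∣ A) u
        0≤restrict u = ≤-restrict L (_∣ A) (λ u∈L → proj₁ (0<gain u∈L)) (λ _ → ≤-refl)
        pointwise : ∀ u → restrict X (_∣ A) u ≤ ρ * restrict X c u + restrict L (_∣ A) u
        pointwise u = restrict-≤ X (_∣ A)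
          (λ u∈X → ≡.subst (λ c′ → u ∣ A ≤ ρ * c′ + restrict L (_∣ A) u) (≡.sym (restrict-∈ X c u∈X))
            ([ (λ u∈L → ≡.subst (λ g → u ∣ A ≤ ρ * c u + g) (≡.sym (restrict-∈ L (_∣ A) u∈L)) (x≤y+x (0≤ρc u)))
             , (λ g≤ρc → ≤-trans g≤ρc (≤-by (0≤restrict u) refl)) ]′
             (dropped (X⊆I u∈X) (X-feasible u∈X))))
          (λ u∉X → proj₁ 0<ρ ⊗ ≤-restrict X c (λ _ → 0≤c u) (λ _ → ≤-refl) ⊕ 0≤restrict u)

      certify : (M ℕ.≤ count) ⊎ (∀ {u} → u ∉ L) → Certificate A z
      certify terminated = record
        { 0≤z      = 0≤z
        ; A⊆I      = A⊆I
        ; dense    = dense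
        ; cover    = λ X X⊆I X-feasible → begin
            f (A ∪ X)                                     ≤⟨ union-bound submodular A X ⟩
            f A + Σ[ X ] (_∣ A)                           ≤⟨ +-monoʳ-≤ _ (Σ-dropped X X⊆I X-feasible) ⟩
            f A + (ρ * cost X + gains L A) ≤⟨ +-monoʳ-≤ _ (+-monoʳ-≤ _ (gains-small terminated)) ⟩
            f A + (ρ * cost X + ε * (f A + z))            ≈⟨ +-assoc _ _ _ ⟨
            f A + ρ * cost X + ε * (f A + z)              ∎
        }
        where
        gains-small : (M ℕ.≤ count) ⊎ (∀ {u} → u ∉ L) → gains L A ≤ ε * (f A + z)
        gains-small (inj₂ empty) = begin
          gains L A            ≈⟨ Σ-cong L (_∣ A) (λ _ → 0#) (λ u∈L → contradiction u∈L empty) ⟩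
          Σ[ L ] (λ _ → 0#)    ≈⟨ Σ-zero L ⟩
          0#                   ≤⟨ proj₁ 0<ε ⊗ (0≤f A ⊕ 0≤z) ⟩
          ε * (f A + z)        ∎
        gains-small (inj₁ M≤count) = ≤-by
          (0≤y-x 1≤εεM ⊗ 0≤gains ⊕ proj₁ 0<ε ⊗ (0≤y-x (fromℕ-mono-≤ M≤count) ⊗ (proj₁ 0<ε ⊗ 0≤gains)) ⊕
           proj₁ 0<ε ⊗ (0≤y-x charge ⊕ 0≤f (A ∪ W)))
          (solve 7 (λ e m k S fA fW z → e :* (fA :+ z) := S :+
             ((e :* (e :* m) :- num 1) :* S :+ e :* ((k :- m) :* (e :* S)) :+
              e :* (fA :+ z :- (k :* (e :* S) :+ fW) :+ fW)))
            refl ε (fromℕ M) (fromℕ count) (gains L A) (f A) (f (A ∪ W)) z)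

      module Round {u₀} (u₀∈L : u₀ ∈ L) {vs} (valid : Valid A L vs) (nonempty : 1 ℕ.≤ length vs) where
        open Cut ρ ε A L vs using (t₁; t₂; t*)

        A′ = nextA A L count vs
        L′ = nextL A L count vs
        cutoff = cut A L vs
        z′ = z + shortfall A cutoff

        A⊆A′ : A ⊆ A′
        A⊆A′ = p⊆p∪q (fromList cutoff)

        A′⊆A∪L : ∀ {u} → u ∈ A′ → u ∈ A ⊎ u ∈ L
        A′⊆A∪L u∈ = Sum.map₂ (λ u∈ → All.lookup (Allₚ.take⁺ t* (proj₁ valid)) (∈-fromList⁻ cutoff u∈))
          (x∈p∪q⁻ A _ u∈)

        L′⊆L : L′ ⊆ L
        L′⊆L u∈ = p─q⊆p L A′ (proj₁ (isCandidate u∈))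

        L′∩A′ : ∀ {u} → u ∈ L′ → u ∉ A′
        L′∩A′ u∈ = ─-∉ L A′ (proj₁ (isCandidate u∈))

        L′-dense : ∀ {u} → u ∈ L′ → ρ * c u ≤ u ∣ A′
        L′-dense {u} u∈ = ≤/⇒*≤ (0<c u) (proj₁ (proj₂ (isCandidate u∈)))

        0≤gain′ : ∀ {u} → u ∈ L′ → 0# ≤ u ∣ A′
        0≤gain′ {u} u∈ = ≤-trans (0≤ρc u) (L′-dense u∈)

        dense′ : ρ * cost A′ ≤ f A′ + z′
        dense′ = ≤-by (0≤y-x (density A cutoff) ⊕ 0≤y-x dense)
          (solve 6 (λ fA fA′ rA rA′ z s → fA′ :+ (z :+ s) :=
             rA′ :+ (fA′ :+ rA :+ s :- (fA :+ rA′) :+ (fA :+ z :- rA)))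
            refl (f A) (f A′) (ρ * cost A) (ρ * cost A′) z (shortfall A cutoff))

        gain-∈≤ : ∀ {u} → u ∈ A′ → u ∣ A′ ≤ ρ * c u
        gain-∈≤ {u} u∈ = ≤-trans (≤-reflexive (gain-∈ submodular u∈)) (0≤ρc u)

        dropped′ : ∀ {u} → u ∈ I → Feasible c B (A′ ∪ ⁅ u ⁆) → u ∈ L′ ⊎ (u ∣ A′ ≤ ρ * c u)
        dropped′ {u} u∈I feasible′ with u ∈? A′
        ... | yes u∈A′ = inj₂ (gain-∈≤ u∈A′)
        ... | no u∉A′ with dropped u∈I (feasible-⊆ (∪-elim A ⁅ u ⁆ (p⊆p∪q ⁅ u ⁆ ∘ A⊆A′)
          (q⊆p∪q A′ ⁅ u ⁆)) feasible′)
        ... | inj₂ g≤ρc = inj₂ (≤-trans (gain-antitone submodular A⊆A′ u∉A′) g≤ρc)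
        ... | inj₁ u∈L with ρ ≤? (u ∣ A′) / c u
        ... | yes ρ≤ = inj₁ (candidate (x∈p∧x∉q⇒x∈p─q u∈L u∉A′) ρ≤ feasible′)
        ... | no  ρ≰ = inj₂ (/≤⇒≤* (0<c u) (≰⇒≥ ρ≰))

        gains-decrease : gains L′ A′ ≤ gains L A
        gains-decrease = ≤-trans
          (Σ-mono L′ (_∣ A′) (_∣ A) (λ u∈ → gain-antitone submodular A⊆A′ (L′∩A′ u∈)))
          (Σ-mono-⊆ L′ L (_∣ A) (λ u∈L → proj₁ (0<gain u∈L)) L′⊆L)

        gains≤profit : gains L′ A′ ≤ profit A L A′
        gains≤profit = Σ-mono-⊆ L′ (candidates ρ L A′) (_∣ A′)
          (λ {u} u∈ → ≤-trans (0≤ρc u) (≤/⇒*≤ (0<c u) (proj₁ (proj₂ (isCandidate u∈)))))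
          (λ u∈ → let _ , ρ≤ , feasible = isCandidate u∈ in candidate (L′⊆L u∈) ρ≤ feasible)

        W-diminishing : f (A′ ∪ W) + f A ≤ f (A ∪ W) + f A′
        W-diminishing = diminishing submodular A⊆A′ λ u∈ →
          let u∈W , u∈A′ = x∈p∩q⁻ W A′ u∈
          in [ id , (λ u∈L → contradiction u∈L (W∩L u∈W)) ]′ (A′⊆A∪L u∈A′)

        continue : fromℕ count * (ε * gains L′ A′) + f (A′ ∪ W) ≤ f A′ + z′
        continue = ≤-by
          (0≤y-x charge ⊕ 0≤fromℕ count ⊗ (proj₁ 0<ε ⊗ 0≤y-x gains-decrease) ⊕ 0≤y-x W-diminishing ⊕
           shortfall-nonNegative A cutoff)
          (solve 10 (λ k e S S′ fA fA′ fW fW′ z s → fA′ :+ (z :+ s) := k :* (e :* S′) :+ fW′ :+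
             (fA :+ z :- (k :* (e :* S) :+ fW) :+ k :* (e :* (S :- S′)) :+ (fW :+ fA′ :- (fW′ :+ fA)) :+ s))
            refl (fromℕ count) ε (gains L A) (gains L′ A′) (f A) (f A′) (f (A ∪ W)) (f (A′ ∪ W)) z
              (shortfall A cutoff))

        E = E⁻ A L A′

        E⊆L : ∀ {u} → u ∈ E → u ∈ L
        E⊆L u∈ = proj₁ (∈⟪⟫⁻ (isLossy? A L A′) u∈)

        E-lossy : ∀ {u} → u ∈ E → u ∣ A′ < 0#
        E-lossy u∈ = proj₂ (∈⟪⟫⁻ (isLossy? A L A′) u∈)

        E-loss : f (A′ ∪ E) + loss A L A′ ≤ f A′
        E-loss = begin
          f (A′ ∪ E) + loss A L A′                ≤⟨ +-mono-≤ (union-bound submodular A′ E) ≤-refl ⟩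
          f A′ + Σ[ E ] (_∣ A′) + loss A L A′     ≈⟨ +-assoc _ _ _ ⟩
          f A′ + (Σ[ E ] (_∣ A′) + loss A L A′)   ≈⟨ +-congˡ (Σ-+ E (_∣ A′) (λ u → abs (u ∣ A′))) ⟨
          f A′ + Σ[ E ] (λ u → u ∣ A′ + abs (u ∣ A′))
            ≈⟨ +-congˡ (trans (Σ-cong E (λ u → u ∣ A′ + abs (u ∣ A′)) (λ _ → 0#)
                 (λ u∈ → trans (+-congˡ (abs-negative (E-lossy u∈))) (-‿inverseʳ _))) (Σ-zero E)) ⟩
          f A′ + 0#                               ≈⟨ +-identityʳ _ ⟩
          f A′                                    ∎

        E-diminishing : f ((A′ ∪ W) ∪ E) + f A′ ≤ f (A′ ∪ E) + f (A′ ∪ W)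
        E-diminishing = diminishing submodular (p⊆p∪q W) λ u∈ →
          let u∈E , u∈A′∪W = x∈p∩q⁻ E (A′ ∪ W) u∈
          in [ id , (λ u∈W → contradiction (E⊆L u∈E) (W∩L u∈W)) ]′ (x∈p∪q⁻ A′ W u∈A′∪W)

        unprofitable-round : t₂ ℕ.< t₁ → Unprofitable A L cutoff
        unprofitable-round t₂<t₁ = ≡.subst (λ t → Unprofitable A L (take t vs))
          (≡.sym (ℕₚ.m≥n⇒m⊓n≡n (ℕₚ.<⇒≤ t₂<t₁)))
          ([ unprofitable⁺ A L vs {t₂} , (λ none → contradiction
               (least-none (unprofitable? A L vs) (length vs) (λ i< → none (ℕₚ.<⇒≤ i<)))
               (λ t₂≡ → ℕₚ.<⇒≱ t₂<t₁ (≡.subst (t₁ ℕ.≤_) (≡.sym t₂≡) (t₁-≤ A L vs)))) ]′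
           (least-or-none (unprofitable? A L vs) (length vs)))

        charge-more : Unprofitable A L cutoff →
          fromℕ (suc count) * (ε * gains L′ A′) + f (A′ ∪ (W ∪ E)) ≤ f A′ + z′
        charge-more unprofitable = ≡.subst (λ X → fromℕ (suc count) * (ε * gains L′ A′) + f X ≤ f A′ + z′)
          (∪-assoc A′ W E) (begin
            (1# + fromℕ count) * (ε * gains L′ A′) + f ((A′ ∪ W) ∪ E)
              ≈⟨ solve 3 (λ k s F → (num 1 :+ k) :* s :+ F := s :+ (k :* s :+ F)) refl _ _ _ ⟩
            ε * gains L′ A′ + (fromℕ count * (ε * gains L′ A′) + f ((A′ ∪ W) ∪ E))
              ≤⟨ +-mono-≤ (≤-trans (*-monoˡ-≤ (proj₁ 0<ε) gains≤profit)
                   (≤-trans unprofitable (+-monoʳ-≤ _ (debits≤shortfall A cutoff))))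
                 (+-mono-≤ (*-monoˡ-≤ (0≤fromℕ count) (*-monoˡ-≤ (proj₁ 0<ε) gains-decrease))
                   (≤-by (0≤y-x E-diminishing ⊕ 0≤y-x E-loss ⊕ 0≤y-x W-diminishing)
                     (solve 7 (λ FWE F′ FE l FW′ F FW → F′ :- l :+ FW :- F := FWE :+
                       (FE :+ FW′ :- (FWE :+ F′) :+ (F′ :- (FE :+ l)) :+ (FW :+ F′ :- (FW′ :+ F))))
                       refl (f ((A′ ∪ W) ∪ E)) (f A′) (f (A′ ∪ E)) (loss A L A′) (f (A′ ∪ W)) (f A)
                         (f (A ∪ W))))) ⟩
            loss A L A′ + shortfall A cutoff + (fromℕ count * (ε * gains L A) +
              (f A′ - loss A L A′ + f (A ∪ W) - f A))
              ≤⟨ ≤-by (0≤y-x charge) (solve 7 (λ l s x F′ FW F z → F′ :+ (z :+ s) :=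
                   l :+ s :+ (x :+ (F′ :- l :+ FW :- F)) :+ (F :+ z :- (x :+ FW)))
                   refl (loss A L A′) (shortfall A cutoff) (fromℕ count * (ε * gains L A)) (f A′)
                     (f (A ∪ W)) (f A) z) ⟩
            f A′ + z′ ∎)

        module Next {count′} (W′ : Subset n) (W′∩L′ : ∀ {u} → u ∈ W′ → u ∉ L′)
                    (charge′ : fromℕ count′ * (ε * gains L′ A′) + f (A′ ∪ W′) ≤ f A′ + z′) where
          next : Invariant A′ L′ count′ z′
          next = record
            { feasible   = nextA-feasible A L count vs valid
            ; A⊆I        = λ u∈ → [ A⊆I , L⊆I ]′ (A′⊆A∪L u∈)
            ; 0≤z        = 0≤z ⊕ shortfall-nonNegative A cutoff
            ; dense      = dense′
            ; L⊆I        = L⊆I ∘ L′⊆L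
            ; L-dense    = L′-dense
            ; L-feasible = λ u∈ → proj₂ (proj₂ (isCandidate u∈))
            ; dropped    = dropped′
            ; W          = W′
            ; W∩L        = W′∩L′
            ; charge     = charge′
            }

        next-invariant : Invariant A′ L′ (nextCount A L count vs) z′
        next-invariant = if-elim (t₂ ℕₚ.<? t₁) (λ count′ → Invariant A′ L′ count′ z′)
          (λ t₂<t₁ → Next.next (W ∪ E)
            (∪-elim W E (λ u∈W u∈L′ → W∩L u∈W (L′⊆L u∈L′)) (λ u∈E u∈L′ → <⇒≱ (E-lossy u∈E) (0≤gain′ u∈L′)))
            (charge-more (unprofitable-round t₂<t₁)))
          (λ _ → Next.next W (λ u∈W u∈L′ → W∩L u∈W (L′⊆L u∈L′)) continue)

        L⊆candidates : L ⊆ candidates ρ L A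
        L⊆candidates {u} u∈L = candidate u∈L (*≤⇒≤/ (0<c u) (L-dense u∈L)) (L-feasible u∈L)

        0<cost : 0# < cost L
        0<cost = <-≤-trans (0<c u₀) (≤-trans (≤-reflexive (sym (Σ-⁅⁆ c u₀)))
          (Σ-mono-⊆ ⁅ u₀ ⁆ L c (λ _ → 0≤c _) (⁅⁆⊆ u₀∈L)))

        cost-candidates : cost L ≤ cost (candidates ρ L A)
        cost-candidates = Σ-mono-⊆ L (candidates ρ L A) c (λ _ → 0≤c _) L⊆candidates

        ¬costDrops : ¬ CostDrops A L []
        ¬costDrops drops = <⇒≱ (*-positive 0<ε 0<cost) (≤-by
          (0≤y-x (≤-trans cost-candidates (≡.subst (λ X → cost (candidates ρ L X) ≤ (1# - ε) * cost L)
            (∪-identityʳ A) drops)))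
          (solve 2 (λ e x → num 0 := e :* x :+ ((num 1 :- e) :* x :- x)) refl ε (cost L)))

        ¬unprofitable : ¬ Unprofitable A L []
        ¬unprofitable unprofitable = <⇒≱ (*-positive 0<ε (*-positive 0<ρ 0<cost)) (begin
          ε * (ρ * cost L)
            ≤⟨ *-monoˡ-≤ (proj₁ 0<ε) (≤-trans (*-monoˡ-≤ (proj₁ 0<ρ) cost-candidates)
                 (ρcost≤profit argMax usm B f c 0<c 0≤f submodular ρ ε 0<ρ 0<ε 8ε≤1 A L A)) ⟩
          ε * profit A L A
            ≤⟨ ≡.subst (λ X → ε * profit A L X ≤ loss A L X + 0#) (∪-identityʳ A) unprofitable ⟩
          loss A L A + 0#
            ≈⟨ trans (+-identityʳ _) (trans (Σ-cong (E⁻ A L A) (λ u → abs (u ∣ A)) (λ _ → 0#) (λ u∈ →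
                 let u∈L , g<0 = ∈⟪⟫⁻ (isLossy? A L A) u∈
                 in contradiction (proj₁ (0<gain u∈L)) (<⇒≱ g<0))) (Σ-zero (E⁻ A L A))) ⟩
          0# ∎)

        cut-nonempty : ∃ λ v → v ∈ L × v ∈ fromList cutoff
        cut-nonempty = go vs (proj₁ valid) nonempty
          where
          go : ∀ vs → All (_∈ L) vs → 1 ℕ.≤ length vs → ∃ λ v → v ∈ L × v ∈ fromList (cut A L vs)
          go (v ∷ vs) (v∈L ∷ _) _ =
            let k₁ , t₁≡ = least-suc (costDrops? A L (v ∷ vs)) (length vs) ¬costDrops
                k₂ , t₂≡ = least-suc (unprofitable? A L (v ∷ vs)) (length vs)
                  (¬unprofitable ∘ unprofitable⁺ A L (v ∷ vs) {0})
            in v , v∈L , ≡.subst₂ (λ t t′ → v ∈ fromList (take (t ℕ.⊓ t′) (v ∷ vs))) (≡.sym t₁≡) (≡.sym t₂≡)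
                 (p⊆p∪q (fromList (take (k₁ ℕ.⊓ k₂) vs)) (x∈⁅x⁆ v))

        shrinks : ∣ L′ ∣ ℕ.< ∣ L ∣
        shrinks = let v , v∈L , v∈cut = cut-nonempty
                  in p⊂q⇒∣p∣<∣q∣ (L′⊆L , v , v∈L , λ v∈L′ → L′∩A′ v∈L′ (q⊆p∪q A _ v∈cut))

  module Bounds (argMax : ArgMax) {n : ℕ} (usm : Subset n → Dist (Subset n)) (B : Carrier)
                (f : Subset n → Carrier) (c : Fin n → Carrier) (0<c : ∀ u → 0# < c u)
                (0≤f : ∀ X → 0# ≤ f X) (submodular : Submodular f)
                (ρ ε : Carrier) (0<ρ : 0# < ρ) (0<ε : 0# < ε) (8ε≤1 : fromℕ 8 * ε ≤ 1#)
                (I : Subset n) (M : ℕ) (1≤εεM : 1# ≤ ε * (ε * fromℕ M)) where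
    open Algorithm argMax usm B f c
    open Sampling argMax usm B f c 0<c
    open Deficits argMax usm B f c 0<c 0≤f submodular ρ ε 0<ρ
    open BatchResults argMax usm B f c 0<c ρ I M ε
    open Invariants argMax usm B f c 0<c 0≤f submodular ρ ε 0<ρ 0<ε 8ε≤1 I M 1≤εεM

    module _ (h : Subset n → Carrier) (b : Carrier)
             (certified : ∀ {A z} → Certificate A z → b ≤ h A + z) where

      bonus : Outcome → Carrier
      bonus (A , _) = h A + fromℕ 3 * (ε * f A)

      return-bound : ∀ {A L z} → Certificate A z → b + (fromℕ 3 * (ε * f A) - z) ≤ 𝔼 bonus (return (A , A , L))
      return-bound {A} {L} {z} certificate = begin
        b + (fromℕ 3 * (ε * f A) - z)          ≤⟨ +-mono-≤ (certified certificate) ≤-refl ⟩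
        h A + z + (fromℕ 3 * (ε * f A) - z) ≈⟨ solve 3 (λ h z x → h :+ z :+ (x :- z) := h :+ x) refl (h A) z _ ⟩
        h A + fromℕ 3 * (ε * f A)              ≈⟨ 𝔼-return bonus (A , A , L) ⟨
        𝔼 bonus (return (A , A , L))           ∎

      rounds-bound : ∀ k {A L count z} → Invariant A L count z → ∣ L ∣ ℕ.≤ k →
                     b + (fromℕ 3 * (ε * f A) - z) ≤ 𝔼 bonus (roundsOf k A L count)
      rounds-bound zero {A} {L} inv ∣L∣≤0 = return-bound {L = L} (certify inv (inj₂ λ {u} u∈L →
        ℕₚ.1+n≰n (ℕₚ.≤-trans (ℕₚ.≤-reflexive (≡.sym (∣⁅x⁆∣≡1 u))) (ℕₚ.≤-trans (p⊆q⇒∣p∣≤∣q∣ (⁅⁆⊆ u∈L)) ∣L∣≤0))))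
      rounds-bound (suc k) {A} {L} {count} {z} inv ∣L∣≤ = if-elim (nonempty? L ×-dec (count ℕₚ.<? M))
        (λ d → b + (fromℕ 3 * (ε * f A) - z) ≤ 𝔼 bonus d)
        (λ ((u₀ , u₀∈L) , _) → begin
          b + (fromℕ 3 * (ε * f A) - z)
            ≈⟨ solve 3 (λ b x z → b :+ (x :- z) := b :- z :+ x) refl b _ z ⟩
          b - z + fromℕ 3 * (ε * f A)
            ≤⟨ +-monoʳ-≤ _ (getSEQ-potential argMax usm B f c 0<c 0≤f submodular ρ ε 0<ρ 0<ε 8ε≤1 A L) ⟩
          b - z + 𝔼 (λ vs → potential A L (cut A L vs)) (getSEQ A L)
            ≈⟨ +-congʳ (𝔼-const (b - z) (getSEQ A L) (getSEQ-isDistribution A L)) ⟨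
          𝔼 (λ _ → b - z) (getSEQ A L) + 𝔼 (λ vs → potential A L (cut A L vs)) (getSEQ A L)
            ≈⟨ 𝔼-+ (λ _ → b - z) (λ vs → potential A L (cut A L vs)) (getSEQ A L) ⟨
          𝔼 (λ vs → b - z + potential A L (cut A L vs)) (getSEQ A L)
            ≤⟨ 𝔼-mono {d = getSEQ A L} (proj₁ (getSEQ-isDistribution A L))
                 (getSEQ-valid u₀∈L (Invariant.L-feasible inv)) (λ {vs} → round u₀∈L vs) ⟩
          𝔼 (λ vs → 𝔼 bonus (mixtureOf k A L count vs)) (getSEQ A L)
            ≈⟨ 𝔼->>= bonus (getSEQ A L) (mixtureOf k A L count) ⟨
          𝔼 bonus (getSEQ A L >>= mixtureOf k A L count)
            ∎)
        (λ stop → return-bound {L = L} (certify inv (terminated stop (nonempty? L))))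
        where
        terminated : ¬ (Nonempty L × count ℕ.< M) → Dec (Nonempty L) → (M ℕ.≤ count) ⊎ (∀ {u} → u ∉ L)
        terminated stop (yes L≠∅) = inj₁ (ℕₚ.≮⇒≥ λ count<M → stop (L≠∅ , count<M))
        terminated stop (no  L=∅) = inj₂ λ u∈L → L=∅ (_ , u∈L)

        round : ∀ {u₀} → u₀ ∈ L → ∀ vs → Valid A L vs × 1 ℕ.≤ length vs →
                b - z + potential A L (cut A L vs) ≤ 𝔼 bonus (mixtureOf k A L count vs)
        round u₀∈L vs (valid , nonempty) = begin
          b - z + (fromℕ 3 * (ε * f A′) - s)
            ≈⟨ solve 4 (λ b z x s → b :- z :+ (x :- s) := b :+ (x :- (z :+ s))) refl b z _ s ⟩
          b + (fromℕ 3 * (ε * f A′) - (z + s))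
            ≤⟨ rounds-bound k {A′} {L′} {nextCount A L count vs} next-invariant
                                                       (ℕₚ.≤-pred (ℕₚ.≤-trans shrinks ∣L∣≤)) ⟩
          𝔼 bonus (afterRound k A L count vs)     ≈⟨ 𝔼-mixture bonus k A L count vs ⟨
          𝔼 bonus (mixtureOf k A L count vs)      ∎
          where
          open Round inv u₀∈L valid nonempty
          s = shortfall A (cut A L vs)

      randBatch-bound : 0# ≤ B → b ≤ 𝔼 bonus (randBatch ρ I M 1# ε)
      randBatch-bound 0≤B = ≡.subst (λ d → b ≤ 𝔼 bonus d) (≡.sym (randBatch-rounds argMax usm B f c ρ I M 1# ε))
        (≤-trans (≤-by (0≤fromℕ 3 ⊗ (proj₁ 0<ε ⊗ 0≤f ⊥))
           (solve 2 (λ b x → b :+ (x :- num 0) := b :+ x) refl b (fromℕ 3 * (ε * f ⊥))))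
         (rounds-bound n {L = candidates ρ I ⊥} {count = 0} (initial 0≤B) (∣p∣≤n (candidates ρ I ⊥))))

  -- Probe

  module Outcomes (argMax : ArgMax) {n : ℕ} (usm : Subset n → Dist (Subset n)) (B : Carrier)
                  (f : Subset n → Carrier) (c : Fin n → Carrier) where
    open Algorithm argMax usm B f c
    open ArgMax argMax

    -- Placeholders solved by unification to definitions local to probe.
    mutual
      best : (ρ : Carrier) (N₁ N₂ : Subset n) (ε : Carrier) → Subset n → Subset n → Subset n
      best = _

      private
        augment : (ρ : Carrier) (N₁ N₂ : Subset n) (ε : Carrier) → Subset n → List (Subset n)
        augment = _

        probe-end : (ρ : Carrier) (N₁ N₂ : Subset n) (ε : Carrier) → Subset n → Subset n → Dist (Subset n)
        probe-end = _

      probe-unfold : ∀ ρ N₁ N₂ ε → probe ρ N₁ N₂ ε ≡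
        (randBatch ρ N₁ ⌈ (ε ^ 2) ⁻¹ ⌉ 1# ε >>= λ r₁ →
         randBatch ρ (N₁ ─ proj₁ r₁) ⌈ (ε ^ 2) ⁻¹ ⌉ 1# ε >>= λ r₂ → probe-end ρ N₁ N₂ ε (proj₁ r₁) (proj₁ r₂))
      probe-unfold ρ N₁ N₂ ε = ≡.refl

      probe-end-best : ∀ ρ N₁ N₂ ε A₁ A₂ → probe-end ρ N₁ N₂ ε A₁ A₂ ≡
        (if does (feasible? (N₂ ∪ A₁))
         then (usm (N₂ ∪ A₁) >>= λ A₃ → return (argmax f (best ρ N₁ N₂ ε A₁ A₂) (A₃ ∷ [])))
         else return (best ρ N₁ N₂ ε A₁ A₂))
      probe-end-best ρ N₁ N₂ ε A₁ A₂ = ≡.refl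

      best-augment : ∀ ρ N₁ N₂ ε A₁ A₂ → best ρ N₁ N₂ ε A₁ A₂ ≡
        argmax f (argmax f ⊥ (A₁ ∷ augment ρ N₁ N₂ ε A₁)) (A₂ ∷ augment ρ N₁ N₂ ε A₂)
      best-augment ρ N₁ N₂ ε A₁ A₂ = ≡.refl

    augment-feasible : ∀ ρ N₁ N₂ ε A → All (Feasible c B) (augment ρ N₁ N₂ ε A)
    augment-feasible ρ N₁ N₂ ε A with filter (λ u → feasible? (A ∪ ⁅ u ⁆)) (elements N₁) in eq
    ... | []     = []
    ... | u ∷ us = proj₂ (∈-filter⁻ (λ u → feasible? (A ∪ ⁅ u ⁆)) {xs = elements N₁}
      (≡.subst (_ ∈ˡ_) (≡.sym eq) (argmax-∈ (λ e → f (A ∪ ⁅ e ⁆)) u us))) ∷ []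

  maximiser : ∀ {n} (g : Subset n → Carrier) → ∃ λ X → ∀ Y → g Y ≤ g X
  maximiser {zero}  g = [] , λ { [] → ≤-refl }
  maximiser {suc n} g with maximiser (g ∘ (inside ∷_)) | maximiser (g ∘ (outside ∷_))
  ... | X , X-max | Y , Y-max with ≤-total (g (inside ∷ X)) (g (outside ∷ Y))
  ... | inj₁ X≤Y = outside ∷ Y , λ { (inside ∷ Z) → ≤-trans (X-max Z) X≤Y ; (outside ∷ Z) → Y-max Z }
  ... | inj₂ Y≤X = inside ∷ X  , λ { (inside ∷ Z) → X-max Z ; (outside ∷ Z) → ≤-trans (Y-max Z) Y≤X }

  1-2ε≈2[½-ε] : ∀ ε x → (1# - fromℕ 2 * ε) * x ≈ fromℕ 2 * ((fromℕ 2 ⁻¹ - ε) * x)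
  1-2ε≈2[½-ε] ε x = trans (*-congʳ (+-congʳ (sym (*-inverseʳ (<⇒≉ (0<fromℕ 1))))))
    (solve 3 (λ h e x → (num 2 :* h :- num 2 :* e) :* x := num 2 :* ((h :- e) :* x)) refl (fromℕ 2 ⁻¹) ε x)

  module _ {ε} (0≤ε : 0# ≤ ε) (8ε≤1 : fromℕ 8 * ε ≤ 1#) where

    0≤1-2ε : 0# ≤ 1# - fromℕ 2 * ε
    0≤1-2ε = ≤-by (0≤y-x 8ε≤1 ⊕ 0≤fromℕ 6 ⊗ 0≤ε)
      (solve 1 (λ e → num 1 :- num 2 :* e := num 0 :+ (num 1 :- num 8 :* e :+ num 6 :* e)) refl ε)

    0≤½-ε : 0# ≤ fromℕ 2 ⁻¹ - ε
    0≤½-ε = *-cancelˡ-≤ (0<fromℕ 1) (begin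
      fromℕ 2 * 0#                        ≈⟨ zeroʳ _ ⟩
      0#                                  ≤⟨ 0≤1-2ε ⟩
      1# - fromℕ 2 * ε                    ≈⟨ *-identityʳ _ ⟨
      (1# - fromℕ 2 * ε) * 1#             ≈⟨ 1-2ε≈2[½-ε] ε 1# ⟩
      fromℕ 2 * ((fromℕ 2 ⁻¹ - ε) * 1#)   ≈⟨ *-congˡ (*-identityʳ _) ⟩
      fromℕ 2 * (fromℕ 2 ⁻¹ - ε)          ∎)

  usm-bound : ∀ {n f ε usm} → IsUSM {n} f ε usm → 0# ≤ fromℕ 2 ⁻¹ - ε → ∀ {X Y} → Y ⊆ X →
              (fromℕ 2 ⁻¹ - ε) * f Y ≤ 𝔼 f (usm X)
  usm-bound {f = f} isUSM 0≤½-ε {X} {Y} Y⊆X with maximiser (λ Z → f (Z ∩ X))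
  ... | Z , Z-max = ≤-trans (*-monoˡ-≤ 0≤½-ε (within Y⊆X))
    (IsUSM.approximation isUSM X (f (Z ∩ X)) ((Z ∩ X , p∩q⊆q Z X , refl) , λ Y → within))
    where
    within : ∀ {Y} → Y ⊆ X → f Y ≤ f (Z ∩ X)
    within {Y} Y⊆X = ≡.subst (λ V → f V ≤ f (Z ∩ X))
      (⊆-antisym (p∩q⊆p Y X) (λ u∈ → x∈p∩q⁺ (u∈ , Y⊆X u∈))) (Z-max Y)

  heavy-certificate : ∀ {w ε ρB ρC F m z₁ z₂} → 0# ≤ w → 0# ≤ ε → 0# ≤ z₂ →
    fromℕ 2 * w - fromℕ 2 * (ε * w) ≤ ρB → ρB ≤ fromℕ 2 * ρC → ρC ≤ F + z₁ → F ≤ m →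
    w - fromℕ 2 * (ε * w) ≤ m + z₁ + z₂
  heavy-certificate {w} {ε} {ρB} {ρC} {F} {m} {z₁} {z₂} 0≤w 0≤ε 0≤z₂ lower heavy dense F≤m =
    *-cancelˡ-≤ (0<fromℕ 1) (≤-by
      (0≤y-x lower ⊕ 0≤y-x heavy ⊕ 0≤fromℕ 2 ⊗ (0≤y-x dense ⊕ 0≤y-x F≤m ⊕ 0≤z₂) ⊕
       0≤fromℕ 2 ⊗ (0≤ε ⊗ 0≤w))
      (solve 8 (λ w e rB rC F m z₁ z₂ → num 2 :* (m :+ z₁ :+ z₂) := num 2 :* (w :- num 2 :* (e :* w)) :+
         (rB :- (num 2 :* w :- num 2 :* (e :* w)) :+ (num 2 :* rC :- rB) :+
          num 2 :* (F :+ z₁ :- rC :+ (m :- F) :+ z₂) :+ num 2 :* (e :* w)))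
        refl w ε ρB ρC F m z₁ z₂))

  -- Here FO = f(O′), C = ρ c(O′), F₁ = f(O₂), FR = f(R), aᵢ = f(Aᵢ) and x = 𝔼 f(USM(N₂ ∪ A₁)), where
  -- O₂ = (O′ ∩ N₁) ─ A₁ and R = O′ ─ O₂.
  light-certificate : ∀ {w ε FO C F₁ FR a₁ a₂ x m z₁ z₂} →
    0# ≤ ε → fromℕ 8 * ε ≤ 1# → 0# ≤ m → 0# ≤ z₁ → 0# ≤ z₂ →
    fromℕ 4 * w + fromℕ 2 * C ≤ FO → FO ≤ F₁ + FR →
    F₁ ≤ (a₁ + C + ε * (a₁ + z₁)) + (a₂ + C + ε * (a₂ + z₂)) →
    (fromℕ 2 ⁻¹ - ε) * FR ≤ x → x ≤ m → a₁ ≤ m → a₂ ≤ m →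
    w - fromℕ 2 * (ε * w) ≤ m + z₁ + z₂
  light-certificate {w} {ε} {FO} {C} {F₁} {FR} {a₁} {a₂} {x} {m} {z₁} {z₂}
    0≤ε 8ε≤1 0≤m 0≤z₁ 0≤z₂ optimum split cover usm x≤m a₁≤m a₂≤m = *-cancelˡ-≤ (0<fromℕ 3) (begin
      fromℕ 4 * (w - fromℕ 2 * (ε * w))
        ≈⟨ solve 2 (λ w e → num 4 :* (w :- num 2 :* (e :* w)) := (num 1 :- num 2 :* e) :* (num 4 :* w))
          refl w ε ⟩
      (1# - fromℕ 2 * ε) * (fromℕ 4 * w)
        ≤⟨ *-monoˡ-≤ (0≤1-2ε 0≤ε 8ε≤1) 4w≤ ⟩
      (1# - fromℕ 2 * ε) * ((fromℕ 2 + fromℕ 2 * ε) * m + ε * (z₁ + z₂) + FR)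
        ≈⟨ distribˡ _ _ _ ⟩
      (1# - fromℕ 2 * ε) * ((fromℕ 2 + fromℕ 2 * ε) * m + ε * (z₁ + z₂)) + (1# - fromℕ 2 * ε) * FR
        ≤⟨ +-monoʳ-≤ _ usm′ ⟩
      (1# - fromℕ 2 * ε) * ((fromℕ 2 + fromℕ 2 * ε) * m + ε * (z₁ + z₂)) + fromℕ 2 * m
        ≤⟨ ≤-by (0≤ε ⊗ 0≤m ⊗ (0≤fromℕ 2 ⊕ 0≤fromℕ 4 ⊗ 0≤ε) ⊕
                 (0≤z₁ ⊕ 0≤z₂) ⊗ (0≤y-x 8ε≤1 ⊕ 0≤fromℕ 7 ⊗ 0≤ε ⊕ 0≤fromℕ 3 ⊕
                                  0≤fromℕ 2 ⊗ 0≤ε ⊗ 0≤ε))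
           (solve 4 (λ e m z₁ z₂ → num 4 :* (m :+ z₁ :+ z₂) :=
              (num 1 :- num 2 :* e) :* ((num 2 :+ num 2 :* e) :* m :+ e :* (z₁ :+ z₂)) :+ num 2 :* m :+
              (e :* m :* (num 2 :+ num 4 :* e) :+
               (z₁ :+ z₂) :* (num 1 :- num 8 :* e :+ num 7 :* e :+ num 3 :+ num 2 :* e :* e)))
             refl ε m z₁ z₂) ⟩
      fromℕ 4 * (m + z₁ + z₂) ∎)
    where
    4w≤ : fromℕ 4 * w ≤ (fromℕ 2 + fromℕ 2 * ε) * m + ε * (z₁ + z₂) + FR
    4w≤ = begin
      fromℕ 4 * w                ≤⟨ ≤-by (0≤y-x optimum ⊕ 0≤y-x split ⊕ 0≤y-x cover)
        (solve 10 (λ w FO C F₁ FR a₁ a₂ e z₁ z₂ →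
           a₁ :+ e :* (a₁ :+ z₁) :+ (a₂ :+ e :* (a₂ :+ z₂)) :+ FR := num 4 :* w :+
           (FO :- (num 4 :* w :+ num 2 :* C) :+ (F₁ :+ FR :- FO) :+
            (a₁ :+ C :+ e :* (a₁ :+ z₁) :+ (a₂ :+ C :+ e :* (a₂ :+ z₂)) :- F₁)))
          refl w FO C F₁ FR a₁ a₂ ε z₁ z₂) ⟩
      a₁ + ε * (a₁ + z₁) + (a₂ + ε * (a₂ + z₂)) + FR
        ≤⟨ ≤-by ((0≤fromℕ 1 ⊕ 0≤ε) ⊗ (0≤y-x a₁≤m ⊕ 0≤y-x a₂≤m))
          (solve 7 (λ e m FR a₁ a₂ z₁ z₂ → (num 2 :+ num 2 :* e) :* m :+ e :* (z₁ :+ z₂) :+ FR :=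
             a₁ :+ e :* (a₁ :+ z₁) :+ (a₂ :+ e :* (a₂ :+ z₂)) :+ FR :+
             ((num 1 :+ num 0 :+ e) :* (m :- a₁ :+ (m :- a₂)))) refl ε m FR a₁ a₂ z₁ z₂) ⟩
      (fromℕ 2 + fromℕ 2 * ε) * m + ε * (z₁ + z₂) + FR ∎
    usm′ : (1# - fromℕ 2 * ε) * FR ≤ fromℕ 2 * m
    usm′ = begin
      (1# - fromℕ 2 * ε) * FR                  ≈⟨ 1-2ε≈2[½-ε] ε FR ⟩
      fromℕ 2 * ((fromℕ 2 ⁻¹ - ε) * FR)        ≤⟨ *-monoˡ-≤ (0≤fromℕ 2) (≤-trans usm x≤m) ⟩
      fromℕ 2 * m                              ∎

  module ProbeResults (argMax : ArgMax) {n : ℕ} (usm : Subset n → Dist (Subset n)) (B : Carrier)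
                      (f : Subset n → Carrier) (c : Fin n → Carrier) (0<c : ∀ u → 0# < c u)
                      (0<B : 0# < B) (ε : Carrier) (isUSM : IsUSM f ε usm)
                      (ρ : Carrier) (N₁ N₂ : Subset n) where
    open Algorithm argMax usm B f c
    open Sampling argMax usm B f c 0<c
    open Outcomes argMax usm B f c
    open ArgMax argMax
    open IsUSM isUSM

    rounds-limit : ℕ
    rounds-limit = ⌈ (ε ^ 2) ⁻¹ ⌉

    T : Subset n → Subset n → Subset n
    T = best ρ N₁ N₂ ε

    finish : Subset n → Subset n → Dist (Subset n)
    finish A₁ A₂ = if does (feasible? (N₂ ∪ A₁))
      then (usm (N₂ ∪ A₁) >>= λ A₃ → return (argmax f (T A₁ A₂) (A₃ ∷ [])))
      else return (T A₁ A₂)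

    first : Dist (Subset n × Subset n × Subset n)
    first = randBatch ρ N₁ rounds-limit 1# ε

    second : Subset n → Dist (Subset n × Subset n × Subset n)
    second A₁ = randBatch ρ (N₁ ─ A₁) rounds-limit 1# ε

    probe-finish : probe ρ N₁ N₂ ε ≡
      (first >>= λ r₁ → second (proj₁ r₁) >>= λ r₂ → finish (proj₁ r₁) (proj₁ r₂))
    probe-finish = probe-unfold ρ N₁ N₂ ε

    first-isDistribution : IsDistribution first
    first-isDistribution = BatchResults.randBatch-isDistribution argMax usm B f c 0<c ρ N₁ rounds-limit ε

    second-isDistribution : ∀ A₁ → IsDistribution (second A₁)
    second-isDistribution A₁ = BatchResults.randBatch-isDistribution argMax usm B f c 0<c ρ
      (N₁ ─ A₁) rounds-limit ε

    finish-isDistribution : ∀ A₁ A₂ → IsDistribution (finish A₁ A₂)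
    finish-isDistribution A₁ A₂ = if-elim (feasible? (N₂ ∪ A₁)) IsDistribution
      (λ _ → >>=-isDistribution (isDistribution (N₂ ∪ A₁))
        (λ A₃ → return-isDistribution (argmax f (T A₁ A₂) (A₃ ∷ []))))
      (λ _ → return-isDistribution (T A₁ A₂))

    probe-isDistribution : IsDistribution (probe ρ N₁ N₂ ε)
    probe-isDistribution = ≡.subst IsDistribution (≡.sym probe-finish)
      (>>=-isDistribution first-isDistribution λ (A₁ , _) →
        >>=-isDistribution (second-isDistribution A₁) λ (A₂ , _) → finish-isDistribution A₁ A₂)

    T-feasible : ∀ {A₁ A₂} → Feasible c B A₁ → Feasible c B A₂ → Feasible c B (T A₁ A₂)
    T-feasible {A₁} {A₂} A₁-feasible A₂-feasible = All.lookup
      (All.lookup (⊥-feasible ∷ A₁-feasible ∷ augment-feasible ρ N₁ N₂ ε A₁) (argmax-∈ f ⊥ _) ∷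
       A₂-feasible ∷ augment-feasible ρ N₁ N₂ ε A₂) (argmax-∈ f _ _)
      where
      ⊥-feasible : Feasible c B ⊥
      ⊥-feasible = ≤-trans (≤-reflexive (Σ-⊥ c)) (proj₁ 0<B)

    finish-feasible : ∀ {A₁ A₂} → Feasible c B A₁ → Feasible c B A₂ → AlmostSurely (Feasible c B) (finish A₁ A₂)
    finish-feasible {A₁} {A₂} A₁-feasible A₂-feasible = if-elim (feasible? (N₂ ∪ A₁))
      (AlmostSurely (Feasible c B))
      (λ feasible → >>=-surely (proj₁ (isDistribution (N₂ ∪ A₁))) (subset (N₂ ∪ A₁)) λ {A₃} A₃⊆ →
        return-surely (All.lookup (T-feasible A₁-feasible A₂-feasible ∷ feasible-⊆ A₃⊆ feasible ∷ [])
          (argmax-∈ f (T A₁ A₂) (A₃ ∷ []))))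
      (λ _ → return-surely (T-feasible A₁-feasible A₂-feasible))

    probe-feasible : AlmostSurely (Feasible c B) (probe ρ N₁ N₂ ε)
    probe-feasible = ≡.subst (AlmostSurely (Feasible c B)) (≡.sym probe-finish)
      (>>=-surely (proj₁ first-isDistribution)
        (BatchResults.randBatch-feasible argMax usm B f c 0<c ρ N₁ rounds-limit ε (proj₁ 0<B))
        λ {r₁} A₁-feasible →
        >>=-surely (proj₁ (second-isDistribution (proj₁ r₁)))
          (BatchResults.randBatch-feasible argMax usm B f c 0<c ρ (N₁ ─ proj₁ r₁) rounds-limit ε (proj₁ 0<B))
          λ A₂-feasible → finish-feasible A₁-feasible A₂-feasible)

    𝔼-finish-usm : ∀ {A₁} A₂ → Feasible c B (N₂ ∪ A₁) → 𝔼 f (usm (N₂ ∪ A₁)) ≤ 𝔼 f (finish A₁ A₂)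
    𝔼-finish-usm {A₁} A₂ feasible = if-elim (feasible? (N₂ ∪ A₁)) (λ d → 𝔼 f (usm (N₂ ∪ A₁)) ≤ 𝔼 f d)
      (λ _ → ≤-trans (𝔼-mono-always (proj₁ (isDistribution (N₂ ∪ A₁))) λ A₃ →
          ≤-trans (argmax-maximal f (T A₁ A₂) (A₃ ∷ []) (there (here ≡.refl)))
            (≤-reflexive (sym (𝔼-return f _))))
        (≤-reflexive (sym (𝔼->>= f (usm (N₂ ∪ A₁)) (λ A₃ → return (argmax f (T A₁ A₂) (A₃ ∷ [])))))))
      (λ infeasible → contradiction feasible infeasible)

    T≤𝔼-finish : ∀ A₁ A₂ → f (T A₁ A₂) ≤ 𝔼 f (finish A₁ A₂)
    T≤𝔼-finish A₁ A₂ = if-elim (feasible? (N₂ ∪ A₁)) (λ d → f (T A₁ A₂) ≤ 𝔼 f d)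
      (λ _ → ≤-trans (𝔼-≥ (isDistribution (N₂ ∪ A₁)) (always (usm (N₂ ∪ A₁)) λ A₃ →
          ≤-trans (argmax-maximal f (T A₁ A₂) (A₃ ∷ []) (here ≡.refl))
            (≤-reflexive (sym (𝔼-return f (argmax f (T A₁ A₂) (A₃ ∷ [])))))) (λ h → h))
        (≤-reflexive (sym (𝔼->>= f (usm (N₂ ∪ A₁)) (λ A₃ → return (argmax f (T A₁ A₂) (A₃ ∷ [])))))))
      (λ _ → ≤-reflexive (sym (𝔼-return f (T A₁ A₂))))

    f₁≤finish : ∀ A₁ A₂ → f A₁ ≤ 𝔼 f (finish A₁ A₂)
    f₁≤finish A₁ A₂ = ≤-trans (≤-trans (argmax-maximal f ⊥ _ (there (here ≡.refl)))
      (argmax-maximal f _ _ (here ≡.refl))) (T≤𝔼-finish A₁ A₂)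

    f₂≤finish : ∀ A₁ A₂ → f A₂ ≤ 𝔼 f (finish A₁ A₂)
    f₂≤finish A₁ A₂ = ≤-trans (argmax-maximal f _ _ (there (here ≡.refl))) (T≤𝔼-finish A₁ A₂)

    module Guarantee (0≤f : ∀ X → 0# ≤ f X) (submodular : Submodular f)
                     (0<ρ : 0# < ρ) (0<ε : 0# < ε) (8ε≤1 : fromℕ 8 * ε ≤ 1#)
                     (N₁∪N₂ : ∀ {u} → u ∉ N₁ → u ∈ N₂) (N₂-small : cost N₂ ≤ ε * B)
                     (O : Subset n) (O-feasible : Feasible c B O) (w : Carrier) (0≤w : 0# ≤ w)
                     (8w≤O : fromℕ 8 * w ≤ f O) (singletons : ∀ u → f ⁅ u ⁆ ≤ w)
                     (ρB≤2w : ρ * B ≤ fromℕ 2 * w) (2w≲ρB : fromℕ 2 * w - fromℕ 2 * (ε * w) ≤ ρ * B) where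

      1≤εεM : 1# ≤ ε * (ε * fromℕ rounds-limit)
      1≤εεM = begin
        1#                                   ≈⟨ *-inverseʳ (<⇒≉ 0<ε²) ⟨
        ε ^ 2 * (ε ^ 2) ⁻¹                   ≤⟨ *-monoˡ-≤ (proj₁ 0<ε²) (⌈⌉-satisfies ((ε ^ 2) ⁻¹)) ⟩
        ε ^ 2 * fromℕ rounds-limit ≈⟨ solve 2 (λ e m → e :* (e :* num 1) :* m := e :* (e :* m)) refl ε _ ⟩
        ε * (ε * fromℕ rounds-limit)         ∎
        where
        0<ε² : 0# < ε ^ 2
        0<ε² = *-positive 0<ε (*-positive 0<ε 0<1)

      Certificate : Subset n → Subset n → Carrier → Set ℓ₂
      Certificate I = Invariants.Certificate argMax usm B f c 0<c 0≤f submodular ρ ε 0<ρ 0<ε 8ε≤1 I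
        rounds-limit 1≤εεM

      0≤c : ∀ u → 0# ≤ c u
      0≤c u = proj₁ (0<c u)

      -- O without its element costing more than B / 2, if there is one.
      reference : ∃ λ O′ → (∀ {u} → u ∈ O′ → fromℕ 2 * c u ≤ B) × fromℕ 4 * w + fromℕ 2 * (ρ * cost O′) ≤ f O′
      reference with Finₚ.any? (λ u → u ∈? O ×-dec (B <? fromℕ 2 * c u))
      ... | no light = O , (λ {u} u∈O → ≮⇒≥ λ B<2c → light (u , u∈O , B<2c)) , ≤-by
          (0≤y-x 8w≤O ⊕ 0≤fromℕ 2 ⊗ (proj₁ 0<ρ ⊗ 0≤y-x O-feasible ⊕ 0≤y-x ρB≤2w))
          (solve 5 (λ w r C B F → F := num 4 :* w :+ num 2 :* (r :* C) :+
             (F :- num 8 :* w :+ num 2 :* (r :* (B :- C) :+ (num 2 :* w :- r :* B)))) refl w ρ (cost O) B (f O))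
      ... | yes (o , o∈O , heavy) = O′ , light , ≤-by
          (0≤y-x split ⊕ 0≤y-x 8w≤O ⊕ 0≤y-x (singletons o) ⊕
           proj₁ 0<ρ ⊗ (0≤fromℕ 2 ⊗ 0≤y-x rest-cost ⊕ 0≤y-x (proj₁ heavy)) ⊕ 0≤y-x ρB≤2w ⊕ 0≤w)
          (solve 8 (λ w r C B F′ F Fo co → F′ := num 4 :* w :+ num 2 :* (r :* C) :+
             (F′ :+ Fo :- F :+ (F :- num 8 :* w) :+ (w :- Fo) :+
              r :* (num 2 :* (B :- (C :+ co)) :+ (num 2 :* co :- B)) :+ (num 2 :* w :- r :* B) :+ w))
             refl w ρ (cost O′) B (f O′) (f O) (f ⁅ o ⁆) (c o))
        where
        O′ = O ─ ⁅ o ⁆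
        O≡ : O ≡ O′ ∪ ⁅ o ⁆
        O≡ = ⊆-antisym
          (λ {u} u∈O → case-⁅⁆ u∈O (u ∈? ⁅ o ⁆))
          (∪-elim O′ ⁅ o ⁆ (p─q⊆p O ⁅ o ⁆) (⁅⁆⊆ o∈O))
          where
          case-⁅⁆ : ∀ {u} → u ∈ O → Dec (u ∈ ⁅ o ⁆) → u ∈ O′ ∪ ⁅ o ⁆
          case-⁅⁆ u∈O (yes u∈o) = q⊆p∪q O′ ⁅ o ⁆ u∈o
          case-⁅⁆ u∈O (no  u∉o) = p⊆p∪q ⁅ o ⁆ (x∈p∧x∉q⇒x∈p─q u∈O u∉o)
        split : f O ≤ f O′ + f ⁅ o ⁆
        split = ≡.subst (λ X → f X ≤ f O′ + f ⁅ o ⁆) (≡.sym O≡) (union-≤ submodular 0≤f O′ ⁅ o ⁆)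
        rest-cost : cost O′ + c o ≤ B
        rest-cost = begin
          cost O′ + c o          ≈⟨ +-congˡ (Σ-⁅⁆ c o) ⟨
          cost O′ + cost ⁅ o ⁆   ≈⟨ Σ-∪-disjoint O′ ⁅ o ⁆ c (─-∉ O ⁅ o ⁆) ⟨
          cost (O′ ∪ ⁅ o ⁆)      ≡⟨ ≡.cong cost O≡ ⟨
          cost O                 ≤⟨ O-feasible ⟩
          B                      ∎
        light : ∀ {u} → u ∈ O′ → fromℕ 2 * c u ≤ B
        light {u} u∈ = ≤-by
          (0≤fromℕ 2 ⊗ 0≤y-x (≤-trans (≤-reflexive (sym (Σ-⁅⁆ c u)))
            (Σ-mono-⊆ ⁅ u ⁆ O′ c (λ _ → 0≤c _) (⁅⁆⊆ u∈))) ⊕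
           0≤fromℕ 2 ⊗ 0≤y-x rest-cost ⊕ 0≤y-x (proj₁ heavy))
          (solve 4 (λ cu C co B → B := num 2 :* cu :+ (num 2 :* (C :- cu) :+
            num 2 :* (B :- (C :+ co)) :+ (num 2 :* co :- B)))
            refl (c u) (cost O′) (c o) B)

      heavy-bound : ∀ {I A z m z′} → Certificate I A z → 0# ≤ z′ → B ≤ fromℕ 2 * cost A → f A ≤ m →
                    w - fromℕ 2 * (ε * w) ≤ m + z + z′
      heavy-bound {A = A} certificate 0≤z′ B≤2c fA≤m = heavy-certificate 0≤w (proj₁ 0<ε) 0≤z′ 2w≲ρB
        (≤-trans (*-monoˡ-≤ (proj₁ 0<ρ) B≤2c)
          (≤-reflexive (solve 2 (λ r C → r :* (num 2 :* C) := num 2 :* (r :* C)) refl ρ (cost A))))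
        (Invariants.Certificate.dense certificate) fA≤m

      light-bound : ∀ {A₁ A₂ z₁ z₂} → Certificate N₁ A₁ z₁ → Certificate (N₁ ─ A₁) A₂ z₂ →
        fromℕ 2 * cost A₁ ≤ B → fromℕ 2 * cost A₂ ≤ B →
        w - fromℕ 2 * (ε * w) ≤ 𝔼 f (finish A₁ A₂) + z₁ + z₂
      light-bound {A₁} {A₂} {z₁} {z₂} C₁ C₂ 2c₁≤B 2c₂≤B = light-certificate {C = ρ * cost O′} (proj₁ 0<ε) 8ε≤1
        (≤-trans (0≤f _) (T≤𝔼-finish A₁ A₂)) (Invariants.Certificate.0≤z C₁) (Invariants.Certificate.0≤z C₂)
        (proj₂ (proj₂ reference)) O′-split cover (usm-bound isUSM (0≤½-ε (proj₁ 0<ε) 8ε≤1) R⊆)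
          (𝔼-finish-usm A₂ N₂∪A₁-feasible)
        (f₁≤finish A₁ A₂) (f₂≤finish A₁ A₂)
        where
        O′ = proj₁ reference
        O′-light : ∀ {u} → u ∈ O′ → fromℕ 2 * c u ≤ B
        O′-light = proj₁ (proj₂ reference)
        O₁ = O′ ∩ N₁
        O₂ = O₁ ─ A₁
        R = O′ ─ O₂

        N₂∪A₁-feasible : Feasible c B (N₂ ∪ A₁)
        N₂∪A₁-feasible = *-cancelˡ-≤ (0<fromℕ 1) (≤-by
          (0≤fromℕ 2 ⊗ (0≤y-x (Σ-∪-≤ N₂ A₁ c 0≤c) ⊕ 0≤y-x N₂-small) ⊕ 0≤y-x 2c₁≤B ⊕
           (0≤y-x 8ε≤1 ⊕ 0≤fromℕ 6 ⊗ proj₁ 0<ε) ⊗ proj₁ 0<B)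
          (solve 5 (λ U N A B e → num 2 :* B := num 2 :* U :+ (num 2 :* (N :+ A :- U :+ (e :* B :- N)) :+
             (B :- num 2 :* A) :+ (num 1 :- num 8 :* e :+ num 6 :* e) :* B))
            refl (cost (N₂ ∪ A₁)) (cost N₂) (cost A₁) B ε))

        augmented-feasible : ∀ A → fromℕ 2 * cost A ≤ B → ∀ {u} → u ∈ O′ → Feasible c B (A ∪ ⁅ u ⁆)
        augmented-feasible A 2c≤B {u} u∈ = *-cancelˡ-≤ (0<fromℕ 1) (≤-by
          (0≤fromℕ 2 ⊗ 0≤y-x (≤-trans (Σ-∪-≤ A ⁅ u ⁆ c 0≤c) (+-monoʳ-≤ _ (≤-reflexive (Σ-⁅⁆ c u)))) ⊕
           0≤y-x 2c≤B ⊕ 0≤y-x (O′-light u∈))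
          (solve 4 (λ U A cu B → num 2 :* B := num 2 :* U :+
            (num 2 :* (A :+ cu :- U) :+ (B :- num 2 :* A) :+ (B :- num 2 :* cu)))
            refl (cost (A ∪ ⁅ u ⁆)) (cost A) (c u) B))

        O₁⊆O′ : O₁ ⊆ O′
        O₁⊆O′ = p∩q⊆p O′ N₁

        O₂⊆O₁ : O₂ ⊆ O₁
        O₂⊆O₁ = p─q⊆p O₁ A₁

        O₂∉A₁ : ∀ {u} → u ∈ O₂ → u ∉ A₁
        O₂∉A₁ = ─-∉ O₁ A₁

        ρcost : ∀ {X} → X ⊆ O′ → ρ * cost X ≤ ρ * cost O′
        ρcost {X} X⊆ = *-monoˡ-≤ (proj₁ 0<ρ) (Σ-mono-⊆ X O′ c (λ _ → 0≤c _) X⊆)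

        cover₁ : f (A₁ ∪ O₁) ≤ f A₁ + ρ * cost O′ + ε * (f A₁ + z₁)
        cover₁ = ≤-trans
          (Invariants.Certificate.cover C₁ O₁ (p∩q⊆q O′ N₁) (augmented-feasible A₁ 2c₁≤B ∘ O₁⊆O′))
          (+-mono-≤ (+-monoʳ-≤ _ (ρcost O₁⊆O′)) ≤-refl)

        cover₂ : f (A₂ ∪ O₂) ≤ f A₂ + ρ * cost O′ + ε * (f A₂ + z₂)
        cover₂ = ≤-trans
          (Invariants.Certificate.cover C₂ O₂
            (λ u∈ → x∈p∧x∉q⇒x∈p─q (p∩q⊆q O′ N₁ (O₂⊆O₁ u∈)) (O₂∉A₁ u∈))
            (augmented-feasible A₂ 2c₂≤B ∘ O₁⊆O′ ∘ O₂⊆O₁))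
          (+-mono-≤ (+-monoʳ-≤ _ (ρcost (O₁⊆O′ ∘ O₂⊆O₁))) ≤-refl)

        intersection : (A₁ ∪ O₁) ∩ (A₂ ∪ O₂) ≡ O₂
        intersection = ⊆-antisym
          (λ u∈ → let u∈₁ , u∈₂ = x∈p∩q⁻ (A₁ ∪ O₁) (A₂ ∪ O₂) u∈ in
            [ (λ u∈A₂ → let u∉A₁ = ─-∉ N₁ A₁ (Invariants.Certificate.A⊆I C₂ u∈A₂) in
                [ (λ u∈A₁ → contradiction u∈A₁ u∉A₁) , (λ u∈O₁ → x∈p∧x∉q⇒x∈p─q u∈O₁ u∉A₁) ]′ (x∈p∪q⁻ A₁ O₁ u∈₁))
            , id ]′ (x∈p∪q⁻ A₂ O₂ u∈₂))
          (λ u∈ → x∈p∩q⁺ (q⊆p∪q A₁ O₁ (O₂⊆O₁ u∈) , q⊆p∪q A₂ O₂ u∈))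

        cover : f O₂ ≤ f A₁ + ρ * cost O′ + ε * (f A₁ + z₁) + (f A₂ + ρ * cost O′ + ε * (f A₂ + z₂))
        cover = begin
          f O₂                                                      ≡⟨ ≡.cong f intersection ⟨
          f ((A₁ ∪ O₁) ∩ (A₂ ∪ O₂)) ≤⟨ x≤y+x (0≤f ((A₁ ∪ O₁) ∪ (A₂ ∪ O₂))) ⟩
          f ((A₁ ∪ O₁) ∪ (A₂ ∪ O₂)) + f ((A₁ ∪ O₁) ∩ (A₂ ∪ O₂))     ≤⟨ submodular (A₁ ∪ O₁) (A₂ ∪ O₂) ⟩
          f (A₁ ∪ O₁) + f (A₂ ∪ O₂)                                 ≤⟨ +-mono-≤ cover₁ cover₂ ⟩
          _                                                         ∎

        O′-split : f O′ ≤ f O₂ + f R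
        O′-split = ≡.subst (λ X → f X ≤ f O₂ + f R) O₂∪R (union-≤ submodular 0≤f O₂ R)
          where
          O₂∪R : O₂ ∪ R ≡ O′
          O₂∪R = ⊆-antisym (∪-elim O₂ R (O₁⊆O′ ∘ O₂⊆O₁) (p─q⊆p O′ O₂)) (λ {u} u∈ → place u∈ (u ∈? O₂))
            where
            place : ∀ {u} → u ∈ O′ → Dec (u ∈ O₂) → u ∈ O₂ ∪ R
            place u∈ (yes u∈O₂) = p⊆p∪q R u∈O₂
            place u∈ (no  u∉O₂) = q⊆p∪q O₂ R (x∈p∧x∉q⇒x∈p─q u∈ u∉O₂)

        R⊆ : R ⊆ N₂ ∪ A₁
        R⊆ {u} u∈R = place (u ∈? N₁) (u ∈? A₁)
          where
          place : Dec (u ∈ N₁) → Dec (u ∈ A₁) → u ∈ N₂ ∪ A₁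
          place (no  u∉N₁) _          = p⊆p∪q A₁ (N₁∪N₂ u∉N₁)
          place (yes u∈N₁) (yes u∈A₁) = q⊆p∪q N₂ A₁ u∈A₁
          place (yes u∈N₁) (no  u∉A₁) = contradiction
            (x∈p∧x∉q⇒x∈p─q (x∈p∩q⁺ (p─q⊆p O′ O₂ u∈R , u∈N₁)) u∉A₁) (─-∉ O′ O₂ u∈R)

      finish-bound : ∀ {A₁ A₂ z₁ z₂} → Certificate N₁ A₁ z₁ → Certificate (N₁ ─ A₁) A₂ z₂ →
                     w - fromℕ 2 * (ε * w) ≤ 𝔼 f (finish A₁ A₂) + z₁ + z₂
      finish-bound {A₁} {A₂} {z₁} {z₂} C₁ C₂ = cases (B ≤? fromℕ 2 * cost A₁) (B ≤? fromℕ 2 * cost A₂)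
        where
        cases : Dec (B ≤ fromℕ 2 * cost A₁) → Dec (B ≤ fromℕ 2 * cost A₂) →
                w - fromℕ 2 * (ε * w) ≤ 𝔼 f (finish A₁ A₂) + z₁ + z₂
        cases (yes heavy₁) _ = heavy-bound C₁ (Invariants.Certificate.0≤z C₂) heavy₁ (f₁≤finish A₁ A₂)
        cases (no _) (yes heavy₂) = ≤-trans
          (heavy-bound C₂ (Invariants.Certificate.0≤z C₁) heavy₂ (f₂≤finish A₁ A₂))
          (≤-reflexive (solve 3 (λ m z₁ z₂ → m :+ z₂ :+ z₁ := m :+ z₁ :+ z₂) refl _ z₁ z₂))
        cases (no light₁) (no light₂) = light-bound C₁ C₂ (≰⇒≥ light₁) (≰⇒≥ light₂)

      module First  = Bounds argMax usm B f c 0<c 0≤f submodular ρ ε 0<ρ 0<ε 8ε≤1 N₁ rounds-limit 1≤εεM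
      module Second (A₁ : Subset n) =
        Bounds argMax usm B f c 0<c 0≤f submodular ρ ε 0<ρ 0<ε 8ε≤1 (N₁ ─ A₁) rounds-limit 1≤εεM

      bonus : Subset n → Carrier
      bonus A = fromℕ 3 * (ε * f A)

      value : Subset n → Carrier
      value A₁ = 𝔼 (λ (A₂ , _) → 𝔼 f (finish A₁ A₂) + bonus A₂) (second A₁)

      value-bound : ∀ {A₁ z₁} → Certificate N₁ A₁ z₁ → w - fromℕ 2 * (ε * w) ≤ value A₁ + z₁
      value-bound {A₁} {z₁} C₁ = begin
        w - fromℕ 2 * (ε * w)
          ≤⟨ Second.randBatch-bound A₁ (λ A₂ → 𝔼 f (finish A₁ A₂) + z₁) _ (λ C₂ → finish-bound C₁ C₂)
            (proj₁ 0<B) ⟩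
        𝔼 (λ (A₂ , _) → 𝔼 f (finish A₁ A₂) + z₁ + bonus A₂) (second A₁)
          ≈⟨ 𝔼-cong (second A₁) (λ (A₂ , _) → solve 3 (λ m z b → m :+ z :+ b := m :+ b :+ z) refl
            (𝔼 f (finish A₁ A₂)) z₁ (bonus A₂)) ⟩
        𝔼 (λ (A₂ , _) → 𝔼 f (finish A₁ A₂) + bonus A₂ + z₁) (second A₁)
          ≈⟨ 𝔼-+ (λ (A₂ , _) → 𝔼 f (finish A₁ A₂) + bonus A₂) (λ _ → z₁) (second A₁) ⟩
        value A₁ + 𝔼 (λ _ → z₁) (second A₁)
          ≈⟨ +-congˡ (𝔼-const z₁ (second A₁) (second-isDistribution A₁)) ⟩
        value A₁ + z₁
          ∎

      κ : Carrier
      κ = 1# + fromℕ 6 * ε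

      absorb-bonuses : ∀ A₁ → value A₁ + bonus A₁ ≤ κ * 𝔼 (λ (A₂ , _) → 𝔼 f (finish A₁ A₂)) (second A₁)
      absorb-bonuses A₁ = begin
        value A₁ + bonus A₁
          ≈⟨ +-congˡ (𝔼-const (bonus A₁) (second A₁) (second-isDistribution A₁)) ⟨
        value A₁ + 𝔼 (λ _ → bonus A₁) (second A₁)
          ≈⟨ 𝔼-+ (λ (A₂ , _) → 𝔼 f (finish A₁ A₂) + bonus A₂) (λ _ → bonus A₁) (second A₁) ⟨
        𝔼 (λ (A₂ , _) → 𝔼 f (finish A₁ A₂) + bonus A₂ + bonus A₁) (second A₁)
          ≤⟨ 𝔼-mono-always (proj₁ (second-isDistribution A₁)) (λ (A₂ , _) → ≤-by
               (0≤fromℕ 3 ⊗ (proj₁ 0<ε ⊗ (0≤y-x (f₁≤finish A₁ A₂) ⊕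
                                                     0≤y-x (f₂≤finish A₁ A₂))))
               (solve 4 (λ e m a₁ a₂ → (num 1 :+ num 6 :* e) :* m :=
                  m :+ num 3 :* (e :* a₂) :+ num 3 :* (e :* a₁) :+ num 3 :* (e :* (m :- a₁ :+ (m :- a₂))))
                 refl ε (𝔼 f (finish A₁ A₂)) (f A₁) (f A₂))) ⟩
        𝔼 (λ (A₂ , _) → κ * 𝔼 f (finish A₁ A₂)) (second A₁)
          ≈⟨ 𝔼-*ˡ κ (λ (A₂ , _) → 𝔼 f (finish A₁ A₂)) (second A₁) ⟩
        κ * 𝔼 (λ (A₂ , _) → 𝔼 f (finish A₁ A₂)) (second A₁)
          ∎

      𝔼-probe : 𝔼 f (probe ρ N₁ N₂ ε) ≈ 𝔼 (λ (A₁ , _) → 𝔼 (λ (A₂ , _) → 𝔼 f (finish A₁ A₂)) (second A₁)) first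
      𝔼-probe = begin-equality
        𝔼 f (probe ρ N₁ N₂ ε)
          ≡⟨ ≡.cong (𝔼 f) probe-finish ⟩
        𝔼 f (first >>= λ r₁ → second (proj₁ r₁) >>= λ r₂ → finish (proj₁ r₁) (proj₁ r₂))
          ≈⟨ 𝔼->>= f first (λ r₁ → second (proj₁ r₁) >>= λ r₂ → finish (proj₁ r₁) (proj₁ r₂)) ⟩
        𝔼 (λ r₁ → 𝔼 f (second (proj₁ r₁) >>= λ r₂ → finish (proj₁ r₁) (proj₁ r₂))) first
          ≈⟨ 𝔼-cong first (λ r₁ → 𝔼->>= f (second (proj₁ r₁)) (λ r₂ → finish (proj₁ r₁) (proj₁ r₂))) ⟩
        𝔼 (λ r₁ → 𝔼 (λ r₂ → 𝔼 f (finish (proj₁ r₁) (proj₁ r₂))) (second (proj₁ r₁))) first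
          ∎

      probe-bound : w - fromℕ 8 * (ε * w) ≤ 𝔼 f (probe ρ N₁ N₂ ε)
      probe-bound = *-cancelˡ-≤ 0<κ (begin
        κ * (w - fromℕ 8 * (ε * w))
          ≤⟨ ≤-by (0≤fromℕ 6 ⊗ (proj₁ 0<ε ⊗ 0≤8εw) ⊕ 0≤y-x (≤-refl {fromℕ 8 * (ε * w)}))
               (solve 3 (λ e w v → w :- num 2 :* (e :* w) :=
                  (num 1 :+ num 6 :* e) :* (w :- v) :+ (num 6 :* (e :* v) :+ (v :- num 8 :* (e :* w))))
                 refl ε w (fromℕ 8 * (ε * w))) ⟩
        w - fromℕ 2 * (ε * w)
          ≤⟨ First.randBatch-bound value _ value-bound (proj₁ 0<B) ⟩
        𝔼 (λ (A₁ , _) → value A₁ + bonus A₁) first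
          ≤⟨ 𝔼-mono-always (proj₁ first-isDistribution) (λ (A₁ , _) → absorb-bonuses A₁) ⟩
        𝔼 (λ (A₁ , _) → κ * 𝔼 (λ (A₂ , _) → 𝔼 f (finish A₁ A₂)) (second A₁)) first
          ≈⟨ 𝔼-*ˡ κ (λ (A₁ , _) → 𝔼 (λ (A₂ , _) → 𝔼 f (finish A₁ A₂)) (second A₁)) first ⟩
        κ * 𝔼 (λ (A₁ , _) → 𝔼 (λ (A₂ , _) → 𝔼 f (finish A₁ A₂)) (second A₁)) first
          ≈⟨ *-congˡ 𝔼-probe ⟨
        κ * 𝔼 f (probe ρ N₁ N₂ ε)
          ∎)
        where
        0≤8εw : 0# ≤ fromℕ 8 * (ε * w)
        0≤8εw = 0≤fromℕ 8 ⊗ (proj₁ 0<ε ⊗ 0≤w)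
        0<κ : 0# < κ
        0<κ = <-≤-trans 0<1 (≤-by (0≤fromℕ 6 ⊗ proj₁ 0<ε) refl)

  -- ParSKP

  open import Data.Integer.Base using (+_; -[1+_])

  next : ℤ → ℤ
  next (+ k)        = + suc k
  next -[1+ zero ]  = + zero
  next -[1+ suc k ] = -[1+ k ]

  advance : ℕ → ℤ → ℤ
  advance zero    z = z
  advance (suc m) z = advance m (next z)

  below : ℕ → ℤ
  below zero    = + zero
  below (suc k) = -[1+ k ]

  advance-+ : ∀ m k → advance m (+ k) ≡ + (m ℕ.+ k)
  advance-+ zero    k = ≡.refl
  advance-+ (suc m) k = ≡.trans (advance-+ m (suc k)) (≡.cong +_ (ℕₚ.+-suc m k))

  advance-below : ∀ k m → advance (k ℕ.+ m) (below k) ≡ + m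
  advance-below zero          m = ≡.trans (advance-+ m 0) (≡.cong +_ (ℕₚ.+-identityʳ m))
  advance-below (suc zero)    m = advance-below zero m
  advance-below (suc (suc k)) m = advance-below (suc k) m

  module _ {ε} (0<ε : 0# < ε) (ε<1 : ε < 1#) where
    private r = 1# - ε

    0<r : 0# < r
    0<r = 0<1-ε 0<ε ε<1

    r*r⁻¹ : ∀ x → r * (r ⁻¹ * x) ≈ x
    r*r⁻¹ x = trans (sym (*-assoc _ _ _)) (trans (*-congʳ (*-inverseʳ (<⇒≉ 0<r))) (*-identityˡ x))

    gridPoint-next : ∀ z → r * gridPoint ε (next z) ≈ gridPoint ε z
    gridPoint-next (+ zero)     = r*r⁻¹ 1#
    gridPoint-next (+ suc k)    = r*r⁻¹ ((r ⁻¹) ^ suc k)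
    gridPoint-next -[1+ zero ]  = refl
    gridPoint-next -[1+ suc k ] = refl

    gridPoint-search : ∀ m z {x} → 0# ≤ x → gridPoint ε z ≤ x → x ≤ gridPoint ε (advance m z) →
                       ∃ λ z′ → gridPoint ε z′ ≤ x × r * x ≤ gridPoint ε z′
    gridPoint-search zero    z {x} 0≤x ≤x x≤ = z , ≤x , ≤-trans
      (≤-by (proj₁ 0<ε ⊗ 0≤x) (solve 2 (λ e x → x := (num 1 :- e) :* x :+ e :* x) refl ε x)) x≤
    gridPoint-search (suc m) z {x} 0≤x ≤x x≤ with gridPoint ε (next z) ≤? x
    ... | yes next≤x = gridPoint-search m (next z) 0≤x next≤x x≤
    ... | no next≰x = z , ≤x , ≤-trans (*-monoˡ-≤ (proj₁ 0<r) (≰⇒≥ next≰x)) (≤-reflexive (gridPoint-next z))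

    gridPoint-below : ∀ k → gridPoint ε (below k) ≈ r ^ k
    gridPoint-below zero    = refl
    gridPoint-below (suc k) = refl

    gridPoint-above : ∀ k → gridPoint ε (+ k) ≈ (r ⁻¹) ^ k
    gridPoint-above zero    = refl
    gridPoint-above (suc k) = refl

    gridPoint-dense : ∀ {x} → 0# < x → ∃ λ z → gridPoint ε z ≤ x × r * x ≤ gridPoint ε z
    gridPoint-dense {x} 0<x = gridPoint-search (k ℕ.+ l) (below k) (proj₁ 0<x)
      (≤-trans (≤-reflexive (gridPoint-below k)) (⌈log⌉-satisfies 0<ε ε<1 0<x))
      (≡.subst (λ z → x ≤ gridPoint ε z) (≡.sym (advance-below k l)) (begin
        x                                 ≈⟨ *-identityˡ x ⟨
        1# * x                            ≈⟨ *-congʳ (⁻¹^*^ (<⇒≉ 0<r) l) ⟨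
        (r ⁻¹) ^ l * r ^ l * x            ≤⟨ *-monoʳ-≤ (proj₁ 0<x) (*-monoˡ-≤
          (^-nonNegative (⁻¹-nonNegative 0<r) l) (⌈log⌉-satisfies 0<ε ε<1 0<x⁻¹)) ⟩
        (r ⁻¹) ^ l * x ⁻¹ * x             ≈⟨ /-*-cancel 0<x ⟩
        (r ⁻¹) ^ l                        ≈⟨ gridPoint-above l ⟨
        gridPoint ε (+ l)                 ∎))
      where
      k = ⌈log[1- ε ] x ⌉
      l = ⌈log[1- ε ] x ⁻¹ ⌉
      0<x⁻¹ = ⁻¹-positive 0<x

    repetitions-positive : ∃ λ k → ⌈log[1- ε ] ε ⌉ ≡ suc k
    repetitions-positive with ⌈log[1- ε ] ε ⌉ | ⌈log⌉-satisfies 0<ε ε<1 0<ε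
    ... | zero  | 1≤ε = contradiction 1≤ε (<⇒≱ ε<1)
    ... | suc k | _   = k , ≡.refl

  sum-const : ∀ m v → sum {m} (λ _ → v) ≈ fromℕ m * v
  sum-const zero    v = sym (zeroˡ v)
  sum-const (suc m) v = trans (+-congˡ (sum-const m v))
    (solve 2 (λ v k → v :+ k :* v := (num 1 :+ k) :* v) refl v (fromℕ m))

  1≤fromℕ : ∀ {m} → Fin m → 1# ≤ fromℕ m
  1≤fromℕ {suc m} _ = ≤-by (0≤fromℕ m) refl

  module ParSKP (n : ℕ) (f : Subset n → Carrier) (c : Fin n → Carrier) (B ε : Carrier)
                (0≤f : ∀ X → 0# ≤ f X) (submodular : Submodular f) (0<c : ∀ u → 0# < c u)
                (0<B : 0# < B) (c≤B : ∀ u → c u ≤ B) (0<ε : 0# < ε) (ε<1 : ε < 1#)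
                (usm : Subset n → Dist (Subset n)) (isUSM : IsUSM f ε usm)
                (argMax : ArgMax) (u* : Fin n) (u*-max : ∀ u → f ⁅ u ⁆ ≤ f ⁅ u* ⁆) where
    open Algorithm argMax usm B f c
    open Sampling argMax usm B f c 0<c using (feasible-⊆)
    open ArgMax argMax
    open IsUSM isUSM

    α : Carrier
    α = fromℕ 4 ⁻¹

    N₁ N₂ : Subset n
    N₁ = ⟪ (λ u → ε * B / fromℕ n <? c u) ⟫
    N₂ = ∁ N₁

    ρmin ρmax : Carrier
    ρmin = α * f ⁅ u* ⁆ / B
    ρmax = fromℕ n ^ 2 * α * f ⁅ u* ⁆ / (ε * B)

    exponents : List ℤ
    exponents = gridExponents ε ρmin ρmax

    probeAt : ℤ → Dist (Subset n)
    probeAt z = probe (gridPoint ε z) N₁ N₂ ε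

    runs : List (Dist (Subset n))
    runs = concatMap (λ z → replicate ⌈log[1- ε ] ε ⌉ (probeAt z)) exponents

    output : Subset n → List (Subset n) → Subset n
    output S₀ outs = argmax f (argmax f S₀ (⁅ u* ⁆ ∷ [])) outs

    parSKP-runs : parSKP u* α ε ≡ (usm N₂ >>= λ S₀ → independently runs >>= λ outs → return (output S₀ outs))
    parSKP-runs = ≡.refl

    0<n : 0# < fromℕ n
    0<n = <-≤-trans 0<1 (1≤fromℕ u*)

    N₂-cheap : ∀ {u} → u ∈ N₂ → c u ≤ ε * B / fromℕ n
    N₂-cheap {u} u∈ = ≮⇒≥ λ expensive → x∈∁p⇒x∉p u∈ (∈⟪⟫⁺ (λ u → ε * B / fromℕ n <? c u) expensive)

    N₂-small : cost N₂ ≤ ε * B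
    N₂-small = begin
      cost N₂                      ≤⟨ Σ-mono N₂ c (λ _ → v) N₂-cheap ⟩
      Σ[ N₂ ] (λ _ → v)
        ≤⟨ sum-mono {g = restrict N₂ (λ _ → v)} {λ _ → v}
          (λ u → restrict-≤ N₂ (λ _ → v) {u} (λ _ → ≤-refl) (λ _ → 0≤v)) ⟩
      sum {n} (λ _ → v)            ≈⟨ sum-const n v ⟩
      fromℕ n * (ε * B / fromℕ n)  ≈⟨ *-comm _ _ ⟩
      ε * B / fromℕ n * fromℕ n    ≈⟨ /-*-cancel 0<n ⟩
      ε * B                        ∎
      where
      v = ε * B / fromℕ n
      0≤v : 0# ≤ v
      0≤v = proj₁ 0<ε ⊗ proj₁ 0<B ⊗ ⁻¹-nonNegative 0<n

    N₂-feasible : Feasible c B N₂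
    N₂-feasible = ≤-trans N₂-small (≤-by (0≤y-x (proj₁ ε<1) ⊗ proj₁ 0<B)
      (solve 2 (λ e B → B := e :* B :+ (num 1 :- e) :* B) refl ε B))

    all-runs : ∀ {p} {P : Dist (Subset n) → Set p} → (∀ z → P (probeAt z)) → All P runs
    all-runs Pz = Allₚ.concat⁺ (Allₚ.map⁺ (All.universal
      (λ z → Allₚ.replicate⁺ ⌈log[1- ε ] ε ⌉ (Pz z)) exponents))

    runs-distributions : All IsDistribution runs
    runs-distributions = all-runs λ z →
      ProbeResults.probe-isDistribution argMax usm B f c 0<c 0<B ε isUSM (gridPoint ε z) N₁ N₂

    runs-isDistribution : IsDistribution (independently runs)
    runs-isDistribution = independently-isDistribution runs-distributions

    probeAt∈runs : ∀ {z} → z ∈ˡ exponents → probeAt z ∈ˡ runs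
    probeAt∈runs {z} z∈ = ∈-concat⁺′ head (∈-map⁺ (λ z → replicate ⌈log[1- ε ] ε ⌉ (probeAt z)) z∈)
      where
      head : probeAt z ∈ˡ replicate ⌈log[1- ε ] ε ⌉ (probeAt z)
      head = ≡.subst (λ k → probeAt z ∈ˡ replicate k (probeAt z))
        (≡.sym (proj₂ (repetitions-positive 0<ε ε<1))) (here ≡.refl)

    parSKP-feasible : AlmostSurely (Feasible c B) (parSKP u* α ε)
    parSKP-feasible = ≡.subst (AlmostSurely (Feasible c B)) (≡.sym parSKP-runs)
      (>>=-surely (proj₁ (isDistribution N₂)) (subset N₂) λ {S₀} S₀⊆N₂ →
       >>=-surely (proj₁ runs-isDistribution) (independently-surely runs-distributions (all-runs λ z →
         ProbeResults.probe-feasible argMax usm B f c 0<c 0<B ε isUSM (gridPoint ε z) N₁ N₂))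
         λ {outs} outs-feasible →
       return-surely (All.lookup
         (All.lookup (feasible-⊆ S₀⊆N₂ N₂-feasible ∷ ≤-trans (≤-reflexive (Σ-⁅⁆ c u*)) (c≤B u*) ∷ [])
            (argmax-∈ f S₀ (⁅ u* ⁆ ∷ [])) ∷ outs-feasible)
         (argmax-∈ f (argmax f S₀ (⁅ u* ⁆ ∷ [])) outs)))

    𝔼-parSKP : 𝔼 f (parSKP u* α ε) ≈ 𝔼 (λ S₀ → 𝔼 (λ outs → f (output S₀ outs)) (independently runs)) (usm N₂)
    𝔼-parSKP = begin-equality
      𝔼 f (parSKP u* α ε)
        ≡⟨ ≡.cong (𝔼 f) parSKP-runs ⟩
      𝔼 f (usm N₂ >>= λ S₀ → independently runs >>= λ outs → return (output S₀ outs))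
        ≈⟨ 𝔼->>= f (usm N₂) (λ S₀ → independently runs >>= λ outs → return (output S₀ outs)) ⟩
      𝔼 (λ S₀ → 𝔼 f (independently runs >>= λ outs → return (output S₀ outs))) (usm N₂)
        ≈⟨ 𝔼-cong (usm N₂) (λ S₀ → trans (𝔼->>= f (independently runs) (λ outs → return (output S₀ outs)))
             (𝔼-cong (independently runs) (λ outs → 𝔼-return f (output S₀ outs)))) ⟩
      𝔼 (λ S₀ → 𝔼 (λ outs → f (output S₀ outs)) (independently runs)) (usm N₂)
        ∎

    ≤parSKP : ∀ {v} → (∀ S₀ → v ≤ 𝔼 (λ outs → f (output S₀ outs)) (independently runs)) →
              v ≤ 𝔼 f (parSKP u* α ε)
    ≤parSKP v≤ = ≤-trans (𝔼-≥ (isDistribution N₂) (always (usm N₂) v≤) (λ h → h)) (≤-reflexive (sym 𝔼-parSKP))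

    singleton≤parSKP : f ⁅ u* ⁆ ≤ 𝔼 f (parSKP u* α ε)
    singleton≤parSKP = ≤parSKP λ S₀ → 𝔼-≥ runs-isDistribution (always (independently runs) λ outs →
      ≤-trans (argmax-maximal f S₀ (⁅ u* ⁆ ∷ []) (there (here ≡.refl)))
              (argmax-maximal f (argmax f S₀ (⁅ u* ⁆ ∷ [])) outs (here ≡.refl))) (λ h → h)

    usm≤parSKP : 𝔼 f (usm N₂) ≤ 𝔼 f (parSKP u* α ε)
    usm≤parSKP = ≤-trans (𝔼-mono-always (proj₁ (isDistribution N₂)) λ S₀ →
        𝔼-≥ runs-isDistribution (always (independently runs) λ outs →
          ≤-trans (argmax-maximal f S₀ (⁅ u* ⁆ ∷ []) (here ≡.refl))
                  (argmax-maximal f (argmax f S₀ (⁅ u* ⁆ ∷ [])) outs (here ≡.refl))) (λ h → h))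
      (≤-reflexive (sym 𝔼-parSKP))

    probe≤parSKP : ∀ {z} → z ∈ˡ exponents → 𝔼 f (probeAt z) ≤ 𝔼 f (parSKP u* α ε)
    probe≤parSKP z∈ = ≤parSKP λ S₀ → 𝔼-independently runs-distributions (probeAt∈runs z∈)
      λ x∈ → argmax-maximal f (argmax f S₀ (⁅ u* ⁆ ∷ [])) _ (there x∈)

    module _ (O : Subset n) (O-feasible : Feasible c B O) (w : Carrier) (8w≤O : fromℕ 8 * w ≤ f O)
             (8ε≤1 : fromℕ 8 * ε ≤ 1#) (u*<w : f ⁅ u* ⁆ < w) (⊥≤2w : f ⊥ ≤ fromℕ 2 * w) where

      0<w : 0# < w
      0<w = ≤-<-trans (0≤f ⁅ u* ⁆) u*<w

      6w≤nf : fromℕ 6 * w ≤ fromℕ n * f ⁅ u* ⁆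
      6w≤nf = ≤-by (0≤y-x 8w≤O ⊕ 0≤y-x O≤ ⊕ 0≤y-x ⊥≤2w)
        (solve 4 (λ w F E N → N := num 6 :* w :+ (F :- num 8 :* w :+ (E :+ N :- F) :+ (num 2 :* w :- E)))
          refl w (f O) (f ⊥) (fromℕ n * f ⁅ u* ⁆))
        where
        gain≤ : ∀ u → gain submodular u ⊥ ≤ f ⁅ u* ⁆
        gain≤ u = ≤-trans (≤-by (0≤f ⊥) (trans (reflexive (≡.cong f (≡.sym (∪-identityˡ ⁅ u ⁆))))
          (solve 2 (λ x y → x := x :- y :+ y) refl (f (⊥ ∪ ⁅ u ⁆)) (f ⊥)))) (u*-max u)
        O≤ : f O ≤ f ⊥ + fromℕ n * f ⁅ u* ⁆
        O≤ = begin
          f O                                             ≡⟨ ≡.cong f (∪-identityˡ O) ⟨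
          f (⊥ ∪ O)                                       ≤⟨ union-bound submodular ⊥ O ⟩
          f ⊥ + Σ[ O ] (λ u → gain submodular u ⊥)
            ≤⟨ +-monoʳ-≤ _ (sum-mono {g = restrict O (λ u → gain submodular u ⊥)} {λ _ → f ⁅ u* ⁆}
            (λ u → restrict-≤ O (λ u → gain submodular u ⊥) {u} (λ _ → gain≤ u) (λ _ → 0≤f _))) ⟩
          f ⊥ + sum {n} (λ _ → f ⁅ u* ⁆)                  ≈⟨ +-congˡ (sum-const n (f ⁅ u* ⁆)) ⟩
          f ⊥ + fromℕ n * f ⁅ u* ⁆                        ∎

      0<u* : 0# < f ⁅ u* ⁆
      0<u* = 0≤f ⁅ u* ⁆ , λ 0≈f → <⇒≱ (*-positive (0<fromℕ 5) 0<w)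
        (≤-trans 6w≤nf (≤-reflexive (trans (*-congˡ (sym 0≈f)) (zeroʳ _))))

      4α≈1 : fromℕ 4 * α ≈ 1#
      4α≈1 = *-inverseʳ (<⇒≉ (0<fromℕ 3))

      0<B⁻¹ = ⁻¹-positive 0<B

      run-bound : w - fromℕ 8 * (ε * w) ≤ 𝔼 f (parSKP u* α ε)
      run-bound with gridPoint-dense 0<ε ε<1 (*-positive (*-positive (0<fromℕ 1) 0<w) 0<B⁻¹)
      ... | z , ρ≤ , ≤ρ = ≤-trans
        (ProbeResults.Guarantee.probe-bound argMax usm B f c 0<c 0<B ε isUSM ρ N₁ N₂ 0≤f submodular 0<ρ 0<ε 8ε≤1
          x∉p⇒x∈∁p N₂-small O O-feasible w (proj₁ 0<w) 8w≤O (λ u → ≤-trans (u*-max u) (proj₁ u*<w)) ρB≤2w 2w≲ρB)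
        (probe≤parSKP (gridExponents-complete 0<ε ε<1 (*-positive
          (*-positive (⁻¹-positive (0<fromℕ 3)) 0<u*) 0<B⁻¹) z ρmin≤ρ ρ≤ρmax))
        where
        ρ = gridPoint ε z

        ρB≤2w : ρ * B ≤ fromℕ 2 * w
        ρB≤2w = ≤/⇒*≤ 0<B ρ≤

        2w≲ρB : fromℕ 2 * w - fromℕ 2 * (ε * w) ≤ ρ * B
        2w≲ρB = begin
          fromℕ 2 * w - fromℕ 2 * (ε * w)
            ≈⟨ solve 2 (λ e w → num 2 :* w :- num 2 :* (e :* w) := (num 1 :- e) :* (num 2 :* w)) refl ε w ⟩
          (1# - ε) * (fromℕ 2 * w)             ≈⟨ *-congˡ (/-*-cancel 0<B) ⟨
          (1# - ε) * (fromℕ 2 * w / B * B)     ≈⟨ *-assoc _ _ _ ⟨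
          (1# - ε) * (fromℕ 2 * w / B) * B     ≤⟨ *-monoʳ-≤ (proj₁ 0<B) ≤ρ ⟩
          ρ * B                                ∎

        0<ρ : 0# < ρ
        0<ρ = <-≤-trans (*-positive (0<1-ε 0<ε ε<1) (*-positive (*-positive (0<fromℕ 1) 0<w) 0<B⁻¹)) ≤ρ

        ρmin≤ρ : ρmin ≤ ρ
        ρmin≤ρ = ≤*⇒/≤ 0<B (*-cancelˡ-≤ (0<fromℕ 3) (begin
          fromℕ 4 * (α * f ⁅ u* ⁆)     ≈⟨ *-assoc _ _ _ ⟨
          fromℕ 4 * α * f ⁅ u* ⁆       ≈⟨ trans (*-congʳ 4α≈1) (*-identityˡ _) ⟩
          f ⁅ u* ⁆                     ≤⟨ ≤-by (0≤y-x (proj₁ u*<w) ⊕ 0≤fromℕ 6 ⊗ proj₁ 0<w ⊕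
                                                0≤y-x 8ε≤1 ⊗ proj₁ 0<w ⊕ 0≤fromℕ 4 ⊗ 0≤y-x 2w≲ρB)
            (solve 4 (λ e w F R → num 4 :* R := F :+ (w :- F :+ num 6 :* w :+ (num 1 :- num 8 :* e) :* w :+
               num 4 :* (R :- (num 2 :* w :- num 2 :* (e :* w))))) refl ε w (f ⁅ u* ⁆) (ρ * B)) ⟩
          fromℕ 4 * (ρ * B)            ∎))

        ρ≤ρmax : ρ ≤ ρmax
        ρ≤ρmax = *≤⇒≤/ (*-positive 0<ε 0<B) (*-cancelˡ-≤ (0<fromℕ 3) (begin
          fromℕ 4 * (ρ * (ε * B))
            ≤⟨ ≤-by (0≤fromℕ 4 ⊗ (proj₁ 0<ε ⊗ 0≤y-x ρB≤2w) ⊕ 0≤y-x 8ε≤1 ⊗ proj₁ 0<w ⊕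
              0≤fromℕ 5 ⊗ proj₁ 0<w ⊕
                     0≤y-x 6w≤nf ⊕ 0≤y-x (1≤fromℕ u*) ⊗ (proj₁ 0<n ⊗ 0≤f ⁅ u* ⁆))
               (solve 6 (λ e w r B N F → N :* (N :* num 1) :* F := num 4 :* (r :* (e :* B)) :+
                  (num 4 :* (e :* (num 2 :* w :- r :* B)) :+ (num 1 :- num 8 :* e) :* w :+ num 5 :* w :+
                   (N :* F :- num 6 :* w) :+ (N :- num 1) :* (N :* F))) refl ε w ρ B (fromℕ n) (f ⁅ u* ⁆)) ⟩
          fromℕ n ^ 2 * f ⁅ u* ⁆
            ≈⟨ *-congʳ (trans (sym (*-identityˡ _)) (*-congʳ (sym 4α≈1))) ⟩
          fromℕ 4 * α * fromℕ n ^ 2 * f ⁅ u* ⁆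
            ≈⟨ solve 4 (λ k a m F → k :* a :* m :* F := k :* (m :* a :* F)) refl (fromℕ 4) α
              (fromℕ n ^ 2) (f ⁅ u* ⁆) ⟩
          fromℕ 4 * (fromℕ n ^ 2 * α * f ⁅ u* ⁆)
            ∎))

    parSKP-bound : ∀ O → Feasible c B O → ∀ w → fromℕ 8 * w ≤ f O → 0# ≤ w →
                   w - fromℕ 8 * (ε * w) ≤ 𝔼 f (parSKP u* α ε)
    parSKP-bound O O-feasible w 8w≤O 0≤w = cases (fromℕ 8 * ε ≤? 1#) (w ≤? f ⁅ u* ⁆) (fromℕ 2 * w ≤? f ⊥)
      where
      cases : Dec (fromℕ 8 * ε ≤ 1#) → Dec (w ≤ f ⁅ u* ⁆) → Dec (fromℕ 2 * w ≤ f ⊥) →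
              w - fromℕ 8 * (ε * w) ≤ 𝔼 f (parSKP u* α ε)
      cases (no 8ε≰1) _ _ = ≤-trans (≤-by (0≤y-x (≰⇒≥ 8ε≰1) ⊗ 0≤w)
          (solve 2 (λ e w → num 0 := w :- num 8 :* (e :* w) :+ (num 8 :* e :- num 1) :* w) refl ε w))
        (≤-trans (0≤f ⁅ u* ⁆) singleton≤parSKP)
      cases (yes _) (yes w≤u*) _ = ≤-trans (≤-by (0≤fromℕ 8 ⊗ (proj₁ 0<ε ⊗ 0≤w) ⊕ 0≤y-x w≤u*)
          (solve 3 (λ e w F → F := w :- num 8 :* (e :* w) :+ (num 8 :* (e :* w) :+ (F :- w))) refl ε w
            (f ⁅ u* ⁆)))
        singleton≤parSKP
      cases (yes 8ε≤1) (no _) (yes 2w≤⊥) = ≤-trans (*-cancelˡ-≤ (0<fromℕ 1) (begin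
          fromℕ 2 * (w - fromℕ 8 * (ε * w))
            ≤⟨ ≤-by (0≤1-2ε (proj₁ 0<ε) 8ε≤1 ⊗ 0≤y-x 2w≤⊥ ⊕ 0≤fromℕ 12 ⊗ (proj₁ 0<ε ⊗ 0≤w))
                 (solve 3 (λ e w F → (num 1 :- num 2 :* e) :* F := num 2 :* (w :- num 8 :* (e :* w)) :+
                    ((num 1 :- num 2 :* e) :* (F :- num 2 :* w) :+ num 12 :* (e :* w))) refl ε w (f ⊥)) ⟩
          (1# - fromℕ 2 * ε) * f ⊥                    ≈⟨ 1-2ε≈2[½-ε] ε (f ⊥) ⟩
          fromℕ 2 * ((fromℕ 2 ⁻¹ - ε) * f ⊥)
            ≤⟨ *-monoˡ-≤ (0≤fromℕ 2) (usm-bound isUSM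
              (0≤½-ε (proj₁ 0<ε) 8ε≤1) λ u∈ → contradiction u∈ ∉⊥) ⟩
          fromℕ 2 * 𝔼 f (usm N₂)                      ∎))
        usm≤parSKP
      cases (yes 8ε≤1) (no w≰u*) (no 2w≰⊥) =
        run-bound O O-feasible w 8w≤O 8ε≤1 (≰⇒> w≰u*) (≰⇒≥ 2w≰⊥)

    parSKP-approximation : ∀ OPT → IsMaximum f (Feasible c B) OPT → (fromℕ 8 ⁻¹ - ε) * OPT ≤ 𝔼 f (parSKP u* α ε)
    parSKP-approximation OPT ((O , O-feasible , fO≈OPT) , _) = begin
      (fromℕ 8 ⁻¹ - ε) * OPT ≈⟨ solve 3 (λ h e x → (h :- e) :* x := h :* x :- e :* x) refl (fromℕ 8 ⁻¹) ε OPT ⟩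
      w - ε * OPT                       ≈⟨ +-congˡ (-‿cong (*-congˡ (fromℕ⁻¹* 7))) ⟨
      w - ε * (fromℕ 8 * w) ≈⟨ solve 2 (λ e w → w :- e :* (num 8 :* w) := w :- num 8 :* (e :* w)) refl ε w ⟩
      w - fromℕ 8 * (ε * w) ≤⟨ parSKP-bound O O-feasible w (≤-reflexive (trans (fromℕ⁻¹* 7) (sym fO≈OPT)))
                                             (⁻¹-nonNegative (0<fromℕ 7) ⊗ ≤-trans (0≤f O)
                                               (≤-reflexive fO≈OPT)) ⟩
      𝔼 f (parSKP u* α ε)               ∎
      where w = fromℕ 8 ⁻¹ * OPT

theorem2 : ∀ {a ℓ₁ ℓ₂} (𝔽 : ArchimedeanField a ℓ₁ ℓ₂) →
  let open ArchimedeanField 𝔽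
      open Probability 𝔽
      open Knapsack 𝔽
  in
  (n : ℕ) (f : Subset n → Carrier) (c : Fin n → Carrier) (B ε : Carrier) →
  (∀ X → 0# ≤ f X) →
  Submodular f →
  (∀ u → 0# < c u) →
  0# < B →
  (∀ u → c u ≤ B) →
  0# < ε →
  ε < 1# →
  (usm : Subset n → Dist (Subset n)) → IsUSM f ε usm →
  (argMax : ArgMax) →
  (u* : Fin n) → (∀ u → f ⁅ u ⁆ ≤ f ⁅ u* ⁆) →
  let S = Algorithm.parSKP argMax usm B f c u* (fromℕ 4 ⁻¹) ε
  in
  AlmostSurely (Feasible c B) S ×
  (∀ OPT → IsMaximum f (Feasible c B) OPT →
    (fromℕ 8 ⁻¹ - ε) * OPT ≤ 𝔼 f S)
theorem2 𝔽 n f c B ε 0≤f submodular 0<c 0<B c≤B 0<ε ε<1 usm isUSM argMax u* u*-max =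
  parSKP-feasible , parSKP-approximation
  where
  open Analysis.ParSKP 𝔽 n f c B ε 0≤f submodular 0<c 0<B c≤B 0<ε ε<1 usm isUSM argMax u* u*-max
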